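{- Let $m$ be an integer such that $q=2m^2+2m+1$ is a prime power, and put $n=2q+2=4(m^2+m+1)$. Then there exists a biregular Hadamard matrix of order $n$ with maximum excess, i.e. whose excess equals the upper bound $n(t+4)-4s$ described in the context. In particular, the Hadamard matrix \[ H=\begin{pmatrix} 1 & -1 & \mathbf{1}_q^{\top} & \mathbf{1}_q^{\top}\\ -1 & -1 & \mathbf{1}_q^{\top} & -\mathbf{1}_q^{\top}\\ \mathbf{1}_q & \mathbf{1}_q & M_1 & M_2\\ \mathbf{1}_q & -\mathbf{1}_q & M_2 & M_3\end{pmatrix} \] can be transformed into a biregular Hadamard matrix with maximum excess by multiplying some of its rows and some of its columns by $-1$. Here $M$ is the $q\times q$ matrix with rows and columns indexed by $\mathbb{F}_q$ and $M_{i,j}=0$ if $j=i$, $M_{i,j}=1$ if $j-i$ is a nonzero square of $\mathbb{F}_q$, $M_{i,j}=-1$ if $j-i$ is a nonsquare; and $M_1=M+I_q$, $M_2=M-I_q$, $M_3=-M_1$.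
   Context: An Hadamard matrix of order $n$ is an $n\times n$ matrix $H$ with entries in $\{1,-1\}$ such that $HH^{\top}=nI_n$. Its excess $E(H)$ is the sum of all its entries. $\mathbf{1}_n$ is the all-one column vector of length $n$. $H$ is called biregular if the entries of $H\mathbf{1}_n$ take exactly two values, both nonnegative integers. Known upper bound on the excess: let $k$ be the even integer with $k\le\sqrt{n}<k+2$; put $t=k$ if $|n-k^2|<|n-(k+2)^2|$ and $t=k-2$ otherwise; let $s$ be the integer part of $n((t+4)^2-n)/(8t+16)$. Then every Hadamard matrix $H$ of order $n$ satisfies $E(H)\le n(t+4)-4s$; "maximum excess" means $E(H)=n(t+4)-4s$. For $q\equiv 1 \pmod 4$ the matrix $H$ in the claim is an Hadamard matrix of order $2q+2$. -}

module Defs where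

open import Data.Nat as ℕ using (ℕ; zero; suc; _<ᵇ_)
open import Data.Nat.Divisibility using (_∣_)
open import Data.Nat.Primality using (Prime)
open import Data.Integer as ℤ using (ℤ; +_; ∣_∣; _/ℕ_)
open import Data.Fin as Fin using (Fin; splitAt)
open import Data.Fin.Properties using (any?)
open import Data.Sum using (inj₁; inj₂)
open import Data.Product using (Σ; ∃; _×_; _,_)
open import Data.Bool using (Bool; true; false; if_then_else_)
open import Relation.Nullary using (¬_; Dec; yes; no)
open import Relation.Nullary.Decidable using (⌊_⌋)
open import Relation.Binary.PropositionalEquality using (_≡_; _≢_)
open import Relation.Binary.Definitions using (DecidableEquality)
open import Function.Bundles using (_↔_; Inverse)
open import Level using (0ℓ)
open import Algebra.Structures using (IsCommutativeRing)

IsPrimePower : ℕ → Set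
IsPrimePower q = Σ ℕ λ p → Σ ℕ λ e → Prime p × 1 ℕ.≤ e × q ≡ p ℕ.^ e

∑ : ∀ {n} → (Fin n → ℤ) → ℤ
∑ {zero}  f = + 0
∑ {suc n} f = f Fin.zero ℤ.+ ∑ (λ i → f (Fin.suc i))

Matrix : ℕ → Set
Matrix n = Fin n → Fin n → ℤ

IsHadamard : (n : ℕ) → Matrix n → Set
IsHadamard n H =
  (∀ i j → H i j ≡ + 1 Data.Sum.⊎ H i j ≡ ℤ.- + 1) ×
  (∀ i → ∑ (λ l → H i l ℤ.* H i l) ≡ + n) ×
  (∀ i j → i ≢ j → ∑ (λ l → H i l ℤ.* H j l) ≡ + 0)

excess : ∀ {n} → Matrix n → ℤ
excess H = ∑ (λ i → ∑ (λ j → H i j))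

rowSum : ∀ {n} → Matrix n → Fin n → ℤ
rowSum H i = ∑ (λ j → H i j)

IsBiregular : ∀ {n} → Matrix n → Set
IsBiregular {n} H = Σ ℤ λ a → Σ ℤ λ b →
  a ≢ b × + 0 ℤ.≤ a × + 0 ℤ.≤ b ×
  (∀ i → rowSum H i ≡ a Data.Sum.⊎ rowSum H i ≡ b) ×
  (∃ λ i → rowSum H i ≡ a) × (∃ λ i → rowSum H i ≡ b)

IsEvenSqrtFloor : ℕ → ℕ → Set
IsEvenSqrtFloor n k = 2 ∣ k × k ℕ.* k ℕ.≤ n × n ℕ.< (k ℕ.+ 2) ℕ.* (k ℕ.+ 2)

tOf : ℕ → ℕ → ℤ
tOf n k =
  if ∣ + n ℤ.- + (k ℕ.* k) ∣ <ᵇ ∣ + n ℤ.- + ((k ℕ.+ 2) ℕ.* (k ℕ.+ 2)) ∣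
  then + k else + k ℤ.- + 2

-- integer part of a / d, for a positive denominator d
-- (convention: 0 when d ≤ 0, a case that never arises for n ≥ 4)
intPart : ℤ → ℤ → ℤ
intPart a (+ suc d) = a /ℕ suc d
intPart a _         = + 0

sOf : ℕ → ℕ → ℤ
sOf n k = intPart (+ n ℤ.* ((t ℤ.+ + 4) ℤ.* (t ℤ.+ + 4) ℤ.- + n))
                  (+ 8 ℤ.* t ℤ.+ + 16)
  where t = tOf n k

excessBound : ℕ → ℕ → ℤ
excessBound n k = + n ℤ.* (tOf n k ℤ.+ + 4) ℤ.- + 4 ℤ.* sOf n k

-- H has maximum excess: E(H) equals the bound (k being the even integer
-- with k ≤ √n < k+2, which is unique)
HasMaxExcess : ∀ {n} → Matrix n → Set
HasMaxExcess {n} H = ∀ k → IsEvenSqrtFloor n k → excess H ≡ excessBound n k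

record FiniteField (q : ℕ) : Set₁ where
  field
    Carrier : Set
    _+_ _*_ : Carrier → Carrier → Carrier
    -_      : Carrier → Carrier
    0# 1#   : Carrier
    isCommutativeRing : IsCommutativeRing _≡_ _+_ _*_ -_ 0# 1#
    0≢1     : 0# ≢ 1#
    inverse : ∀ x → x ≢ 0# → ∃ λ y → x * y ≡ 1#
    _≟_     : DecidableEquality Carrier
    enum    : Fin q ↔ Carrier

  elt : Fin q → Carrier
  elt = Inverse.to enum

  _-_ : Carrier → Carrier → Carrier
  x - y = x + (- y)

  isSquare? : (x : Carrier) → Dec (∃ λ a → elt a * elt a ≡ x)
  isSquare? x = any? (λ a → (elt a * elt a) ≟ x)

module Construction {q : ℕ} (F : FiniteField q) where
  open FiniteField F

  M : Fin q → Fin q → ℤ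
  M a b with elt a ≟ elt b
  ... | yes _ = + 0
  ... | no  _ = if ⌊ isSquare? (elt b - elt a) ⌋ then + 1 else ℤ.- + 1

  δ : Fin q → Fin q → ℤ
  δ a b = if ⌊ elt a ≟ elt b ⌋ then + 1 else + 0

  M₁ M₂ M₃ : Fin q → Fin q → ℤ
  M₁ a b = M a b ℤ.+ δ a b
  M₂ a b = M a b ℤ.- δ a b
  M₃ a b = ℤ.- M₁ a b

  -- order 2q + 2, indices: 0, 1, then q indices of block 3, q of block 4
  order : ℕ
  order = 2 ℕ.+ (q ℕ.+ q)

  H : Matrix order
  H Fin.zero Fin.zero = + 1
  H Fin.zero (Fin.suc Fin.zero) = ℤ.- + 1
  H Fin.zero (Fin.suc (Fin.suc j)) = + 1
  H (Fin.suc Fin.zero) Fin.zero = ℤ.- + 1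
  H (Fin.suc Fin.zero) (Fin.suc Fin.zero) = ℤ.- + 1
  H (Fin.suc Fin.zero) (Fin.suc (Fin.suc j)) with splitAt q j
  ... | inj₁ _ = + 1
  ... | inj₂ _ = ℤ.- + 1
  H (Fin.suc (Fin.suc i)) Fin.zero = + 1
  H (Fin.suc (Fin.suc i)) (Fin.suc Fin.zero) with splitAt q i
  ... | inj₁ _ = + 1
  ... | inj₂ _ = ℤ.- + 1
  H (Fin.suc (Fin.suc i)) (Fin.suc (Fin.suc j)) with splitAt q i | splitAt q j
  ... | inj₁ a | inj₁ b = M₁ a b
  ... | inj₁ a | inj₂ b = M₂ a b
  ... | inj₂ a | inj₁ b = M₂ a b
  ... | inj₂ a | inj₂ b = M₃ a b

sign : Bool → ℤ
sign true  = ℤ.- + 1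
sign false = + 1

rescale : ∀ {n} → (Fin n → Bool) → (Fin n → Bool) → Matrix n → Matrix n
rescale r c H i j = sign (r i) ℤ.* H i j ℤ.* sign (c j)

qOf : ℤ → ℕ
qOf m = ∣ + 2 ℤ.* m ℤ.* m ℤ.+ + 2 ℤ.* m ℤ.+ + 1 ∣

{-# OPTIONS --safe #-}
module Submission where

-- Let q = 4t + 1 and let C be the symmetric conference matrix of order q + 1 on the projective line
-- over F, so that H = (C+I, C-I; C-I, -C-I).  Fix a nonsquare g and a quartic character ψ of F, and
-- put w(x) = ψ(x² - g), w(∞) = 1.  The torus F(√g)ˣ acts on the line, and its equivariance gives
-- C w = J w̄ with J = A + Bi = ∑ ψ(x² - g).  Encoding w = u + iv by the column signs u + v, u - v, the
-- row sums of H become ±2A, ±2(B+1), ±2(B-1).  As H is symmetric, the squares of the row sums add up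
-- to n², whence A² + B² = q; reducing J modulo a prime above p (a binomial coefficient without
-- carries) shows that p does not divide J.  So {|A|, |B|} = {m, m+1}, the absolute row sums take the
-- values 2m, 2m+4 or 2m+2, 2m-2, and again the sum of their squares determines the excess n(2m+1).
--
-- A field of order q = pᵉ exists because e is a power of 2: if e = 2ᵏ o with o odd, then
-- (A + Bi)ᵒ, with A + Bi the sum J for the field of order p^(2ᵏ), is m + (m+1)i up to units and
-- conjugation, and a 2-adic argument forces o = 1.

open import Defs
open import Level using (0ℓ)
open import Algebra.Bundles using (AbelianGroup; CommutativeMonoid; CommutativeRing)
open import Algebra.Structures using (IsCommutativeRing)
import Algebra.Properties.AbelianGroup
import Algebra.Properties.CommutativeMonoid.Sum
import Algebra.Properties.CommutativeSemiring.Binomial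
import Algebra.Properties.CommutativeSemiring.Exp
import Algebra.Properties.Group
import Algebra.Properties.Monoid.Mult.TCOptimised
import Algebra.Properties.Ring
import Algebra.Properties.Semiring.Exp
import Algebra.Properties.Semiring.Mult
import Algebra.Properties.Semiring.Mult.TCOptimised
import Algebra.Properties.Semiring.Sum
import Algebra.Solver.Ring
import Algebra.Solver.Ring.AlmostCommutativeRing as ACR
open import Data.Bool as Bool using (Bool; true; false; if_then_else_)
open import Data.Empty using (⊥)
open import Data.Fin as Fin using (Fin; punchIn; splitAt; toℕ; _↑ˡ_; _↑ʳ_)
import Data.Fin.Properties as Finₚ
open import Data.Integer as ℤ using (ℤ; +_; -[1+_]; _⊖_; ∣_∣)
open import Data.Integer.Divisibility.Signed as ℤ∣ using () renaming (_∣_ to _∣ℤ_)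
import Data.Integer.Properties as ℤₚ
open import Data.Integer.Tactic.RingSolver using () renaming (solve-∀ to ℤ-ring)
open import Data.Maybe using (Maybe; just; nothing)
open import Data.Nat as ℕ using (ℕ; zero; suc; NonZero; pred; s≤s; z≤n; _!; _<_; _≤_; _∸_; _<ᵇ_)
open import Data.Nat.Combinatorics using (k![n∸k]!∣n!) renaming (_C_ to _choose_)
open import Data.Nat.Combinatorics.Specification using (nCk≡n!/k![n-k]!)
open import Data.Nat.Coprimality using (Coprime; coprime-Bézout; prime⇒coprime)
open import Data.Nat.DivMod using (_/_; _%_; _mod_; m%n<n; m<n⇒m%n≡m; %-distribˡ-+; %-distribˡ-*; n%n≡0; m*n%n≡0; m*n/n≡m; m/n*n≡m)
open import Data.Nat.Divisibility as ∣ using (_∣_; divides)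
open import Data.Nat.GCD using (module Bézout)
open import Data.Nat.Induction using (<-rec)
open import Data.Nat.Primality using (Prime; euclidsLemma; prime⇒irreducible; prime⇒nonTrivial; prime⇒nonZero; prime[2])
import Data.Nat.Properties as ℕₚ
open import Data.Nat.Tactic.RingSolver using () renaming (solve-∀ to ℕ-ring)
open import Data.Product using (Σ; ∃; _×_; _,_; proj₁; proj₂)
open import Data.Product.Function.NonDependent.Propositional using (_×-↔_)
open import Data.Product.Properties using (≡-dec)
open import Data.Sum as Sum using (_⊎_; inj₁; inj₂; [_,_]′)
open import Data.Unit using (tt)
open import Data.Vec using (Vec; []; _∷_; replicate)
open import Function.Base using (_∘_)
open import Function.Bundles using (Inverse; mk↔ₛ′)
open import Function.Construct.Composition using (_↔-∘_)
open import Function.Construct.Identity using (↔-id)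
open import Function.Construct.Symmetry using (↔-sym)
open import Relation.Binary.Definitions using (tri<; tri≈; tri>)
open import Relation.Binary.PropositionalEquality using (_≡_; _≢_; refl; sym; trans; cong; cong₂; subst; isEquivalence; module ≡-Reasoning)
import Relation.Binary.Reasoning.Setoid
open import Relation.Nullary using (¬_; Dec; yes; no; contradiction)
open import Relation.Nullary.Decidable using (⌊_⌋)

open Algebra.Properties.Group (AbelianGroup.group ℤₚ.+-0-abelianGroup) using () renaming (∙-cancelˡ to +-cancelˡ)

module IntegerImage (R : CommutativeRing 0ℓ 0ℓ) where
  open CommutativeRing R
    using (Carrier; _≈_; _+_; _*_; -_; 0#; 1#; setoid; semiring; ring; +-abelianGroup;
           +-cong; +-congˡ; +-congʳ; *-cong; -‿cong; +-assoc; +-comm; +-identityˡ; +-identityʳ; -‿inverseʳ)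
  open CommutativeRing R using () renaming (refl to ≈-refl; sym to ≈-sym; trans to ≈-trans)
  open Algebra.Properties.Semiring.Mult.TCOptimised semiring
    using (1+×; ×-homo-+; ×1-homo-*) renaming (_×_ to _·_)
  open Algebra.Properties.Ring ring using (-‿distribˡ-*; -‿distribʳ-*; -0#≈0#; -‿involutive)
  open Algebra.Properties.AbelianGroup +-abelianGroup using (⁻¹-∙-comm)
  open Relation.Binary.Reasoning.Setoid setoid

  ⟦_⟧ : ℤ → Carrier
  ⟦ + n ⟧      = n · 1#
  ⟦ -[1+ n ] ⟧ = - (suc n · 1#)

  ⟦⟧-⊖ : ∀ m n → ⟦ m ⊖ n ⟧ ≈ m · 1# + - (n · 1#)
  ⟦⟧-⊖ m       zero    = ≈-sym (≈-trans (+-congˡ -0#≈0#) (+-identityʳ _))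
  ⟦⟧-⊖ zero    (suc n) = ≈-sym (+-identityˡ _)
  ⟦⟧-⊖ (suc m) (suc n) = begin
    ⟦ suc m ⊖ suc n ⟧ ≡⟨ cong ⟦_⟧ (ℤₚ.[1+m]⊖[1+n]≡m⊖n m n) ⟩
    ⟦ m ⊖ n ⟧                                  ≈⟨ ⟦⟧-⊖ m n ⟩
    m · 1# + - (n · 1#)                        ≈⟨ +-congʳ (≈-sym (+-identityˡ _)) ⟩
    (0# + m · 1#) + - (n · 1#)                 ≈⟨ +-congʳ (+-congʳ (≈-sym (-‿inverseʳ 1#))) ⟩
    ((1# + - 1#) + m · 1#) + - (n · 1#)        ≈⟨ +-congʳ (≈-trans (+-assoc _ _ _) (≈-trans (+-congˡ (+-comm _ _)) (≈-sym (+-assoc _ _ _)))) ⟩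
    ((1# + m · 1#) + - 1#) + - (n · 1#)        ≈⟨ +-assoc _ _ _ ⟩
    (1# + m · 1#) + (- 1# + - (n · 1#))        ≈⟨ +-cong (≈-sym (1+× m 1#)) (⁻¹-∙-comm 1# _) ⟩
    suc m · 1# + - (1# + n · 1#)               ≈⟨ +-congˡ (-‿cong (≈-sym (1+× n 1#))) ⟩
    suc m · 1# + - (suc n · 1#) ∎

  ⟦⟧-neg : ∀ i → ⟦ ℤ.- i ⟧ ≈ - ⟦ i ⟧
  ⟦⟧-neg (+ zero)   = ≈-sym -0#≈0#
  ⟦⟧-neg (+ suc n)  = ≈-refl
  ⟦⟧-neg -[1+ n ]   = ≈-sym (-‿involutive _)

  ⟦⟧-+ : ∀ i j → ⟦ i ℤ.+ j ⟧ ≈ ⟦ i ⟧ + ⟦ j ⟧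
  ⟦⟧-+ (+ m)    (+ n)    = ×-homo-+ 1# m n
  ⟦⟧-+ (+ m)    -[1+ n ] = ⟦⟧-⊖ m (suc n)
  ⟦⟧-+ -[1+ m ] (+ n)    = ≈-trans (⟦⟧-⊖ n (suc m)) (+-comm _ _)
  ⟦⟧-+ -[1+ m ] -[1+ n ] = ≈-trans (-‿cong (≈-trans (reflexive′ (cong (λ k → suc k · 1#) (sym (ℕₚ.+-suc m n)))) (×-homo-+ 1# (suc m) (suc n)))) (≈-sym (⁻¹-∙-comm _ _))
    where
    reflexive′ : ∀ {x y} → x ≡ y → x ≈ y
    reflexive′ refl = ≈-refl

  ⟦⟧-*⁺ : ∀ m j → ⟦ + m ℤ.* j ⟧ ≈ ⟦ + m ⟧ * ⟦ j ⟧
  ⟦⟧-*⁺ m (+ n)    = begin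
    ⟦ + m ℤ.* + n ⟧ ≡⟨ cong ⟦_⟧ (sym (ℤₚ.pos-* m n)) ⟩
    ⟦ + (m ℕ.* n) ⟧ ≈⟨ ×1-homo-* m n ⟩
    ⟦ + m ⟧ * ⟦ + n ⟧ ∎
  ⟦⟧-*⁺ m -[1+ n ] = begin
    ⟦ + m ℤ.* ℤ.- + suc n ⟧ ≡⟨ cong ⟦_⟧ (sym (ℤₚ.neg-distribʳ-* (+ m) (+ suc n))) ⟩
    ⟦ ℤ.- (+ m ℤ.* + suc n) ⟧   ≈⟨ ⟦⟧-neg (+ m ℤ.* + suc n) ⟩
    - ⟦ + m ℤ.* + suc n ⟧       ≈⟨ -‿cong (⟦⟧-*⁺ m (+ suc n)) ⟩
    - (⟦ + m ⟧ * ⟦ + suc n ⟧)   ≈⟨ -‿distribʳ-* _ _ ⟩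
    ⟦ + m ⟧ * ⟦ -[1+ n ] ⟧ ∎

  ⟦⟧-* : ∀ i j → ⟦ i ℤ.* j ⟧ ≈ ⟦ i ⟧ * ⟦ j ⟧
  ⟦⟧-* (+ m)    j = ⟦⟧-*⁺ m j
  ⟦⟧-* -[1+ m ] j = begin
    ⟦ ℤ.- + suc m ℤ.* j ⟧ ≡⟨ cong ⟦_⟧ (sym (ℤₚ.neg-distribˡ-* (+ suc m) j)) ⟩
    ⟦ ℤ.- (+ suc m ℤ.* j) ⟧     ≈⟨ ⟦⟧-neg (+ suc m ℤ.* j) ⟩
    - ⟦ + suc m ℤ.* j ⟧         ≈⟨ -‿cong (⟦⟧-*⁺ (suc m) j) ⟩
    - (⟦ + suc m ⟧ * ⟦ j ⟧)     ≈⟨ -‿distribˡ-* _ _ ⟩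
    ⟦ -[1+ m ] ⟧ * ⟦ j ⟧ ∎

  almostCommutativeRing : ACR.AlmostCommutativeRing 0ℓ 0ℓ
  almostCommutativeRing = ACR.fromCommutativeRing R

  morphism : CommutativeRing.rawRing ℤₚ.+-*-commutativeRing ACR.-Raw-AlmostCommutative⟶ almostCommutativeRing
  morphism = record
    { ⟦_⟧ = ⟦_⟧ ; +-homo = ⟦⟧-+ ; *-homo = ⟦⟧-* ; -‿homo = ⟦⟧-neg ; 0-homo = ≈-refl ; 1-homo = ≈-refl }

  ⟦⟧-≟ : ∀ i j → Maybe (⟦ i ⟧ ≈ ⟦ j ⟧)
  ⟦⟧-≟ i j with i ℤ.≟ j
  ... | yes refl = just ≈-refl
  ... | no _     = nothing

  module Solver = Algebra.Solver.Ring (CommutativeRing.rawRing ℤₚ.+-*-commutativeRing) almostCommutativeRing morphism ⟦⟧-≟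

open ≡-Reasoning

1+4×_ : ℕ → ℕ
1+4× t = suc ((t ℕ.+ t) ℕ.+ (t ℕ.+ t))

-- Pairs (a , b) stand for a + b √d.
module Adjoin√
  {A : Set} {_+_ _*_ : A → A → A} { -_ : A → A} {0# 1# : A}
  (isCommutativeRing : IsCommutativeRing _≡_ _+_ _*_ -_ 0# 1#) (d : A) where

  ring : CommutativeRing 0ℓ 0ℓ
  ring = record { isCommutativeRing = isCommutativeRing }

  private
    module R = CommutativeRing ring
  open IntegerImage ring using (module Solver)
  open Solver

  _⊕_ _⊗_ : A × A → A × A → A × A
  (a , b) ⊕ (a′ , b′) = (a + a′) , (b + b′)
  (a , b) ⊗ (a′ , b′) = ((a * a′) + (d * (b * b′))) , ((a * b′) + (b * a′))

  ⊝_ : A × A → A × A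
  ⊝ (a , b) = (- a) , (- b)

  isCommutativeRing′ : IsCommutativeRing _≡_ _⊕_ _⊗_ ⊝_ (0# , 0#) (1# , 0#)
  isCommutativeRing′ = record
    { isRing = record
      { +-isAbelianGroup = record
        { isGroup = record
          { isMonoid = record
            { isSemigroup = record
              { isMagma = record { isEquivalence = isEquivalence ; ∙-cong = cong₂ _⊕_ }
              ; assoc = λ { (a , b) (a′ , b′) (a″ , b″) → cong₂ _,_ (R.+-assoc a a′ a″) (R.+-assoc b b′ b″) } }
            ; identity = (λ { (a , b) → cong₂ _,_ (R.+-identityˡ a) (R.+-identityˡ b) })
                       , (λ { (a , b) → cong₂ _,_ (R.+-identityʳ a) (R.+-identityʳ b) }) }
          ; inverse = (λ { (a , b) → cong₂ _,_ (R.-‿inverseˡ a) (R.-‿inverseˡ b) })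
                    , (λ { (a , b) → cong₂ _,_ (R.-‿inverseʳ a) (R.-‿inverseʳ b) })
          ; ⁻¹-cong = cong ⊝_ }
        ; comm = λ { (a , b) (a′ , b′) → cong₂ _,_ (R.+-comm a a′) (R.+-comm b b′) } }
      ; *-cong = cong₂ _⊗_
      ; *-assoc = λ { (a , b) (a′ , b′) (a″ , b″) → cong₂ _,_
          (solve 7 (λ d a b a′ b′ a″ b″ →
             (a :* a′ :+ d :* (b :* b′)) :* a″ :+ d :* ((a :* b′ :+ b :* a′) :* b″)
             := a :* (a′ :* a″ :+ d :* (b′ :* b″)) :+ d :* (b :* (a′ :* b″ :+ b′ :* a″))) refl d a b a′ b′ a″ b″)
          (solve 7 (λ d a b a′ b′ a″ b″ →
             (a :* a′ :+ d :* (b :* b′)) :* b″ :+ (a :* b′ :+ b :* a′) :* a″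
             := a :* (a′ :* b″ :+ b′ :* a″) :+ b :* (a′ :* a″ :+ d :* (b′ :* b″))) refl d a b a′ b′ a″ b″) }
      ; *-identity =
          (λ { (a , b) → cong₂ _,_
            (solve 3 (λ d a b → con (+ 1) :* a :+ d :* (con (+ 0) :* b) := a) refl d a b)
            (solve 2 (λ a b → con (+ 1) :* b :+ con (+ 0) :* a := b) refl a b) })
        , (λ { (a , b) → cong₂ _,_
            (solve 3 (λ d a b → a :* con (+ 1) :+ d :* (b :* con (+ 0)) := a) refl d a b)
            (solve 2 (λ a b → a :* con (+ 0) :+ b :* con (+ 1) := b) refl a b) })
      ; distrib =
          (λ { (a , b) (a′ , b′) (a″ , b″) → cong₂ _,_
            (solve 7 (λ d a b a′ b′ a″ b″ →
               a :* (a′ :+ a″) :+ d :* (b :* (b′ :+ b″))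
               := (a :* a′ :+ d :* (b :* b′)) :+ (a :* a″ :+ d :* (b :* b″))) refl d a b a′ b′ a″ b″)
            (solve 6 (λ a b a′ b′ a″ b″ →
               a :* (b′ :+ b″) :+ b :* (a′ :+ a″)
               := (a :* b′ :+ b :* a′) :+ (a :* b″ :+ b :* a″)) refl a b a′ b′ a″ b″) })
        , (λ { (a , b) (a′ , b′) (a″ , b″) → cong₂ _,_
            (solve 7 (λ d a b a′ b′ a″ b″ →
               (a′ :+ a″) :* a :+ d :* ((b′ :+ b″) :* b)
               := (a′ :* a :+ d :* (b′ :* b)) :+ (a″ :* a :+ d :* (b″ :* b))) refl d a b a′ b′ a″ b″)
            (solve 6 (λ a b a′ b′ a″ b″ →
               (a′ :+ a″) :* b :+ (b′ :+ b″) :* a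
               := (a′ :* b :+ b′ :* a) :+ (a″ :* b :+ b″ :* a)) refl a b a′ b′ a″ b″) }) }
    ; *-comm = λ { (a , b) (a′ , b′) → cong₂ _,_
        (solve 5 (λ d a b a′ b′ → a :* a′ :+ d :* (b :* b′) := a′ :* a :+ d :* (b′ :* b)) refl d a b a′ b′)
        (solve 4 (λ a b a′ b′ → a :* b′ :+ b :* a′ := a′ :* b :+ b′ :* a) refl a b a′ b′) }
    }

  ring′ : CommutativeRing 0ℓ 0ℓ
  ring′ = record { isCommutativeRing = isCommutativeRing′ }

module FiniteSum (M : CommutativeMonoid 0ℓ 0ℓ) where
  open CommutativeMonoid M renaming (refl to ≈-refl; sym to ≈-sym; trans to ≈-trans)
  open Algebra.Properties.CommutativeMonoid.Sum M

  sum-ε : ∀ {n} (f : Fin n → Carrier) → (∀ i → f i ≈ ε) → sum f ≈ ε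
  sum-ε {n} f f≈ε = ≈-trans (sum-cong-≋ f≈ε) (sum-replicate-zero n)

  sum-single : ∀ {n} (f : Fin n → Carrier) j → (∀ i → i ≢ j → f i ≈ ε) → sum f ≈ f j
  sum-single {suc n} f j off = ≈-trans (sum-remove {i = j} f)
    (≈-trans (∙-congˡ (sum-ε _ (λ i → off (punchIn j i) (Finₚ.punchInᵢ≢i j i)))) (identityʳ _))

  module Over {q : ℕ} (F : FiniteField q) where
    open FiniteField F using (elt; enum) renaming (Carrier to K)

    total : (K → Carrier) → Carrier
    total f = sum (λ i → f (elt i))

    total-single : ∀ f (k : K) → (∀ x → x ≢ k → f x ≈ ε) → total f ≈ f k
    total-single f k off = ≈-trans (sum-single (λ i → f (elt i)) (Inverse.from enum k)
        λ i i≢ → off (elt i) (λ e → i≢ (trans (sym (Inverse.strictlyInverseʳ enum i)) (cong (Inverse.from enum) e))))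
      (reflexive (cong f (Inverse.strictlyInverseˡ enum k)))

    total-bijection : ∀ f (σ τ : K → K) → (∀ x → σ (τ x) ≡ x) → (∀ x → τ (σ x) ≡ x) →
                      total f ≈ total (f ∘ σ)
    total-bijection f σ τ στ τσ = ≈-trans
      (sum-permute (λ i → f (elt i)) π)
      (sum-cong-≋ (λ i → reflexive (cong f (Inverse.strictlyInverseˡ enum (σ (elt i))))))
      where
      π = ↔-sym enum ↔-∘ (mk↔ₛ′ σ τ στ τσ ↔-∘ enum)

private
  module ℤ-sum where
    open Algebra.Properties.Semiring.Sum (CommutativeRing.semiring ℤₚ.+-*-commutativeRing) public
    open FiniteSum ℤₚ.+-0-commutativeMonoid public

∑≡sum : ∀ {n} (f : Fin n → ℤ) → ∑ f ≡ ℤ-sum.sum f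
∑≡sum {zero}  f = refl
∑≡sum {suc n} f = cong (λ s → f Fin.zero ℤ.+ s) (∑≡sum (f ∘ Fin.suc))

∑-cong : ∀ {n} {f g : Fin n → ℤ} → (∀ i → f i ≡ g i) → ∑ f ≡ ∑ g
∑-cong {zero}  e = refl
∑-cong {suc n} e = cong₂ ℤ._+_ (e Fin.zero) (∑-cong (e ∘ Fin.suc))

∑-+ : ∀ {n} (f g : Fin n → ℤ) → ∑ (λ i → f i ℤ.+ g i) ≡ ∑ f ℤ.+ ∑ g
∑-+ f g = trans (∑≡sum (λ i → f i ℤ.+ g i))
  (trans (ℤ-sum.∑-distrib-+ f g) (cong₂ ℤ._+_ (sym (∑≡sum f)) (sym (∑≡sum g))))

∑-*ˡ : ∀ {n} c (f : Fin n → ℤ) → ∑ (λ i → c ℤ.* f i) ≡ c ℤ.* ∑ f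
∑-*ˡ c f = trans (∑≡sum (λ i → c ℤ.* f i))
  (trans (sym (ℤ-sum.*-distribˡ-sum c f)) (cong (c ℤ.*_) (sym (∑≡sum f))))

∑-comm : ∀ {m n} (f : Fin m → Fin n → ℤ) → ∑ (λ i → ∑ (f i)) ≡ ∑ (λ j → ∑ (λ i → f i j))
∑-comm f = begin
  ∑ (λ i → ∑ (f i)) ≡⟨ ∑-cong (λ i → ∑≡sum (f i)) ⟩
  ∑ (λ i → ℤ-sum.sum (f i)) ≡⟨ ∑≡sum (λ i → ℤ-sum.sum (f i)) ⟩
  ℤ-sum.sum (λ i → ℤ-sum.sum (f i)) ≡⟨ ℤ-sum.∑-comm f ⟩
  ℤ-sum.sum (λ j → ℤ-sum.sum (λ i → f i j)) ≡⟨ ∑≡sum (λ j → ℤ-sum.sum (λ i → f i j)) ⟨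
  ∑ (λ j → ℤ-sum.sum (λ i → f i j)) ≡⟨ ∑-cong (λ j → ∑≡sum (λ i → f i j)) ⟨
  ∑ (λ j → ∑ (λ i → f i j)) ∎

∑-const : ∀ n c → ∑ {n} (λ _ → c) ≡ + n ℤ.* c
∑-const zero    c = refl
∑-const (suc n) c = trans (cong (λ s → c ℤ.+ s) (∑-const n c)) (sym (ℤₚ.suc-* (+ n) c))

∑-single : ∀ {n} (f : Fin n → ℤ) j → (∀ i → i ≢ j → f i ≡ + 0) → ∑ f ≡ f j
∑-single f j off = trans (∑≡sum f) (ℤ-sum.sum-single f j off)

∑-++ : ∀ m {n} (f : Fin (m ℕ.+ n) → ℤ) → ∑ f ≡ ∑ (λ i → f (i ↑ˡ n)) ℤ.+ ∑ (λ j → f (m ↑ʳ j))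
∑-++ zero    f = sym (ℤₚ.+-identityˡ _)
∑-++ (suc m) f = trans (cong (λ s → f Fin.zero ℤ.+ s) (∑-++ m (f ∘ Fin.suc))) (sym (ℤₚ.+-assoc (f Fin.zero) _ _))

∑-nonneg : ∀ {n} (f : Fin n → ℤ) → (∀ i → + 0 ℤ.≤ f i) → + 0 ℤ.≤ ∑ f
∑-nonneg {zero}  f f≥0 = ℤₚ.≤-refl
∑-nonneg {suc n} f f≥0 = ℤₚ.+-mono-≤ (f≥0 Fin.zero) (∑-nonneg (f ∘ Fin.suc) (f≥0 ∘ Fin.suc))

∑-nonneg-zero : ∀ {n} (f : Fin n → ℤ) → (∀ i → + 0 ℤ.≤ f i) → ∑ f ≡ + 0 → ∀ i → f i ≡ + 0
∑-nonneg-zero {suc n} f f≥0 e i = go i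
  where
  rest≥0 : + 0 ℤ.≤ ∑ (f ∘ Fin.suc)
  rest≥0 = ∑-nonneg (f ∘ Fin.suc) (f≥0 ∘ Fin.suc)
  head≡0 : f Fin.zero ≡ + 0
  head≡0 = ℤₚ.≤-antisym
    (subst (f Fin.zero ℤ.≤_) e (subst (ℤ._≤ ∑ f) (ℤₚ.+-identityʳ _) (ℤₚ.+-monoʳ-≤ (f Fin.zero) rest≥0)))
    (f≥0 Fin.zero)
  rest≡0 : ∑ (f ∘ Fin.suc) ≡ + 0
  rest≡0 = trans (sym (ℤₚ.+-identityˡ _)) (trans (cong (ℤ._+ ∑ (f ∘ Fin.suc)) (sym head≡0)) e)
  go : ∀ i → f i ≡ + 0
  go Fin.zero    = head≡0
  go (Fin.suc i) = ∑-nonneg-zero (f ∘ Fin.suc) (f≥0 ∘ Fin.suc) rest≡0 i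

∑-isometry : ∀ {n} (S : Fin n → Fin n → ℤ) (k : ℤ) → (∀ i j → S i j ≡ S j i) →
  (∀ i → ∑ (λ l → S i l ℤ.* S i l) ≡ k) → (∀ i j → i ≢ j → ∑ (λ l → S i l ℤ.* S j l) ≡ + 0) →
  (x : Fin n → ℤ) →
  ∑ (λ i → ∑ (λ j → S i j ℤ.* x j) ℤ.* ∑ (λ j → S i j ℤ.* x j)) ≡ k ℤ.* ∑ (λ j → x j ℤ.* x j)
∑-isometry {n} S k S-sym diag off x = begin
  ∑ (λ i → y i ℤ.* y i)
    ≡⟨ ∑-cong (λ i → trans (sym (∑-*ˡ (y i) (λ j → S i j ℤ.* x j))) (∑-cong λ j → expand i j)) ⟩
  ∑ (λ i → ∑ (λ j → ∑ (λ l → (x j ℤ.* x l) ℤ.* (S j i ℤ.* S l i))))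
    ≡⟨ ∑-comm (λ i j → ∑ (λ l → (x j ℤ.* x l) ℤ.* (S j i ℤ.* S l i))) ⟩
  ∑ (λ j → ∑ (λ i → ∑ (λ l → (x j ℤ.* x l) ℤ.* (S j i ℤ.* S l i))))
    ≡⟨ ∑-cong (λ j → ∑-comm (λ i l → (x j ℤ.* x l) ℤ.* (S j i ℤ.* S l i))) ⟩
  ∑ (λ j → ∑ (λ l → ∑ (λ i → (x j ℤ.* x l) ℤ.* (S j i ℤ.* S l i))))
    ≡⟨ ∑-cong (λ j → ∑-cong (λ l → ∑-*ˡ (x j ℤ.* x l) (λ i → S j i ℤ.* S l i))) ⟩
  ∑ (λ j → ∑ (λ l → (x j ℤ.* x l) ℤ.* ∑ (λ i → S j i ℤ.* S l i)))
    ≡⟨ ∑-cong (λ j → trans (∑-single _ j (λ l l≢j → trans (cong ((x j ℤ.* x l) ℤ.*_) (off j l (l≢j ∘ sym))) (ℤₚ.*-zeroʳ (x j ℤ.* x l))))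
         (trans (cong ((x j ℤ.* x j) ℤ.*_) (diag j)) (ℤₚ.*-comm (x j ℤ.* x j) k))) ⟩
  ∑ (λ j → k ℤ.* (x j ℤ.* x j))
    ≡⟨ ∑-*ˡ k (λ j → x j ℤ.* x j) ⟩
  k ℤ.* ∑ (λ j → x j ℤ.* x j) ∎
  where
  y : Fin n → ℤ
  y i = ∑ (λ j → S i j ℤ.* x j)
  rearrange : ∀ a b c d → (a ℤ.* b) ℤ.* (c ℤ.* d) ≡ (b ℤ.* d) ℤ.* (a ℤ.* c)
  rearrange = ℤ-ring
  expand : ∀ i j → y i ℤ.* (S i j ℤ.* x j) ≡ ∑ (λ l → (x j ℤ.* x l) ℤ.* (S j i ℤ.* S l i))
  expand i j = begin
    y i ℤ.* (S i j ℤ.* x j) ≡⟨ ℤₚ.*-comm (y i) (S i j ℤ.* x j) ⟩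
    (S i j ℤ.* x j) ℤ.* y i ≡⟨ ∑-*ˡ (S i j ℤ.* x j) (λ l → S i l ℤ.* x l) ⟨
    ∑ (λ l → (S i j ℤ.* x j) ℤ.* (S i l ℤ.* x l))
      ≡⟨ ∑-cong (λ l → trans (rearrange (S i j) (x j) (S i l) (x l)) (cong₂ (λ s s′ → (x j ℤ.* x l) ℤ.* (s ℤ.* s′)) (S-sym i j) (S-sym i l))) ⟩
    ∑ (λ l → (x j ℤ.* x l) ℤ.* (S j i ℤ.* S l i)) ∎

module Field {q : ℕ} (F : FiniteField q) where
  open FiniteField F public using (0≢1; inverse; _≟_; elt; enum; isSquare?) renaming (Carrier to K)

  ring : CommutativeRing 0ℓ 0ℓ
  ring = record { isCommutativeRing = FiniteField.isCommutativeRing F }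

  open CommutativeRing ring public
    using (_+_; _*_; -_; _-_; 0#; 1#; +-assoc; +-comm; +-identityˡ; +-identityʳ; -‿inverseˡ; -‿inverseʳ;
           *-assoc; *-comm; *-identityˡ; *-identityʳ; zeroˡ; zeroʳ;
           semiring; commutativeSemiring; +-commutativeMonoid; *-commutativeMonoid)
  open IntegerImage ring public
  open Solver using (solve; _:=_; _:+_; _:*_; _:-_; :-_; con)
  open Algebra.Properties.Semiring.Exp semiring public using (_^_; ^-homo-*; ^-assocʳ)
  open Algebra.Properties.CommutativeSemiring.Exp commutativeSemiring public using (^-distrib-*)

  private
    module Π where
      open Algebra.Properties.CommutativeMonoid.Sum *-commutativeMonoid public
      open FiniteSum *-commutativeMonoid public
      open Over F public

  index : K → Fin q
  index = Inverse.from enum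

  elt-index : ∀ x → elt (index x) ≡ x
  elt-index = Inverse.strictlyInverseˡ enum

  elt-injective : ∀ {i j} → elt i ≡ elt j → i ≡ j
  elt-injective {i} {j} e =
    trans (sym (Inverse.strictlyInverseʳ enum i)) (trans (cong index e) (Inverse.strictlyInverseʳ enum j))

  inv : K → K
  inv x with x ≟ 0#
  ... | yes _   = 0#
  ... | no x≢0 = proj₁ (inverse x x≢0)

  inv-0 : inv 0# ≡ 0#
  inv-0 with 0# ≟ 0#
  ... | yes _   = refl
  ... | no 0≢0 = contradiction refl 0≢0

  *-inv : ∀ {x} → x ≢ 0# → x * inv x ≡ 1#
  *-inv {x} x≢0 with x ≟ 0#
  ... | yes x≡0 = contradiction x≡0 x≢0
  ... | no x≢0′ = proj₂ (inverse x x≢0′)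

  *-cancelˡ : ∀ x {y z} → x ≢ 0# → x * y ≡ x * z → y ≡ z
  *-cancelˡ x {y} {z} x≢0 e = begin
    y ≡⟨ *-identityˡ y ⟨
    1# * y ≡⟨ cong (_* y) (*-inv x≢0) ⟨
    x * inv x * y ≡⟨ solve 3 (λ x i y → x :* i :* y := i :* (x :* y)) refl x (inv x) y ⟩
    inv x * (x * y) ≡⟨ cong (inv x *_) e ⟩
    inv x * (x * z) ≡⟨ solve 3 (λ x i y → x :* i :* y := i :* (x :* y)) refl x (inv x) z ⟨
    x * inv x * z ≡⟨ cong (_* z) (*-inv x≢0) ⟩
    1# * z ≡⟨ *-identityˡ z ⟩
    z ∎

  x*y≡0 : ∀ x y → x * y ≡ 0# → x ≡ 0# ⊎ y ≡ 0#
  x*y≡0 x y e with x ≟ 0#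
  ... | yes x≡0 = inj₁ x≡0
  ... | no x≢0  = inj₂ (*-cancelˡ x x≢0 (trans e (sym (zeroʳ x))))

  *-≢0 : ∀ {x y} → x ≢ 0# → y ≢ 0# → x * y ≢ 0#
  *-≢0 {x} {y} x≢0 y≢0 e with x*y≡0 x y e
  ... | inj₁ x≡0 = x≢0 x≡0
  ... | inj₂ y≡0 = y≢0 y≡0

  ^-≢0 : ∀ {x} n → x ≢ 0# → x ^ n ≢ 0#
  ^-≢0 zero    x≢0 = 0≢1 ∘ sym
  ^-≢0 (suc n) x≢0 = *-≢0 x≢0 (^-≢0 n x≢0)

  1^n≡1 : ∀ n → 1# ^ n ≡ 1#
  1^n≡1 zero    = refl
  1^n≡1 (suc n) = trans (*-identityˡ _) (1^n≡1 n)

  inv-≢0 : ∀ {x} → x ≢ 0# → inv x ≢ 0#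
  inv-≢0 {x} x≢0 e = 0≢1 (trans (sym (zeroʳ x)) (trans (cong (x *_) (sym e)) (*-inv x≢0)))

  inv-involutive : ∀ x → inv (inv x) ≡ x
  inv-involutive x with x ≟ 0#
  ... | yes refl = inv-0
  ... | no x≢0  = *-cancelˡ y y≢0 (trans (*-inv y≢0) (sym (trans (*-comm y x) x*y≡1)))
    where
    y : K
    y = proj₁ (inverse x x≢0)
    x*y≡1 : x * y ≡ 1#
    x*y≡1 = proj₂ (inverse x x≢0)
    y≢0 : y ≢ 0#
    y≢0 e = 0≢1 (trans (sym (zeroʳ x)) (trans (cong (x *_) (sym e)) x*y≡1))

  x-y≡0 : ∀ x y → x - y ≡ 0# → x ≡ y
  x-y≡0 x y e = trans (solve 2 (λ x y → x := x :- y :+ y) refl x y) (trans (cong (_+ y) e) (+-identityˡ y))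

  private
    product-≢0 : ∀ {n} (f : Fin n → K) → (∀ i → f i ≢ 0#) → Π.sum f ≢ 0#
    product-≢0 {zero}  f f≢0 = 0≢1 ∘ sym
    product-≢0 {suc n} f f≢0 = *-≢0 (f≢0 Fin.zero) (product-≢0 (f ∘ Fin.suc) (f≢0 ∘ Fin.suc))

    nonzeroPart : K → K
    nonzeroPart x with x ≟ 0#
    ... | yes _ = 1#
    ... | no _  = x

    nonzeroPart-≢0 : ∀ x → nonzeroPart x ≢ 0#
    nonzeroPart-≢0 x with x ≟ 0#
    ... | yes _   = 0≢1 ∘ sym
    ... | no x≢0 = x≢0

    atZero : K → K → K
    atZero a x with x ≟ 0#
    ... | yes _ = a
    ... | no _  = 1#

    atZero-0 : ∀ a → atZero a 0# ≡ a
    atZero-0 a with 0# ≟ 0#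
    ... | yes _   = refl
    ... | no 0≢0 = contradiction refl 0≢0

    atZero-≢0 : ∀ a x → x ≢ 0# → atZero a x ≡ 1#
    atZero-≢0 a x x≢0 with x ≟ 0#
    ... | yes x≡0 = contradiction x≡0 x≢0
    ... | no _    = refl

    scale : ∀ a x → a ≢ 0# → a * nonzeroPart x ≡ atZero a x * nonzeroPart (a * x)
    scale a x a≢0 with x ≟ 0# | (a * x) ≟ 0#
    ... | yes _    | yes _ = refl
    ... | yes refl | no ne = contradiction (zeroʳ a) ne
    ... | no x≢0  | yes e = contradiction e (*-≢0 a≢0 x≢0)
    ... | no _     | no _  = sym (*-identityˡ _)

  fermat : ∀ a → a ≢ 0# → a ^ q ≡ a
  fermat a a≢0 = *-cancelˡ P P≢0 (begin
    P * a ^ q ≡⟨ *-comm P _ ⟩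
    a ^ q * P ≡⟨ cong (_* P) (Π.sum-replicate q) ⟨
    Π.total (λ _ → a) * P ≡⟨ Π.∑-distrib-+ (λ _ → a) (nonzeroPart ∘ elt) ⟨
    Π.total (λ x → a * nonzeroPart x) ≡⟨ Π.sum-cong-≋ (λ i → scale a (elt i) a≢0) ⟩
    Π.total (λ x → atZero a x * nonzeroPart (a * x))
                                                ≡⟨ Π.∑-distrib-+ (atZero a ∘ elt) (λ i → nonzeroPart (a * elt i)) ⟩
    Π.total (atZero a) * Π.total (λ x → nonzeroPart (a * x))
                                                ≡⟨ cong₂ _*_ (trans (Π.total-single (atZero a) 0# (atZero-≢0 a)) (atZero-0 a))
                                                     (sym (Π.total-bijection nonzeroPart (a *_) (inv a *_) left right)) ⟩
    a * P ≡⟨ *-comm a P ⟩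
    P * a ∎)
    where
    P : K
    P = Π.total nonzeroPart
    P≢0 : P ≢ 0#
    P≢0 = product-≢0 (nonzeroPart ∘ elt) (nonzeroPart-≢0 ∘ elt)
    left : ∀ x → a * (inv a * x) ≡ x
    left x = trans (sym (*-assoc a (inv a) x)) (trans (cong (_* x) (*-inv a≢0)) (*-identityˡ x))
    right : ∀ x → inv a * (a * x) ≡ x
    right x = trans (solve 3 (λ a i x → i :* (a :* x) := a :* (i :* x)) refl a (inv a) x) (left x)

  -- The vector (c₀ , … , cₙ₋₁) stands for the monic polynomial c₀ + … + cₙ₋₁ Xⁿ⁻¹ + Xⁿ.
  evalMonic : ∀ {n} → Vec K n → K → K
  evalMonic []       x = 1#
  evalMonic (c ∷ cs) x = c + x * evalMonic cs x

  private
    addScaled : ∀ {n} → Vec K (suc n) → K → Vec K n → Vec K (suc n)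
    addScaled (c ∷ cs) r []       = (c + r) ∷ cs
    addScaled (c ∷ cs) r (d ∷ ds) = (c + r * d) ∷ addScaled cs r ds

    eval-addScaled : ∀ {n} (cs : Vec K (suc n)) r ds x →
      evalMonic (addScaled cs r ds) x ≡ evalMonic cs x + r * evalMonic ds x
    eval-addScaled (c ∷ cs) r []       x =
      solve 4 (λ c r x e → c :+ r :+ x :* e := c :+ x :* e :+ r :* con (+ 1)) refl c r x (evalMonic cs x)
    eval-addScaled (c ∷ cs) r (d ∷ ds) x = trans
      (cong (λ e → (c + r * d) + x * e) (eval-addScaled cs r ds x))
      (solve 6 (λ c r d x e e′ → c :+ r :* d :+ x :* (e :+ r :* e′) := c :+ x :* e :+ r :* (d :+ x :* e′))
        refl c r d x (evalMonic cs x) (evalMonic ds x))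

    quotient : ∀ {n} → Vec K (suc n) → K → Vec K n
    quotient (c ∷ [])         r = []
    quotient (c ∷ cs@(_ ∷ _)) r = addScaled cs r (quotient cs r)

    eval-quotient : ∀ {n} (cs : Vec K (suc n)) r x →
      evalMonic cs x - evalMonic cs r ≡ (x - r) * evalMonic (quotient cs r) x
    eval-quotient (c ∷ []) r x =
      solve 3 (λ c r x → (c :+ x :* con (+ 1)) :- (c :+ r :* con (+ 1)) := (x :- r) :* con (+ 1)) refl c r x
    eval-quotient (c ∷ cs@(_ ∷ _)) r x = begin
      (c + x * evalMonic cs x) - (c + r * evalMonic cs r)
        ≡⟨ solve 5 (λ c x e r e′ → (c :+ x :* e) :- (c :+ r :* e′) := (x :- r) :* e :+ r :* (e :- e′))
             refl c x (evalMonic cs x) r (evalMonic cs r) ⟩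
      (x - r) * evalMonic cs x + r * (evalMonic cs x - evalMonic cs r)
        ≡⟨ cong (λ e → (x - r) * evalMonic cs x + r * e) (eval-quotient cs r x) ⟩
      (x - r) * evalMonic cs x + r * ((x - r) * evalMonic (quotient cs r) x)
        ≡⟨ solve 4 (λ x r e e′ → (x :- r) :* e :+ r :* ((x :- r) :* e′) := (x :- r) :* (e :+ r :* e′))
             refl x r (evalMonic cs x) (evalMonic (quotient cs r) x) ⟩
      (x - r) * (evalMonic cs x + r * evalMonic (quotient cs r) x)
        ≡⟨ cong ((x - r) *_) (eval-addScaled cs r (quotient cs r) x) ⟨
      (x - r) * evalMonic (addScaled cs r (quotient cs r)) x ∎

  monic-rootBound : ∀ {n} (cs : Vec K n) (ρ : Fin (suc n) → K) → (∀ {i j} → ρ i ≡ ρ j → i ≡ j) →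
    ¬ (∀ i → evalMonic cs (ρ i) ≡ 0#)
  monic-rootBound []          ρ ρ-inj roots = 0≢1 (sym (roots Fin.zero))
  monic-rootBound cs@(_ ∷ _) ρ ρ-inj roots =
    monic-rootBound (quotient cs r) (ρ ∘ Fin.suc) (λ e → Finₚ.suc-injective (ρ-inj e)) roots′
    where
    r : K
    r = ρ Fin.zero
    roots′ : ∀ i → evalMonic (quotient cs r) (ρ (Fin.suc i)) ≡ 0#
    roots′ i with x*y≡0 (ρ (Fin.suc i) - r) _ (trans (sym (eval-quotient cs r (ρ (Fin.suc i))))
      (trans (cong₂ _-_ (roots (Fin.suc i)) (roots Fin.zero)) (-‿inverseʳ 0#)))
    ... | inj₁ e = contradiction (ρ-inj (x-y≡0 _ _ e)) λ ()
    ... | inj₂ e = e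

  private
    -- X ^ (2+j) - X
    powerMinusX : ∀ j → Vec K (2 ℕ.+ j)
    powerMinusX j = 0# ∷ (- 1#) ∷ replicate j 0#

    eval-zeros : ∀ j x → evalMonic (replicate j 0#) x ≡ x ^ j
    eval-zeros zero    x = refl
    eval-zeros (suc j) x = trans (+-identityˡ _) (cong (x *_) (eval-zeros j x))

  -- Otherwise X ^ (1+j) - X, of degree less than q, would vanish on the whole field.
  ∃-^≢1 : ∀ j → 0 < j → suc j < q → ∃ λ x → x ≢ 0# × x ^ j ≢ 1#
  ∃-^≢1 (suc j) _ j<q with Finₚ.any? (λ i → decide (elt i))
    where
    decide : ∀ x → Dec (x ≢ 0# × x ^ suc j ≢ 1#)
    decide x with x ≟ 0# | (x ^ suc j) ≟ 1#
    ... | yes x≡0 | _      = no λ p → proj₁ p x≡0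
    ... | no x≢0  | yes e  = no λ p → proj₂ p e
    ... | no x≢0  | no ne  = yes (x≢0 , ne)
  ... | yes (i , p) = elt i , p
  ... | no none = contradiction (λ i → vanish (ρ i)) (monic-rootBound (powerMinusX j) ρ ρ-inj)
    where
    ρ : Fin (suc (2 ℕ.+ j)) → K
    ρ i = elt (Fin.inject≤ i j<q)
    ρ-inj : ∀ {i i′} → ρ i ≡ ρ i′ → i ≡ i′
    ρ-inj e = Finₚ.inject≤-injective j<q j<q _ _ (elt-injective e)
    vanish : ∀ x → evalMonic (powerMinusX j) x ≡ 0#
    vanish x with x ≟ 0#
    ... | yes refl = trans (+-identityˡ _) (zeroˡ _)
    ... | no x≢0 with (x ^ suc j) ≟ 1#
    ... | no ne = contradiction (index x , subst (λ y → y ≢ 0# × y ^ suc j ≢ 1#) (sym (elt-index x)) (x≢0 , ne)) none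
    ... | yes e = begin
      0# + x * (- 1# + x * evalMonic (replicate j 0#) x) ≡⟨ cong (λ y → 0# + x * (- 1# + x * y)) (eval-zeros j x) ⟩
      0# + x * (- 1# + x ^ suc j) ≡⟨ cong (λ y → 0# + x * (- 1# + y)) e ⟩
      0# + x * (- 1# + 1#) ≡⟨ solve 1 (λ x → con (+ 0) :+ x :* (:- con (+ 1) :+ con (+ 1)) := con (+ 0)) refl x ⟩
      0# ∎

module Gauss = Adjoin√ (CommutativeRing.isCommutativeRing ℤₚ.+-*-commutativeRing) (ℤ.- + 1)

ℤ[i] : Set
ℤ[i] = ℤ × ℤ

ℤ[i]-ring : CommutativeRing 0ℓ 0ℓ
ℤ[i]-ring = Gauss.ring′

open Gauss using (_⊗_)

conj : ℤ[i] → ℤ[i]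
conj (a , b) = a , ℤ.- b

data Unit : ℤ[i] → Set where
  unit-1  : Unit (+ 1 , + 0)
  unit-i  : Unit (+ 0 , + 1)
  unit--1 : Unit (ℤ.- + 1 , + 0)
  unit--i : Unit (+ 0 , ℤ.- + 1)

Unit-⊗ : ∀ {z w} → Unit z → Unit w → Unit (z ⊗ w)
Unit-⊗ unit-1  unit-1  = unit-1
Unit-⊗ unit-1  unit-i  = unit-i
Unit-⊗ unit-1  unit--1 = unit--1
Unit-⊗ unit-1  unit--i = unit--i
Unit-⊗ unit-i  unit-1  = unit-i
Unit-⊗ unit-i  unit-i  = unit--1
Unit-⊗ unit-i  unit--1 = unit--i
Unit-⊗ unit-i  unit--i = unit-1
Unit-⊗ unit--1 unit-1  = unit--1
Unit-⊗ unit--1 unit-i  = unit--i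
Unit-⊗ unit--1 unit--1 = unit-1
Unit-⊗ unit--1 unit--i = unit-i
Unit-⊗ unit--i unit-1  = unit--i
Unit-⊗ unit--i unit-i  = unit-1
Unit-⊗ unit--i unit--1 = unit-i
Unit-⊗ unit--i unit--i = unit--1

module FieldSum {q : ℕ} (F : FiniteField q) where
  open Field F

  private
    module Σ′ = FiniteSum.Over ℤₚ.+-0-commutativeMonoid F

  ∑ₖ : (K → ℤ) → ℤ
  ∑ₖ f = ∑ (λ i → f (elt i))

  ∑ₖ-single : ∀ f (k : K) → (∀ x → x ≢ k → f x ≡ + 0) → ∑ₖ f ≡ f k
  ∑ₖ-single f k off = trans (∑≡sum (f ∘ elt)) (Σ′.total-single f k off)

  ∑ₖ-bijection : ∀ f (σ τ : K → K) → (∀ x → σ (τ x) ≡ x) → (∀ x → τ (σ x) ≡ x) → ∑ₖ f ≡ ∑ₖ (f ∘ σ)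
  ∑ₖ-bijection f σ τ στ τσ =
    trans (∑≡sum (f ∘ elt)) (trans (Σ′.total-bijection f σ τ στ τσ) (sym (∑≡sum (f ∘ σ ∘ elt))))

  [_≐_] : K → K → ℤ
  [ x ≐ y ] = if ⌊ x ≟ y ⌋ then + 1 else + 0

  ≐-yes : ∀ x y → x ≡ y → [ x ≐ y ] ≡ + 1
  ≐-yes x y e with x ≟ y
  ... | yes _ = refl
  ... | no ne = contradiction e ne

  ≐-no : ∀ x y → x ≢ y → [ x ≐ y ] ≡ + 0
  ≐-no x y ne with x ≟ y
  ... | yes e = contradiction e ne
  ... | no _  = refl

  ∑ₖ-≐ : ∀ k → ∑ₖ (λ x → [ x ≐ k ]) ≡ + 1
  ∑ₖ-≐ k = trans (∑ₖ-single (λ x → [ x ≐ k ]) k (λ x → ≐-no x k)) (≐-yes k k refl)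

module QuarticCharacter {q : ℕ} (F : FiniteField q) (t : ℕ) (0<t : 0 < t)
  (q≡1+4t : q ≡ 1+4× t) where
  open Field F
  open FieldSum F
  open Solver using (solve; _:=_; _:+_; _:*_; _:-_; :-_; con)

  x^4t≡1 : ∀ x → x ≢ 0# → x ^ ((t ℕ.+ t) ℕ.+ (t ℕ.+ t)) ≡ 1#
  x^4t≡1 x x≢0 = *-cancelˡ x x≢0 (trans (subst (λ n → x ^ n ≡ x) q≡1+4t (fermat x x≢0)) (sym (*-identityʳ x)))

  y²≡1 : ∀ y → y * y ≡ 1# → y ≡ 1# ⊎ y ≡ - 1#
  y²≡1 y e with x*y≡0 (y - 1#) (y + 1#)
    (trans (solve 1 (λ y → (y :- con (+ 1)) :* (y :+ con (+ 1)) := y :* y :- con (+ 1)) refl y)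
      (trans (cong (_- 1#) e) (-‿inverseʳ 1#)))
  ... | inj₁ y-1≡0 = inj₁ (x-y≡0 y 1# y-1≡0)
  ... | inj₂ y+1≡0 = inj₂ (trans (solve 1 (λ y → y := (y :+ con (+ 1)) :- con (+ 1)) refl y)
                             (trans (cong (_- 1#) y+1≡0) (+-identityˡ _)))

  abstract
    non-root : ∃ λ x → x ≢ 0# × x ^ (t ℕ.+ t) ≢ 1#
    non-root = ∃-^≢1 (t ℕ.+ t) 0<2t
      (subst (suc (t ℕ.+ t) <_) (sym q≡1+4t) (s≤s (ℕₚ.≤-trans (ℕₚ.≤-reflexive (ℕₚ.+-comm 1 _)) (ℕₚ.+-monoʳ-≤ (t ℕ.+ t) 0<2t))))
      where
      0<2t : 0 < t ℕ.+ t
      0<2t = ℕₚ.≤-trans 0<t (ℕₚ.m≤m+n t t)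

  g : K
  g = proj₁ non-root

  g≢0 : g ≢ 0#
  g≢0 = proj₁ (proj₂ non-root)

  g^2t≡-1 : g ^ (t ℕ.+ t) ≡ - 1#
  g^2t≡-1 = [ (λ e → contradiction e (proj₂ (proj₂ non-root))) , (λ e → e) ]′
    (y²≡1 (g ^ (t ℕ.+ t)) (trans (sym (^-homo-* g (t ℕ.+ t) (t ℕ.+ t))) (x^4t≡1 g g≢0)))

  1≢-1 : 1# ≢ - 1#
  1≢-1 e = proj₂ (proj₂ non-root) (trans g^2t≡-1 (sym e))

  ι : K
  ι = g ^ t

  ι²≡-1 : ι * ι ≡ - 1#
  ι²≡-1 = trans (sym (^-homo-* g t t)) g^2t≡-1

  ι≢0 : ι ≢ 0#
  ι≢0 = ^-≢0 t g≢0

  Φ Φ̄ : ℤ[i] → K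
  Φ (a , b) = ⟦ a ⟧ + ⟦ b ⟧ * ι
  Φ̄ (a , b) = ⟦ a ⟧ - ⟦ b ⟧ * ι

  Φ-⊗ : ∀ z w → Φ (z ⊗ w) ≡ Φ z * Φ w
  Φ-⊗ (a , b) (c , d) = begin
    ⟦ a ℤ.* c ℤ.+ ℤ.- + 1 ℤ.* (b ℤ.* d) ⟧ + ⟦ a ℤ.* d ℤ.+ b ℤ.* c ⟧ * ι
      ≡⟨ cong₂ (λ x y → x + y * ι)
           (trans (⟦⟧-+ (a ℤ.* c) (ℤ.- + 1 ℤ.* (b ℤ.* d))) (cong₂ _+_ (⟦⟧-* a c)
             (trans (⟦⟧-* (ℤ.- + 1) (b ℤ.* d)) (cong₂ _*_ (sym ι²≡-1) (⟦⟧-* b d)))))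
           (trans (⟦⟧-+ (a ℤ.* d) (b ℤ.* c)) (cong₂ _+_ (⟦⟧-* a d) (⟦⟧-* b c))) ⟩
    ⟦ a ⟧ * ⟦ c ⟧ + ι * ι * (⟦ b ⟧ * ⟦ d ⟧) + (⟦ a ⟧ * ⟦ d ⟧ + ⟦ b ⟧ * ⟦ c ⟧) * ι
      ≡⟨ solve 5 (λ a b c d i → a :* c :+ i :* i :* (b :* d) :+ (a :* d :+ b :* c) :* i := (a :+ b :* i) :* (c :+ d :* i))
           refl ⟦ a ⟧ ⟦ b ⟧ ⟦ c ⟧ ⟦ d ⟧ ι ⟩
    Φ (a , b) * Φ (c , d) ∎

  private
    Φ-1 : Φ (+ 1 , + 0) ≡ 1#
    Φ-1 = solve 1 (λ i → con (+ 1) :+ con (+ 0) :* i := con (+ 1)) refl ι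
    Φ-i : Φ (+ 0 , + 1) ≡ ι
    Φ-i = solve 1 (λ i → con (+ 0) :+ con (+ 1) :* i := i) refl ι
    Φ--1 : Φ (ℤ.- + 1 , + 0) ≡ - 1#
    Φ--1 = solve 1 (λ i → :- con (+ 1) :+ con (+ 0) :* i := :- con (+ 1)) refl ι
    Φ--i : Φ (+ 0 , ℤ.- + 1) ≡ - ι
    Φ--i = solve 1 (λ i → con (+ 0) :+ (:- con (+ 1)) :* i := :- i) refl ι

    ι≢1 : ι ≢ 1#
    ι≢1 e = 1≢-1 (trans (sym (*-identityˡ 1#)) (trans (cong₂ _*_ (sym e) (sym e)) ι²≡-1))

    -ι≢1 : - ι ≢ 1#
    -ι≢1 e = 1≢-1 (trans (sym (*-identityˡ 1#)) (trans (cong₂ _*_ (sym e) (sym e))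
      (trans (solve 1 (λ i → (:- i) :* (:- i) := i :* i) refl ι) ι²≡-1)))

    Φ≡1 : ∀ {u} → Unit u → Φ u ≡ 1# → u ≡ (+ 1 , + 0)
    Φ≡1 unit-1  e = refl
    Φ≡1 unit-i  e = contradiction (trans (sym Φ-i) e) ι≢1
    Φ≡1 unit--1 e = contradiction (trans (sym e) Φ--1) 1≢-1
    Φ≡1 unit--i e = contradiction (trans (sym Φ--i) e) -ι≢1

    Unit-conj : ∀ {u} → Unit u → Unit (conj u)
    Unit-conj unit-1  = unit-1
    Unit-conj unit-i  = unit--i
    Unit-conj unit--1 = unit--1
    Unit-conj unit--i = unit-i

    u⊗conj : ∀ {u} → Unit u → u ⊗ conj u ≡ (+ 1 , + 0)
    u⊗conj unit-1  = refl
    u⊗conj unit-i  = refl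
    u⊗conj unit--1 = refl
    u⊗conj unit--i = refl

  open CommutativeRing ℤ[i]-ring using () renaming
    (*-assoc to ⊗-assoc; *-comm to ⊗-comm; *-identityˡ to ⊗-identityˡ; *-identityʳ to ⊗-identityʳ; zeroˡ to ⊗-zeroˡ; zeroʳ to ⊗-zeroʳ)

  Φ-injective : ∀ {u v} → Unit u → Unit v → Φ u ≡ Φ v → u ≡ v
  Φ-injective {u} {v} U V e = begin
    u ≡⟨ ⊗-identityʳ u ⟨
    u ⊗ (+ 1 , + 0) ≡⟨ cong (u ⊗_) (trans (⊗-comm (conj v) v) (u⊗conj V)) ⟨
    u ⊗ (conj v ⊗ v) ≡⟨ ⊗-assoc u (conj v) v ⟨
    (u ⊗ conj v) ⊗ v ≡⟨ cong (_⊗ v) (Φ≡1 (Unit-⊗ U (Unit-conj V)) Φ[uv̄]≡1) ⟩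
    (+ 1 , + 0) ⊗ v ≡⟨ ⊗-identityˡ v ⟩
    v ∎
    where
    Φ[uv̄]≡1 : Φ (u ⊗ conj v) ≡ 1#
    Φ[uv̄]≡1 = begin
      Φ (u ⊗ conj v) ≡⟨ Φ-⊗ u (conj v) ⟩
      Φ u * Φ (conj v) ≡⟨ cong (_* Φ (conj v)) e ⟩
      Φ v * Φ (conj v) ≡⟨ Φ-⊗ v (conj v) ⟨
      Φ (v ⊗ conj v) ≡⟨ cong Φ (u⊗conj V) ⟩
      Φ (+ 1 , + 0) ≡⟨ Φ-1 ⟩
      1# ∎

  private
    fourthRoot : ∀ y → (y * y) * (y * y) ≡ 1# → ∃ λ u → Unit u × Φ u ≡ y
    fourthRoot y e = [ real , imaginary ]′ (y²≡1 (y * y) e)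
      where
      real : y * y ≡ 1# → ∃ λ u → Unit u × Φ u ≡ y
      real e′ = [ (λ y≡1 → _ , unit-1 , trans Φ-1 (sym y≡1)) , (λ y≡-1 → _ , unit--1 , trans Φ--1 (sym y≡-1)) ]′ (y²≡1 y e′)
      imaginary : y * y ≡ - 1# → ∃ λ u → Unit u × Φ u ≡ y
      imaginary e′ =
        [ (λ y-ι≡0 → _ , unit-i , trans Φ-i (sym (x-y≡0 y ι y-ι≡0)))
        , (λ y+ι≡0 → _ , unit--i , trans Φ--i (sym (trans (solve 2 (λ y i → y := (y :+ i) :- i) refl y ι)
                                                (trans (cong (_- ι) y+ι≡0) (+-identityˡ _))))) ]′
        (x*y≡0 (y - ι) (y + ι) (trans (solve 2 (λ y i → (y :- i) :* (y :+ i) := y :* y :- i :* i) refl y ι)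
          (trans (cong₂ _-_ e′ ι²≡-1) (-‿inverseʳ (- 1#)))))

    quartic : ∀ x → x ≢ 0# → ∃ λ u → Unit u × Φ u ≡ x ^ t
    quartic x x≢0 = fourthRoot (x ^ t)
      (trans (cong₂ _*_ (sym (^-homo-* x t t)) (sym (^-homo-* x t t)))
        (trans (sym (^-homo-* x (t ℕ.+ t) (t ℕ.+ t))) (x^4t≡1 x x≢0)))

  ψ : K → ℤ[i]
  ψ x with x ≟ 0#
  ... | yes _   = + 0 , + 0
  ... | no x≢0 = proj₁ (quartic x x≢0)

  ψ-0 : ψ 0# ≡ (+ 0 , + 0)
  ψ-0 with 0# ≟ 0#
  ... | yes _   = refl
  ... | no 0≢0 = contradiction refl 0≢0

  ψ-Unit : ∀ x → x ≢ 0# → Unit (ψ x)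
  ψ-Unit x x≢0 with x ≟ 0#
  ... | yes x≡0 = contradiction x≡0 x≢0
  ... | no x≢0′ = proj₁ (proj₂ (quartic x x≢0′))

  Φ-ψ : ∀ x → x ≢ 0# → Φ (ψ x) ≡ x ^ t
  Φ-ψ x x≢0 with x ≟ 0#
  ... | yes x≡0 = contradiction x≡0 x≢0
  ... | no x≢0′ = proj₂ (proj₂ (quartic x x≢0′))

  ψ-* : ∀ x y → ψ (x * y) ≡ ψ x ⊗ ψ y
  ψ-* x y = lemma (x ≟ 0#) (y ≟ 0#)
    where
    lemma : Dec (x ≡ 0#) → Dec (y ≡ 0#) → ψ (x * y) ≡ ψ x ⊗ ψ y
    lemma (yes refl) _ = trans (cong ψ (zeroˡ y)) (trans ψ-0 (trans (sym (⊗-zeroˡ (ψ y))) (cong (_⊗ ψ y) (sym ψ-0))))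
    lemma (no _) (yes refl) = trans (cong ψ (zeroʳ x)) (trans ψ-0 (trans (sym (⊗-zeroʳ (ψ x))) (cong (ψ x ⊗_) (sym ψ-0))))
    lemma (no x≢0) (no y≢0) = Φ-injective (ψ-Unit (x * y) (*-≢0 x≢0 y≢0)) (Unit-⊗ (ψ-Unit x x≢0) (ψ-Unit y y≢0)) (begin
      Φ (ψ (x * y)) ≡⟨ Φ-ψ (x * y) (*-≢0 x≢0 y≢0) ⟩
      (x * y) ^ t ≡⟨ ^-distrib-* x y t ⟩
      x ^ t * y ^ t ≡⟨ cong₂ _*_ (Φ-ψ x x≢0) (Φ-ψ y y≢0) ⟨
      Φ (ψ x) * Φ (ψ y) ≡⟨ Φ-⊗ (ψ x) (ψ y) ⟨
      Φ (ψ x ⊗ ψ y) ∎)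

  ψ-g : ψ g ≡ (+ 0 , + 1)
  ψ-g = Φ-injective (ψ-Unit g g≢0) unit-i (trans (Φ-ψ g g≢0) (sym Φ-i))

  ψ-1 : ψ 1# ≡ (+ 1 , + 0)
  ψ-1 = Φ-injective (ψ-Unit 1# (0≢1 ∘ sym)) unit-1 (trans (Φ-ψ 1# (0≢1 ∘ sym)) (trans (1^n≡1 t) (sym Φ-1)))

  Φ̄-ψ : ∀ x → x ≢ 0# → Φ̄ (ψ x) ≡ x ^ t * (x ^ t * x ^ t)
  Φ̄-ψ x x≢0 = trans (cube (ψ-Unit x x≢0)) (cong (λ y → y * (y * y)) (Φ-ψ x x≢0))
    where
    cube : ∀ {u} → Unit u → Φ̄ u ≡ Φ u * (Φ u * Φ u)
    cube unit-1  = solve 1 (λ i → con (+ 1) :- con (+ 0) :* i := (con (+ 1) :+ con (+ 0) :* i) :* ((con (+ 1) :+ con (+ 0) :* i) :* (con (+ 1) :+ con (+ 0) :* i))) refl ι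
    cube unit--1 = solve 1 (λ i → :- con (+ 1) :- con (+ 0) :* i := (:- con (+ 1) :+ con (+ 0) :* i) :* ((:- con (+ 1) :+ con (+ 0) :* i) :* (:- con (+ 1) :+ con (+ 0) :* i))) refl ι
    cube unit-i  = trans (solve 1 (λ i → con (+ 0) :- con (+ 1) :* i := i :* (:- con (+ 1))) refl ι)
      (trans (cong (ι *_) (sym ι²≡-1)) (cong (λ y → y * (y * y)) (sym Φ-i)))
    cube unit--i = trans (solve 1 (λ i → con (+ 0) :- (:- con (+ 1)) :* i := (:- i) :* (:- con (+ 1))) refl ι)
      (trans (cong ((- ι) *_) (sym ι²≡-1)) (trans (solve 1 (λ i → (:- i) :* (i :* i) := (:- i) :* ((:- i) :* (:- i))) refl ι)
        (cong (λ y → y * (y * y)) (sym Φ--i))))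

  χ : K → ℤ
  χ x = proj₁ (ψ x ⊗ ψ x)

  χ-0 : χ 0# ≡ + 0
  χ-0 = cong (λ z → proj₁ (z ⊗ z)) ψ-0

  χ-1 : χ 1# ≡ + 1
  χ-1 = cong (λ z → proj₁ (z ⊗ z)) ψ-1

  χ-g : χ g ≡ ℤ.- + 1
  χ-g = cong (λ z → proj₁ (z ⊗ z)) ψ-g

  ψ²≡χ : ∀ x → ψ x ⊗ ψ x ≡ (χ x , + 0)
  ψ²≡χ x = lemma (x ≟ 0#)
    where
    unit : ∀ {u} → Unit u → u ⊗ u ≡ (proj₁ (u ⊗ u) , + 0)
    unit unit-1  = refl
    unit unit-i  = refl
    unit unit--1 = refl
    unit unit--i = refl
    lemma : Dec (x ≡ 0#) → ψ x ⊗ ψ x ≡ (χ x , + 0)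
    lemma (yes refl) = trans (cong (λ z → z ⊗ z) ψ-0) (cong (_, + 0) (sym χ-0))
    lemma (no x≢0)   = unit (ψ-Unit x x≢0)

  χψ≡ψ̄ : ∀ x → x ≢ 0# → (χ x , + 0) ⊗ ψ x ≡ conj (ψ x)
  χψ≡ψ̄ x x≢0 = unit (ψ-Unit x x≢0)
    where
    unit : ∀ {u} → Unit u → (proj₁ (u ⊗ u) , + 0) ⊗ u ≡ conj u
    unit unit-1  = refl
    unit unit-i  = refl
    unit unit--1 = refl
    unit unit--i = refl

  χ-values : ∀ x → x ≢ 0# → χ x ≡ + 1 ⊎ χ x ≡ ℤ.- + 1
  χ-values x x≢0 = unit (ψ-Unit x x≢0)
    where
    unit : ∀ {u} → Unit u → proj₁ (u ⊗ u) ≡ + 1 ⊎ proj₁ (u ⊗ u) ≡ ℤ.- + 1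
    unit unit-1  = inj₁ refl
    unit unit-i  = inj₂ refl
    unit unit--1 = inj₁ refl
    unit unit--i = inj₂ refl

  χ-* : ∀ x y → χ (x * y) ≡ χ x ℤ.* χ y
  χ-* x y = begin
    proj₁ (ψ (x * y) ⊗ ψ (x * y)) ≡⟨ cong (λ z → proj₁ (z ⊗ z)) (ψ-* x y) ⟩
    proj₁ ((ψ x ⊗ ψ y) ⊗ (ψ x ⊗ ψ y)) ≡⟨ cong proj₁ (interchange (ψ x) (ψ y)) ⟩
    proj₁ ((ψ x ⊗ ψ x) ⊗ (ψ y ⊗ ψ y)) ≡⟨ cong proj₁ (cong₂ _⊗_ (ψ²≡χ x) (ψ²≡χ y)) ⟩
    χ x ℤ.* χ y ℤ.+ ℤ.- + 1 ℤ.* (+ 0 ℤ.* + 0) ≡⟨ ℤₚ.+-identityʳ _ ⟩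
    χ x ℤ.* χ y ∎
    where
    interchange : ∀ z w → (z ⊗ w) ⊗ (z ⊗ w) ≡ (z ⊗ z) ⊗ (w ⊗ w)
    interchange z w = trans (⊗-assoc z w (z ⊗ w)) (trans (cong (z ⊗_) (trans (sym (⊗-assoc w z w))
      (trans (cong (_⊗ w) (⊗-comm w z)) (⊗-assoc z w w)))) (sym (⊗-assoc z z (w ⊗ w))))

  χ² : ∀ x → x ≢ 0# → χ x ℤ.* χ x ≡ + 1
  χ² x x≢0 with χ-values x x≢0
  ... | inj₁ e = cong₂ ℤ._*_ e e
  ... | inj₂ e = cong₂ ℤ._*_ e e

  χ-square : ∀ x → x ≢ 0# → χ (x * x) ≡ + 1
  χ-square x x≢0 = trans (χ-* x x) (χ² x x≢0)

  χ--1 : χ (- 1#) ≡ + 1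
  χ--1 = trans (cong χ (sym ι²≡-1)) (χ-square ι ι≢0)

  χ-neg : ∀ x → χ (- x) ≡ χ x
  χ-neg x = trans (cong χ (solve 1 (λ x → :- x := (:- con (+ 1)) :* x) refl x))
    (trans (χ-* (- 1#) x) (trans (cong (ℤ._* χ x) χ--1) (ℤₚ.*-identityˡ (χ x))))

  g*-bijection : (∀ x → g * (inv g * x) ≡ x) × (∀ x → inv g * (g * x) ≡ x)
  g*-bijection = left , λ x → trans (solve 3 (λ a i x → i :* (a :* x) := a :* (i :* x)) refl g (inv g) x) (left x)
    where
    left : ∀ x → g * (inv g * x) ≡ x
    left x = trans (sym (*-assoc g (inv g) x)) (trans (cong (_* x) (*-inv g≢0)) (*-identityˡ x))

  i≡-i⇒i≡0 : ∀ i → i ≡ ℤ.- i → i ≡ + 0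
  i≡-i⇒i≡0 (+ zero) e = refl

  ∑χ≡0 : ∑ₖ χ ≡ + 0
  ∑χ≡0 = i≡-i⇒i≡0 (∑ₖ χ) (begin
    ∑ₖ χ ≡⟨ ∑ₖ-bijection χ (g *_) (inv g *_) (proj₁ g*-bijection) (proj₂ g*-bijection) ⟩
    ∑ₖ (λ x → χ (g * x)) ≡⟨ ∑-cong (λ i → trans (χ-* g (elt i)) (cong (ℤ._* χ (elt i)) χ-g)) ⟩
    ∑ₖ (λ x → ℤ.- + 1 ℤ.* χ x) ≡⟨ ∑-*ˡ (ℤ.- + 1) (χ ∘ elt) ⟩
    ℤ.- + 1 ℤ.* ∑ₖ χ ≡⟨ ℤₚ.-1*i≡-i (∑ₖ χ) ⟩
    ℤ.- ∑ₖ χ ∎)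

  -- Each z has at most 1 + χ z square roots, and both sides add up to q.
  private
    roots : K → ℤ
    roots z = ∑ₖ (λ y → [ y * y ≐ z ])

    deficit : K → ℤ
    deficit z = (+ 1 ℤ.+ χ z) ℤ.+ ℤ.- + 1 ℤ.* roots z

    ∑roots : ∑ₖ roots ≡ + q
    ∑roots = begin
      ∑ₖ (λ z → ∑ₖ (λ y → [ y * y ≐ z ])) ≡⟨ ∑-comm (λ i j → [ elt j * elt j ≐ elt i ]) ⟩
      ∑ₖ (λ y → ∑ₖ (λ z → [ y * y ≐ z ])) ≡⟨ ∑-cong (λ i → one (elt i * elt i)) ⟩
      ∑ₖ (λ _ → + 1) ≡⟨ ∑-const q (+ 1) ⟩
      + q ℤ.* + 1 ≡⟨ ℤₚ.*-identityʳ (+ q) ⟩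
      + q ∎
      where
      one : ∀ k → ∑ₖ (λ z → [ k ≐ z ]) ≡ + 1
      one k = trans (∑ₖ-single (λ z → [ k ≐ z ]) k (λ z ne → ≐-no k z (ne ∘ sym))) (≐-yes k k refl)

    ∑deficit : ∑ₖ deficit ≡ + 0
    ∑deficit = begin
      ∑ₖ deficit
        ≡⟨ ∑-+ (λ i → + 1 ℤ.+ χ (elt i)) (λ i → ℤ.- + 1 ℤ.* roots (elt i)) ⟩
      ∑ₖ (λ z → + 1 ℤ.+ χ z) ℤ.+ ∑ₖ (λ z → ℤ.- + 1 ℤ.* roots z)
        ≡⟨ cong₂ ℤ._+_ (trans (∑-+ (λ _ → + 1) (χ ∘ elt)) (cong₂ ℤ._+_ (trans (∑-const q (+ 1)) (ℤₚ.*-identityʳ (+ q))) ∑χ≡0))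
             (trans (∑-*ˡ (ℤ.- + 1) (roots ∘ elt)) (cong (ℤ.- + 1 ℤ.*_) ∑roots)) ⟩
      (+ q ℤ.+ + 0) ℤ.+ ℤ.- + 1 ℤ.* + q
        ≡⟨ cong₂ ℤ._+_ (ℤₚ.+-identityʳ (+ q)) (ℤₚ.-1*i≡-i (+ q)) ⟩
      + q ℤ.+ ℤ.- + q
        ≡⟨ ℤₚ.+-inverseʳ (+ q) ⟩
      + 0 ∎

    s≢-s : ∀ s → s ≢ 0# → s ≢ - s
    s≢-s s s≢0 e = 1≢-1 (*-cancelˡ s s≢0 (trans (*-identityʳ s) (trans e (solve 1 (λ s → :- s := s :* (:- con (+ 1))) refl s))))

    roots-of-square : ∀ s → s ≢ 0# → roots (s * s) ≡ + 2
    roots-of-square s s≢0 = begin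
      ∑ₖ (λ y → [ y * y ≐ s * s ]) ≡⟨ ∑-cong (λ i → split (elt i)) ⟩
      ∑ₖ (λ y → [ y ≐ s ] ℤ.+ [ y ≐ - s ]) ≡⟨ ∑-+ (λ i → [ elt i ≐ s ]) (λ i → [ elt i ≐ - s ]) ⟩
      ∑ₖ (λ y → [ y ≐ s ]) ℤ.+ ∑ₖ (λ y → [ y ≐ - s ]) ≡⟨ cong₂ ℤ._+_ (∑ₖ-≐ s) (∑ₖ-≐ (- s)) ⟩
      + 2 ∎
      where
      split : ∀ y → [ y * y ≐ s * s ] ≡ [ y ≐ s ] ℤ.+ [ y ≐ - s ]
      split y with y ≟ s | y ≟ (- s)
      ... | yes y≡s | yes y≡-s = contradiction (trans (sym y≡s) y≡-s) (s≢-s s s≢0)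
      ... | yes y≡s | no _     = ≐-yes (y * y) (s * s) (cong₂ _*_ y≡s y≡s)
      ... | no _    | yes y≡-s = ≐-yes (y * y) (s * s) (trans (cong₂ _*_ y≡-s y≡-s) (solve 1 (λ s → (:- s) :* (:- s) := s :* s) refl s))
      ... | no y≢s  | no y≢-s  = ≐-no (y * y) (s * s) λ e →
        *-≢0 (y≢s ∘ x-y≡0 y s) (λ e′ → y≢-s (trans (solve 2 (λ y s → y := (y :+ s) :- s) refl y s) (trans (cong (_- s) e′) (+-identityˡ _))))
          (trans (solve 2 (λ y s → (y :- s) :* (y :+ s) := y :* y :- s :* s) refl y s) (trans (cong (_- (s * s)) e) (-‿inverseʳ (s * s))))

    roots-0 : roots 0# ≡ + 1
    roots-0 = trans (∑ₖ-single (λ y → [ y * y ≐ 0# ]) 0# (λ y y≢0 → ≐-no (y * y) 0# (*-≢0 y≢0 y≢0)))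
      (≐-yes (0# * 0#) 0# (zeroˡ 0#))

    roots-nonsquare : ∀ z → ¬ (∃ λ a → elt a * elt a ≡ z) → roots z ≡ + 0
    roots-nonsquare z ¬sq = trans (∑-cong (λ i → ≐-no (elt i * elt i) z (λ e → ¬sq (i , e))))
      (trans (∑-const q (+ 0)) (ℤₚ.*-zeroʳ (+ q)))

    root-≢0 : ∀ {x} → x * x ≢ 0# → x ≢ 0#
    root-≢0 {x} x²≢0 e = x²≢0 (trans (cong (_* x) e) (zeroˡ x))

    deficit≥0 : ∀ z → + 0 ℤ.≤ deficit z
    deficit≥0 z = lemma (z ≟ 0#) (isSquare? z)
      where
      eval : ∀ {a b} → χ z ≡ a → roots z ≡ b → + 0 ℤ.≤ (+ 1 ℤ.+ a) ℤ.+ ℤ.- + 1 ℤ.* b → + 0 ℤ.≤ deficit z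
      eval e e′ = subst (+ 0 ℤ.≤_) (sym (cong₂ (λ a b → (+ 1 ℤ.+ a) ℤ.+ ℤ.- + 1 ℤ.* b) e e′))
      lemma : Dec (z ≡ 0#) → Dec (∃ λ a → elt a * elt a ≡ z) → + 0 ℤ.≤ deficit z
      lemma (yes e) _ = eval {+ 0} {+ 1} (trans (cong χ e) χ-0) (trans (cong roots e) roots-0) ℤₚ.≤-refl
      lemma (no z≢0) (yes (a , e)) = eval {+ 1} {+ 2}
        (trans (cong χ (sym e)) (χ-square (elt a) a≢0)) (trans (cong roots (sym e)) (roots-of-square (elt a) a≢0)) ℤₚ.≤-refl
        where
        a≢0 : elt a ≢ 0#
        a≢0 = root-≢0 (λ e′ → z≢0 (trans (sym e) e′))
      lemma (no z≢0) (no ¬sq) with χ-values z z≢0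
      ... | inj₁ e = eval {+ 1} {+ 0} e (roots-nonsquare z ¬sq) (ℤ.+≤+ z≤n)
      ... | inj₂ e = eval {ℤ.- + 1} {+ 0} e (roots-nonsquare z ¬sq) ℤₚ.≤-refl

  χ-nonsquare : ∀ z → ¬ (∃ λ a → elt a * elt a ≡ z) → χ z ≡ ℤ.- + 1
  χ-nonsquare z ¬sq = begin
    χ z ≡⟨ ℤₚ.+-identityˡ (χ z) ⟨
    + 0 ℤ.+ χ z ≡⟨⟩
    (ℤ.- + 1 ℤ.+ + 1) ℤ.+ χ z ≡⟨ ℤₚ.+-assoc (ℤ.- + 1) (+ 1) (χ z) ⟩
    ℤ.- + 1 ℤ.+ (+ 1 ℤ.+ χ z) ≡⟨ cong (ℤ._+_ (ℤ.- + 1)) (ℤₚ.+-identityʳ (+ 1 ℤ.+ χ z)) ⟨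
    ℤ.- + 1 ℤ.+ ((+ 1 ℤ.+ χ z) ℤ.+ + 0) ≡⟨ cong (λ r → ℤ.- + 1 ℤ.+ ((+ 1 ℤ.+ χ z) ℤ.+ ℤ.- + 1 ℤ.* r)) (roots-nonsquare z ¬sq) ⟨
    ℤ.- + 1 ℤ.+ deficit z ≡⟨ cong (ℤ._+_ (ℤ.- + 1)) deficit≡0 ⟩
    ℤ.- + 1 ∎
    where
    deficit≡0 : deficit z ≡ + 0
    deficit≡0 = subst (λ y → deficit y ≡ + 0) (elt-index z)
      (∑-nonneg-zero (deficit ∘ elt) (deficit≥0 ∘ elt) ∑deficit (index z))

module CharacterSums {q : ℕ} (F : FiniteField q) (t : ℕ) (0<t : 0 < t)
  (q≡1+4t : q ≡ 1+4× t) where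
  open Field F
  open FieldSum F
  open QuarticCharacter F t 0<t q≡1+4t
  open Solver using (solve; _:=_; _:+_; _:*_; _:-_; :-_; con)
  open CommutativeRing ℤ[i]-ring using () renaming
    (*-assoc to ⊗-assoc; *-comm to ⊗-comm; *-identityˡ to ⊗-identityˡ; *-identityʳ to ⊗-identityʳ)

  ∑ₖ-translate : ∀ f c → ∑ₖ f ≡ ∑ₖ (λ z → f (z + c))
  ∑ₖ-translate f c = ∑ₖ-bijection f (_+ c) (_- c)
    (λ x → solve 2 (λ x c → x :- c :+ c := x) refl x c) (λ x → solve 2 (λ x c → x :+ c :- c := x) refl x c)

  ∑ₖ-inv : ∀ f a b → b ≢ 0# → ∑ₖ f ≡ ∑ₖ (λ z → f (a + b * inv z))
  ∑ₖ-inv f a b b≢0 = ∑ₖ-bijection f σ τ στ τσ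
    where
    σ τ : K → K
    σ z = a + b * inv z
    τ y = inv ((y - a) * inv b)
    στ : ∀ y → σ (τ y) ≡ y
    στ y = begin
      a + b * inv (inv ((y - a) * inv b)) ≡⟨ cong (λ w → a + b * w) (inv-involutive _) ⟩
      a + b * ((y - a) * inv b) ≡⟨ solve 4 (λ a b y i → a :+ b :* ((y :- a) :* i) := a :+ (b :* i) :* (y :- a)) refl a b y (inv b) ⟩
      a + (b * inv b) * (y - a) ≡⟨ cong (λ w → a + w * (y - a)) (*-inv b≢0) ⟩
      a + 1# * (y - a) ≡⟨ solve 2 (λ a y → a :+ con (+ 1) :* (y :- a) := y) refl a y ⟩
      y ∎
    τσ : ∀ z → τ (σ z) ≡ z
    τσ z = begin
      inv ((a + b * inv z - a) * inv b) ≡⟨ cong inv (solve 4 (λ a b i r → (a :+ b :* r :- a) :* i := (b :* i) :* r) refl a b (inv b) (inv z)) ⟩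
      inv ((b * inv b) * inv z) ≡⟨ cong (λ w → inv (w * inv z)) (*-inv b≢0) ⟩
      inv (1# * inv z) ≡⟨ cong inv (*-identityˡ (inv z)) ⟩
      inv (inv z) ≡⟨ inv-involutive z ⟩
      z ∎

  x-y≢0 : ∀ {x y} → x ≢ y → x - y ≢ 0#
  x-y≢0 {x} {y} x≢y e = x≢y (x-y≡0 x y e)

  ∑χ²≡q-1 : ∀ x → ∑ₖ (λ y → χ (y - x) ℤ.* χ (y - x)) ≡ + q ℤ.+ ℤ.- + 1
  ∑χ²≡q-1 x = begin
    ∑ₖ (λ y → χ (y - x) ℤ.* χ (y - x)) ≡⟨ ∑-cong (λ i → pointwise (elt i) (elt i ≟ x)) ⟩
    ∑ₖ (λ y → + 1 ℤ.+ ℤ.- + 1 ℤ.* [ y ≐ x ]) ≡⟨ ∑-+ (λ _ → + 1) (λ i → ℤ.- + 1 ℤ.* [ elt i ≐ x ]) ⟩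
    ∑ₖ (λ _ → + 1) ℤ.+ ∑ₖ (λ y → ℤ.- + 1 ℤ.* [ y ≐ x ])
      ≡⟨ cong₂ ℤ._+_ (trans (∑-const q (+ 1)) (ℤₚ.*-identityʳ (+ q)))
           (trans (∑-*ˡ (ℤ.- + 1) (λ i → [ elt i ≐ x ])) (cong (ℤ.- + 1 ℤ.*_) (∑ₖ-≐ x))) ⟩
    + q ℤ.+ ℤ.- + 1 ∎
    where
    pointwise : ∀ y → Dec (y ≡ x) → χ (y - x) ℤ.* χ (y - x) ≡ + 1 ℤ.+ ℤ.- + 1 ℤ.* [ y ≐ x ]
    pointwise y (yes refl) = trans (cong (λ w → w ℤ.* w) (trans (cong χ (-‿inverseʳ y)) χ-0))
      (sym (cong (λ w → + 1 ℤ.+ ℤ.- + 1 ℤ.* w) (≐-yes y y refl)))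
    pointwise y (no y≢x) = trans (χ² (y - x) (x-y≢0 y≢x)) (sym (cong (λ w → + 1 ℤ.+ ℤ.- + 1 ℤ.* w) (≐-no y x y≢x)))

  χ-*-square : ∀ x r → r ≢ 0# → χ ((r * r) * x) ≡ χ x
  χ-*-square x r r≢0 = trans (χ-* (r * r) x) (trans (cong (ℤ._* χ x) (χ-square r r≢0)) (ℤₚ.*-identityˡ (χ x)))

  ∑χχ≡-1 : ∀ x x′ → x ≢ x′ → ∑ₖ (λ y → χ (y - x) ℤ.* χ (y - x′)) ≡ ℤ.- + 1
  ∑χχ≡-1 x x′ x≢x′ = begin
    ∑ₖ f ≡⟨ ∑ₖ-inv f x c c≢0 ⟩
    ∑ₖ f′ ≡⟨ solve-for (∑ₖ f′) ⟩
    (∑ₖ f′ ℤ.+ + 1) ℤ.+ ℤ.- + 1 ≡⟨ cong (λ w → (∑ₖ f′ ℤ.+ w) ℤ.+ ℤ.- + 1) (∑ₖ-≐ 0#) ⟨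
    (∑ₖ f′ ℤ.+ ∑ₖ (λ u → [ u ≐ 0# ])) ℤ.+ ℤ.- + 1 ≡⟨ cong (ℤ._+ ℤ.- + 1) (∑-+ (f′ ∘ elt) (λ i → [ elt i ≐ 0# ])) ⟨
    ∑ₖ (λ u → f′ u ℤ.+ [ u ≐ 0# ]) ℤ.+ ℤ.- + 1 ≡⟨ cong (ℤ._+ ℤ.- + 1) (∑-cong (λ i → pointwise (elt i) (elt i ≟ 0#))) ⟩
    ∑ₖ (λ u → χ (u + 1#)) ℤ.+ ℤ.- + 1 ≡⟨ cong (ℤ._+ ℤ.- + 1) (∑ₖ-translate χ 1#) ⟨
    ∑ₖ χ ℤ.+ ℤ.- + 1 ≡⟨ cong (ℤ._+ ℤ.- + 1) ∑χ≡0 ⟩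
    ℤ.- + 1 ∎
    where
    solve-for : ∀ a → a ≡ (a ℤ.+ + 1) ℤ.+ ℤ.- + 1
    solve-for = ℤ-ring
    c : K
    c = x - x′
    c≢0 : c ≢ 0#
    c≢0 = x-y≢0 x≢x′
    f f′ : K → ℤ
    f y = χ (y - x) ℤ.* χ (y - x′)
    f′ u = f (x + c * inv u)
    pointwise : ∀ u → Dec (u ≡ 0#) → f′ u ℤ.+ [ u ≐ 0# ] ≡ χ (u + 1#)
    pointwise u (yes u≡0) = begin
      f′ u ℤ.+ [ u ≐ 0# ] ≡⟨ cong₂ ℤ._+_ (cong (ℤ._* χ (x + c * inv u - x′)) χ≡0) (≐-yes u 0# u≡0) ⟩
      + 1 ≡⟨ χ-1 ⟨
      χ 1# ≡⟨ cong χ (trans (cong (_+ 1#) u≡0) (+-identityˡ 1#)) ⟨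
      χ (u + 1#) ∎
      where
      χ≡0 : χ (x + c * inv u - x) ≡ + 0
      χ≡0 = trans (cong χ (trans (cong (λ w → x + c * w - x) (trans (cong inv u≡0) inv-0))
        (solve 2 (λ x c → x :+ c :* con (+ 0) :- x := con (+ 0)) refl x c))) χ-0
    pointwise u (no u≢0) = begin
      f′ u ℤ.+ [ u ≐ 0# ] ≡⟨ cong (λ w → f′ u ℤ.+ w) (≐-no u 0# u≢0) ⟩
      f′ u ℤ.+ + 0 ≡⟨ ℤₚ.+-identityʳ (f′ u) ⟩
      f′ u ≡⟨ χ-* (x + c * r - x) (x + c * r - x′) ⟨
      χ ((x + c * r - x) * (x + c * r - x′))
        ≡⟨ cong χ (solve 3 (λ x x′ r → (x :+ (x :- x′) :* r :- x) :* (x :+ (x :- x′) :* r :- x′)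
             := ((x :- x′) :* r) :* ((x :- x′) :* (con (+ 1) :+ r))) refl x x′ r) ⟩
      χ ((c * r) * (c * (1# + r))) ≡⟨ cong (λ w → χ ((c * r) * (c * (w + r)))) (*-inv u≢0) ⟨
      χ ((c * r) * (c * (u * r + r)))
        ≡⟨ cong χ (solve 3 (λ c r u → (c :* r) :* (c :* (u :* r :+ r)) := ((c :* r) :* (c :* r)) :* (u :+ con (+ 1))) refl c r u) ⟩
      χ (((c * r) * (c * r)) * (u + 1#)) ≡⟨ χ-*-square (u + 1#) (c * r) (*-≢0 c≢0 (inv-≢0 u≢0)) ⟩
      χ (u + 1#) ∎
      where
      r : K
      r = inv u

  N : K → K
  N x = x * x - g

  N≢0 : ∀ x → N x ≢ 0#
  N≢0 x e = absurd (x ≟ 0#)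
    where
    x²≡g : x * x ≡ g
    x²≡g = x-y≡0 (x * x) g e
    1≢-1ℤ : + 1 ≢ ℤ.- + 1
    1≢-1ℤ ()
    absurd : Dec (x ≡ 0#) → _
    absurd (yes refl) = g≢0 (trans (sym x²≡g) (zeroˡ 0#))
    absurd (no x≢0)   = 1≢-1ℤ (trans (sym (χ-square x x≢0)) (trans (cong χ x²≡g) χ-g))

  ∑χN≡-1 : ∑ₖ (χ ∘ N) ≡ ℤ.- + 1
  ∑χN≡-1 = s+2≡-s (∑ₖ (χ ∘ N)) (begin
    ∑ₖ (χ ∘ N) ℤ.+ + 2 ≡⟨ cong (ℤ._+ + 2) (∑ₖ-inv (χ ∘ N) 0# g g≢0) ⟩
    ∑ₖ f′ ℤ.+ + 2 ≡⟨ cong (λ w → ∑ₖ f′ ℤ.+ + 2 ℤ.* w) (∑ₖ-≐ 0#) ⟨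
    ∑ₖ f′ ℤ.+ + 2 ℤ.* ∑ₖ (λ z → [ z ≐ 0# ]) ≡⟨ cong (λ w → ∑ₖ f′ ℤ.+ w) (∑-*ˡ (+ 2) (λ i → [ elt i ≐ 0# ])) ⟨
    ∑ₖ f′ ℤ.+ ∑ₖ (λ z → + 2 ℤ.* [ z ≐ 0# ]) ≡⟨ ∑-+ (f′ ∘ elt) (λ i → + 2 ℤ.* [ elt i ≐ 0# ]) ⟨
    ∑ₖ (λ z → f′ z ℤ.+ + 2 ℤ.* [ z ≐ 0# ]) ≡⟨ ∑-cong (λ i → pointwise (elt i) (elt i ≟ 0#)) ⟩
    ∑ₖ (λ z → ℤ.- + 1 ℤ.* χ (N z)) ≡⟨ ∑-*ˡ (ℤ.- + 1) (χ ∘ N ∘ elt) ⟩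
    ℤ.- + 1 ℤ.* ∑ₖ (χ ∘ N) ∎)
    where
    s+2≡-s : ∀ s → s ℤ.+ + 2 ≡ ℤ.- + 1 ℤ.* s → s ≡ ℤ.- + 1
    s+2≡-s s e = ℤₚ.*-cancelˡ-≡ (+ 2) s (ℤ.- + 1) (begin
      + 2 ℤ.* s ≡⟨ step₁ s ⟩
      (s ℤ.+ + 2) ℤ.+ (s ℤ.+ ℤ.- + 2) ≡⟨ cong (ℤ._+ (s ℤ.+ ℤ.- + 2)) e ⟩
      ℤ.- + 1 ℤ.* s ℤ.+ (s ℤ.+ ℤ.- + 2) ≡⟨ step₂ s ⟩
      + 2 ℤ.* (ℤ.- + 1) ∎)
      where
      step₁ : ∀ s → + 2 ℤ.* s ≡ (s ℤ.+ + 2) ℤ.+ (s ℤ.+ ℤ.- + 2)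
      step₁ = ℤ-ring
      step₂ : ∀ s → ℤ.- + 1 ℤ.* s ℤ.+ (s ℤ.+ ℤ.- + 2) ≡ + 2 ℤ.* (ℤ.- + 1)
      step₂ = ℤ-ring
    f′ : K → ℤ
    f′ z = χ (N (0# + g * inv z))
    pointwise : ∀ z → Dec (z ≡ 0#) → f′ z ℤ.+ + 2 ℤ.* [ z ≐ 0# ] ≡ ℤ.- + 1 ℤ.* χ (N z)
    pointwise z (yes z≡0) = begin
      f′ z ℤ.+ + 2 ℤ.* [ z ≐ 0# ] ≡⟨ cong₂ (λ v w → v ℤ.+ + 2 ℤ.* w) χ≡-1 (≐-yes z 0# z≡0) ⟩
      + 1 ≡⟨ cong (ℤ.- + 1 ℤ.*_) χNz≡-1 ⟨
      ℤ.- + 1 ℤ.* χ (N z) ∎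
      where
      χ[-g] : χ (- g) ≡ ℤ.- + 1
      χ[-g] = trans (χ-neg g) χ-g
      χ≡-1 : f′ z ≡ ℤ.- + 1
      χ≡-1 = trans (cong χ (trans (cong (λ w → N (0# + g * w)) (trans (cong inv z≡0) inv-0))
        (solve 1 (λ g → (con (+ 0) :+ g :* con (+ 0)) :* (con (+ 0) :+ g :* con (+ 0)) :- g := :- g) refl g))) χ[-g]
      χNz≡-1 : χ (N z) ≡ ℤ.- + 1
      χNz≡-1 = trans (cong χ (trans (cong N z≡0) (solve 1 (λ g → con (+ 0) :* con (+ 0) :- g := :- g) refl g))) χ[-g]
    pointwise z (no z≢0) = begin
      f′ z ℤ.+ + 2 ℤ.* [ z ≐ 0# ] ≡⟨ cong (λ w → f′ z ℤ.+ + 2 ℤ.* w) (≐-no z 0# z≢0) ⟩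
      f′ z ℤ.+ + 0 ≡⟨ ℤₚ.+-identityʳ (f′ z) ⟩
      χ (N (0# + g * r))
        ≡⟨ cong χ (solve 2 (λ g r → (con (+ 0) :+ g :* r) :* (con (+ 0) :+ g :* r) :- g := g :* (g :* (r :* r) :- con (+ 1) :* con (+ 1))) refl g r) ⟩
      χ (g * (g * (r * r) - 1# * 1#)) ≡⟨ cong (λ w → χ (g * (g * (r * r) - w * w))) (*-inv z≢0) ⟨
      χ (g * (g * (r * r) - (z * r) * (z * r)))
        ≡⟨ cong χ (solve 3 (λ g r z → g :* (g :* (r :* r) :- (z :* r) :* (z :* r)) := :- (g :* ((r :* r) :* (z :* z :- g)))) refl g r z) ⟩
      χ (- (g * ((r * r) * N z))) ≡⟨ χ-neg _ ⟩
      χ (g * ((r * r) * N z)) ≡⟨ χ-* g ((r * r) * N z) ⟩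
      χ g ℤ.* χ ((r * r) * N z) ≡⟨ cong₂ ℤ._*_ χ-g (χ-*-square (N z) r (inv-≢0 z≢0)) ⟩
      ℤ.- + 1 ℤ.* χ (N z) ∎
      where
      r : K
      r = inv z

  u v : K → ℤ
  u x = proj₁ (ψ (N x))
  v x = proj₂ (ψ (N x))

  A B : ℤ
  A = ∑ₖ u
  B = ∑ₖ v

  private
    ψ-*-fourth : ∀ x r → r ≢ 0# → ψ (((r * r) * (r * r)) * x) ≡ ψ x
    ψ-*-fourth x r r≢0 = begin
      ψ (((r * r) * (r * r)) * x) ≡⟨ ψ-* ((r * r) * (r * r)) x ⟩
      ψ ((r * r) * (r * r)) ⊗ ψ x ≡⟨ cong (_⊗ ψ x) (trans (ψ-* (r * r) (r * r)) (trans (ψ²≡χ (r * r)) (cong (_, + 0) (χ-square r r≢0)))) ⟩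
      (+ 1 , + 0) ⊗ ψ x ≡⟨ ⊗-identityˡ (ψ x) ⟩
      ψ x ∎

    χ⊗ψ : ∀ a b → (χ a , + 0) ⊗ ψ b ≡ ψ ((a * a) * b)
    χ⊗ψ a b = trans (cong (_⊗ ψ b) (trans (sym (ψ²≡χ a)) (sym (ψ-* a a)))) (sym (ψ-* (a * a) b))

    conjψ⊗ψ : ∀ n b → n ≢ 0# → conj (ψ n) ⊗ ψ b ≡ ψ ((n * n) * n * b)
    conjψ⊗ψ n b n≢0 = trans (cong (_⊗ ψ b) (trans (sym (χψ≡ψ̄ n n≢0)) (χ⊗ψ n n))) (sym (ψ-* ((n * n) * n) b))

    -- The substitution y = x - N x / (z + x), induced on the projective line by multiplication
    -- by x + √g in F(√g), of norm N x.
    substitute : ∀ x z → z + x ≢ 0# →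
      (χ (x + - N x * inv (z + x) - x) , + 0) ⊗ ψ (N (x + - N x * inv (z + x))) ≡ conj (ψ (N x)) ⊗ ψ (N z)
    substitute x z s≢0 = begin
      (χ (y - x) , + 0) ⊗ ψ (N y) ≡⟨ χ⊗ψ (y - x) (N y) ⟩
      ψ (((y - x) * (y - x)) * N y) ≡⟨ cong ψ simplify ⟩
      ψ (((r * r) * (r * r)) * ((n * n) * n * N z)) ≡⟨ ψ-*-fourth ((n * n) * n * N z) r (inv-≢0 s≢0) ⟩
      ψ ((n * n) * n * N z) ≡⟨ conjψ⊗ψ n (N z) (N≢0 x) ⟨
      conj (ψ n) ⊗ ψ (N z) ∎
      where
      n r y : K
      n = N x
      r = inv (z + x)
      y = x + - n * r
      simplify : ((y - x) * (y - x)) * N y ≡ ((r * r) * (r * r)) * ((n * n) * n * N z)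
      simplify = begin
        ((y - x) * (y - x)) * N y
          ≡⟨ solve 3 (λ x g r → let n = x :* x :- g ; y = x :+ :- n :* r in
               ((y :- x) :* (y :- x)) :* (y :* y :- g)
               := ((n :* r) :* (n :* r)) :* (n :* (con (+ 1) :* con (+ 1) :- (x :+ x) :* r :* con (+ 1) :+ n :* (r :* r)))) refl x g r ⟩
        ((n * r) * (n * r)) * (n * (1# * 1# - (x + x) * r * 1# + n * (r * r)))
          ≡⟨ cong (λ e → ((n * r) * (n * r)) * (n * (e * e - (x + x) * r * e + n * (r * r)))) (*-inv s≢0) ⟨
        ((n * r) * (n * r)) * (n * (((z + x) * r) * ((z + x) * r) - (x + x) * r * ((z + x) * r) + n * (r * r)))
          ≡⟨ solve 4 (λ x g r z → let n = x :* x :- g in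
               ((n :* r) :* (n :* r)) :* (n :* (((z :+ x) :* r) :* ((z :+ x) :* r) :- (x :+ x) :* r :* ((z :+ x) :* r) :+ n :* (r :* r)))
               := ((r :* r) :* (r :* r)) :* ((n :* n) :* n :* (z :* z :- g))) refl x g r z ⟩
        ((r * r) * (r * r)) * ((n * n) * n * N z) ∎

    pole : ∀ x z → z + x ≡ 0# →
      (χ (x + - N x * inv (z + x) - x) , + 0) ⊗ ψ (N (x + - N x * inv (z + x))) ≡ (+ 0 , + 0)
    pole x z s≡0 = trans (cong (λ c → (c , + 0) ⊗ ψ (N (x + - N x * inv (z + x)))) (trans (cong χ y-x≡0) χ-0))
      (CommutativeRing.zeroˡ ℤ[i]-ring (ψ (N (x + - N x * inv (z + x)))))
      where
      y-x≡0 : x + - N x * inv (z + x) - x ≡ 0#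
      y-x≡0 = trans (cong (λ w → x + - N x * w - x) (trans (cong inv s≡0) inv-0))
        (solve 2 (λ x n → x :+ :- n :* con (+ 0) :- x := con (+ 0)) refl x (N x))

    conjψ⊗ψ≡1 : ∀ x z → z + x ≡ 0# → conj (ψ (N x)) ⊗ ψ (N z) ≡ (+ 1 , + 0)
    conjψ⊗ψ≡1 x z s≡0 = trans (cong (λ w → conj (ψ (N x)) ⊗ ψ w) Nz≡Nx)
      (unit (ψ-Unit (N x) (N≢0 x)))
      where
      z≡-x : z ≡ - x
      z≡-x = trans (solve 2 (λ z x → z := (z :+ x) :- x) refl z x) (trans (cong (_- x) s≡0) (+-identityˡ (- x)))
      Nz≡Nx : N z ≡ N x
      Nz≡Nx = trans (cong N z≡-x) (solve 2 (λ x g → (:- x) :* (:- x) :- g := x :* x :- g) refl x g)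
      unit : ∀ {w} → Unit w → conj w ⊗ w ≡ (+ 1 , + 0)
      unit unit-1  = refl
      unit unit-i  = refl
      unit unit--1 = refl
      unit unit--i = refl

    module Pointwise (x z : K) where
      y : K
      y = x + - N x * inv (z + x)

      lhs rhs : ℤ[i]
      lhs = (χ (y - x) , + 0) ⊗ ψ (N y)
      rhs = conj (ψ (N x)) ⊗ ψ (N z)

      lhs-rhs : Dec (z + x ≡ 0#) → (proj₁ lhs ℤ.+ [ z + x ≐ 0# ] ≡ proj₁ rhs) × (proj₂ lhs ≡ proj₂ rhs)
      lhs-rhs (no s≢0) =
          trans (cong (λ w → proj₁ lhs ℤ.+ w) (≐-no (z + x) 0# s≢0))
            (trans (ℤₚ.+-identityʳ (proj₁ lhs)) (cong proj₁ (substitute x z s≢0)))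
        , cong proj₂ (substitute x z s≢0)
      lhs-rhs (yes s≡0) =
          trans (cong₂ ℤ._+_ (cong proj₁ (pole x z s≡0)) (≐-yes (z + x) 0# s≡0)) (cong proj₁ (sym (conjψ⊗ψ≡1 x z s≡0)))
        , trans (cong proj₂ (pole x z s≡0)) (cong proj₂ (sym (conjψ⊗ψ≡1 x z s≡0)))

      real : χ (y - x) ℤ.* u y ℤ.+ [ z + x ≐ 0# ] ≡ u x ℤ.* u z ℤ.+ v x ℤ.* v z
      real = trans (cong (ℤ._+ [ z + x ≐ 0# ]) (sym (ℤₚ.+-identityʳ (χ (y - x) ℤ.* u y))))
        (trans (proj₁ (lhs-rhs ((z + x) ≟ 0#))) (re (u x) (u z) (v x) (v z)))
        where
        re : ∀ a b c d → a ℤ.* b ℤ.+ ℤ.- + 1 ℤ.* (ℤ.- c ℤ.* d) ≡ a ℤ.* b ℤ.+ c ℤ.* d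
        re = ℤ-ring

      imaginary : χ (y - x) ℤ.* v y ≡ u x ℤ.* v z ℤ.+ ℤ.- v x ℤ.* u z
      imaginary = trans (im (χ (y - x)) (u y) (v y)) (proj₂ (lhs-rhs ((z + x) ≟ 0#)))
        where
        im : ∀ a b c → a ℤ.* c ≡ a ℤ.* c ℤ.+ + 0 ℤ.* b
        im = ℤ-ring

    ∑ₖ-möbius : ∀ x f → ∑ₖ f ≡ ∑ₖ (λ z → f (x + - N x * inv (z + x)))
    ∑ₖ-möbius x f = trans (∑ₖ-inv f x (- N x) -N≢0) (∑ₖ-translate (λ z → f (x + - N x * inv z)) x)
      where
      -N≢0 : - N x ≢ 0#
      -N≢0 e = N≢0 x (trans (solve 1 (λ n → n := :- (:- n)) refl (N x)) (trans (cong -_ e) (solve 0 (:- con (+ 0) := con (+ 0)) refl)))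

    ∑-linear : ∀ a b (f h : K → ℤ) → ∑ₖ (λ z → a ℤ.* f z ℤ.+ b ℤ.* h z) ≡ a ℤ.* ∑ₖ f ℤ.+ b ℤ.* ∑ₖ h
    ∑-linear a b f h = trans (∑-+ (λ i → a ℤ.* f (elt i)) (λ i → b ℤ.* h (elt i)))
      (cong₂ ℤ._+_ (∑-*ˡ a (f ∘ elt)) (∑-*ˡ b (h ∘ elt)))

  ∑χu : ∀ x → ∑ₖ (λ y → χ (y - x) ℤ.* u y) ℤ.+ + 1 ≡ u x ℤ.* A ℤ.+ v x ℤ.* B
  ∑χu x = begin
    ∑ₖ f ℤ.+ + 1 ≡⟨ cong₂ ℤ._+_ (∑ₖ-möbius x f) (sym (trans (sym (∑ₖ-translate (λ z → [ z ≐ 0# ]) x)) (∑ₖ-≐ 0#))) ⟩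
    ∑ₖ f′ ℤ.+ ∑ₖ (λ z → [ z + x ≐ 0# ]) ≡⟨ ∑-+ (f′ ∘ elt) (λ i → [ elt i + x ≐ 0# ]) ⟨
    ∑ₖ (λ z → f′ z ℤ.+ [ z + x ≐ 0# ]) ≡⟨ ∑-cong (λ i → Pointwise.real x (elt i)) ⟩
    ∑ₖ (λ z → u x ℤ.* u z ℤ.+ v x ℤ.* v z) ≡⟨ ∑-linear (u x) (v x) u v ⟩
    u x ℤ.* A ℤ.+ v x ℤ.* B ∎
    where
    f f′ : K → ℤ
    f y = χ (y - x) ℤ.* u y
    f′ z = f (x + - N x * inv (z + x))

  ∑χv : ∀ x → ∑ₖ (λ y → χ (y - x) ℤ.* v y) ≡ u x ℤ.* B ℤ.+ ℤ.- v x ℤ.* A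
  ∑χv x = begin
    ∑ₖ f ≡⟨ ∑ₖ-möbius x f ⟩
    ∑ₖ (λ z → f (x + - N x * inv (z + x))) ≡⟨ ∑-cong (λ i → Pointwise.imaginary x (elt i)) ⟩
    ∑ₖ (λ z → u x ℤ.* v z ℤ.+ ℤ.- v x ℤ.* u z) ≡⟨ ∑-linear (u x) (ℤ.- v x) v u ⟩
    u x ℤ.* B ℤ.+ ℤ.- v x ℤ.* A ∎
    where
    f : K → ℤ
    f y = χ (y - x) ℤ.* v y

-- H = (C+I, C-I; C-I, -C-I) for the symmetric conference matrix C on the projective line,
-- where nothing is the point at infinity.
module PaleyMatrix {q : ℕ} (F : FiniteField q) (χ : FiniteField.Carrier F → ℤ)
  (M≡χ : ∀ a b → Construction.M F a b ≡ χ (FiniteField._-_ F (FiniteField.elt F b) (FiniteField.elt F a)))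
  (χ-0 : χ (FiniteField.0# F) ≡ + 0)
  (χ-neg : ∀ x → χ (FiniteField.-_ F x) ≡ χ x)
  (χ-values : ∀ x → x ≢ FiniteField.0# F → χ x ≡ + 1 ⊎ χ x ≡ ℤ.- + 1)
  (∑χ : ∀ x → ∑ (λ i → χ (FiniteField._-_ F (FiniteField.elt F i) x)) ≡ + 0)
  (∑χ² : ∀ x → ∑ (λ i → χ (FiniteField._-_ F (FiniteField.elt F i) x) ℤ.* χ (FiniteField._-_ F (FiniteField.elt F i) x)) ≡ + q ℤ.+ ℤ.- + 1)
  (∑χχ : ∀ x y → x ≢ y → ∑ (λ i → χ (FiniteField._-_ F (FiniteField.elt F i) x) ℤ.* χ (FiniteField._-_ F (FiniteField.elt F i) y)) ≡ ℤ.- + 1)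
  where
  open Field F
  open FieldSum F
  open Construction F using (H; order)
  open Solver using (solve; _:=_; _:+_; _:*_; _:-_; :-_; con)

  Point : Set
  Point = Maybe K

  ∑ₚ : (Point → ℤ) → ℤ
  ∑ₚ f = f nothing ℤ.+ ∑ₖ (f ∘ just)

  ∑ₚ-cong : ∀ {f h : Point → ℤ} → (∀ l → f l ≡ h l) → ∑ₚ f ≡ ∑ₚ h
  ∑ₚ-cong e = cong₂ ℤ._+_ (e nothing) (∑-cong (e ∘ just ∘ elt))

  ∑ₚ-linear : ∀ a b (f h : Point → ℤ) → ∑ₚ (λ l → a ℤ.* f l ℤ.+ b ℤ.* h l) ≡ a ℤ.* ∑ₚ f ℤ.+ b ℤ.* ∑ₚ h
  ∑ₚ-linear a b f h = trans
    (cong (λ s → (a ℤ.* f nothing ℤ.+ b ℤ.* h nothing) ℤ.+ s) (trans (∑-+ (λ i → a ℤ.* f (just (elt i))) (λ i → b ℤ.* h (just (elt i))))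
      (cong₂ ℤ._+_ (∑-*ˡ a (f ∘ just ∘ elt)) (∑-*ˡ b (h ∘ just ∘ elt)))))
    (regroup a b (f nothing) (h nothing) (∑ₖ (f ∘ just)) (∑ₖ (h ∘ just)))
    where
    regroup : ∀ a b x y z w → (a ℤ.* x ℤ.+ b ℤ.* y) ℤ.+ (a ℤ.* z ℤ.+ b ℤ.* w) ≡ a ℤ.* (x ℤ.+ z) ℤ.+ b ℤ.* (y ℤ.+ w)
    regroup = ℤ-ring

  ∑ₚ-combine : ∀ (f h k : Point → ℤ) → (∀ l → f l ℤ.+ h l ≡ k l) → ∑ₚ f ℤ.+ ∑ₚ h ≡ ∑ₚ k
  ∑ₚ-combine f h k e = trans (units (∑ₚ f) (∑ₚ h)) (trans (sym (∑ₚ-linear (+ 1) (+ 1) f h))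
    (∑ₚ-cong (λ l → trans (sym (units (f l) (h l))) (e l))))
    where
    units : ∀ a b → a ℤ.+ b ≡ + 1 ℤ.* a ℤ.+ + 1 ℤ.* b
    units = ℤ-ring

  C D : Point → Point → ℤ
  C nothing  nothing  = + 0
  C nothing  (just _) = + 1
  C (just _) nothing  = + 1
  C (just x) (just y) = χ (y - x)
  D nothing  nothing  = + 1
  D nothing  (just _) = + 0
  D (just _) nothing  = + 0
  D (just x) (just y) = [ x ≐ y ]

  C-sym : ∀ p r → C p r ≡ C r p
  C-sym nothing  nothing  = refl
  C-sym nothing  (just _) = refl
  C-sym (just _) nothing  = refl
  C-sym (just x) (just y) = trans (cong χ (solve 2 (λ x y → y :- x := :- (x :- y)) refl x y)) (χ-neg (x - y))

  D-refl : ∀ p → D p p ≡ + 1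
  D-refl nothing  = refl
  D-refl (just x) = ≐-yes x x refl

  D-≢ : ∀ p r → p ≢ r → D p r ≡ + 0
  D-≢ nothing  nothing  p≢r = contradiction refl p≢r
  D-≢ nothing  (just _) p≢r = refl
  D-≢ (just _) nothing  p≢r = refl
  D-≢ (just x) (just y) p≢r = ≐-no x y (p≢r ∘ cong just)

  _≟ₚ_ : (p r : Point) → Dec (p ≡ r)
  nothing ≟ₚ nothing = yes refl
  nothing ≟ₚ just _  = no λ ()
  just _  ≟ₚ nothing = no λ ()
  just x  ≟ₚ just y with x ≟ y
  ... | yes refl = yes refl
  ... | no x≢y   = no λ { refl → x≢y refl }

  D-sym : ∀ p r → D p r ≡ D r p
  D-sym p r with p ≟ₚ r
  ... | yes refl = refl
  ... | no p≢r   = trans (D-≢ p r p≢r) (sym (D-≢ r p (p≢r ∘ sym)))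

  ∑ₚ-D : ∀ p (f : Point → ℤ) → ∑ₚ (λ l → D p l ℤ.* f l) ≡ f p
  ∑ₚ-D nothing f = trans (cong₂ ℤ._+_ (ℤₚ.*-identityˡ (f nothing)) (trans (∑-const q (+ 0)) (ℤₚ.*-zeroʳ (+ q)))) (ℤₚ.+-identityʳ (f nothing))
  ∑ₚ-D (just x) f = trans (ℤₚ.+-identityˡ (∑ₖ (λ y → [ x ≐ y ] ℤ.* f (just y))))
    (trans (∑ₖ-single (λ y → [ x ≐ y ] ℤ.* f (just y)) x (λ y y≢x → cong (ℤ._* f (just y)) (≐-no x y (y≢x ∘ sym))))
      (trans (cong (ℤ._* f (just x)) (≐-yes x x refl)) (ℤₚ.*-identityˡ (f (just x)))))

  ∑ₚ-CC-refl : ∀ p → ∑ₚ (λ l → C p l ℤ.* C p l) ≡ + q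
  ∑ₚ-CC-refl nothing = trans (ℤₚ.+-identityˡ _) (trans (∑-const q (+ 1)) (ℤₚ.*-identityʳ (+ q)))
  ∑ₚ-CC-refl (just x) = trans (cong (λ s → + 1 ℤ.+ s) (∑χ² x)) (cancel (+ q))
    where
    cancel : ∀ a → + 1 ℤ.+ (a ℤ.+ ℤ.- + 1) ≡ a
    cancel = ℤ-ring

  ∑ₚ-CC-≢ : ∀ p r → p ≢ r → ∑ₚ (λ l → C p l ℤ.* C r l) ≡ + 0
  ∑ₚ-CC-≢ nothing  nothing  p≢r = contradiction refl p≢r
  ∑ₚ-CC-≢ nothing  (just y) p≢r = trans (ℤₚ.+-identityˡ _) (trans (∑-cong (λ i → ℤₚ.*-identityˡ (χ (elt i - y)))) (∑χ y))
  ∑ₚ-CC-≢ (just x) nothing  p≢r = trans (ℤₚ.+-identityˡ _) (trans (∑-cong (λ i → ℤₚ.*-identityʳ (χ (elt i - x)))) (∑χ x))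
  ∑ₚ-CC-≢ (just x) (just y) p≢r = cong (λ s → + 1 ℤ.+ s) (∑χχ x y (p≢r ∘ cong just))

  Index : Set
  Index = Point × Bool

  H′ : Index → Index → ℤ
  H′ (p , true)  (r , true)  = C p r ℤ.+ D p r
  H′ (p , true)  (r , false) = C p r ℤ.- D p r
  H′ (p , false) (r , true)  = C p r ℤ.- D p r
  H′ (p , false) (r , false) = ℤ.- (C p r ℤ.+ D p r)

  block : Fin q ⊎ Fin q → Index
  block (inj₁ a) = just (elt a) , true
  block (inj₂ a) = just (elt a) , false

  code : Fin order → Index
  code Fin.zero              = nothing , true
  code (Fin.suc Fin.zero)    = nothing , false
  code (Fin.suc (Fin.suc j)) = block (splitAt q j)

  H≡H′ : ∀ i j → H i j ≡ H′ (code i) (code j)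
  H≡H′ Fin.zero Fin.zero = refl
  H≡H′ Fin.zero (Fin.suc Fin.zero) = refl
  H≡H′ Fin.zero (Fin.suc (Fin.suc j)) with splitAt q j
  ... | inj₁ _ = refl
  ... | inj₂ _ = refl
  H≡H′ (Fin.suc Fin.zero) Fin.zero = refl
  H≡H′ (Fin.suc Fin.zero) (Fin.suc Fin.zero) = refl
  H≡H′ (Fin.suc Fin.zero) (Fin.suc (Fin.suc j)) with splitAt q j
  ... | inj₁ _ = refl
  ... | inj₂ _ = refl
  H≡H′ (Fin.suc (Fin.suc i)) Fin.zero with splitAt q i
  ... | inj₁ _ = refl
  ... | inj₂ _ = refl
  H≡H′ (Fin.suc (Fin.suc i)) (Fin.suc Fin.zero) with splitAt q i
  ... | inj₁ _ = refl
  ... | inj₂ _ = refl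
  H≡H′ (Fin.suc (Fin.suc i)) (Fin.suc (Fin.suc j)) with splitAt q i | splitAt q j
  ... | inj₁ a | inj₁ b = cong (ℤ._+ [ elt a ≐ elt b ]) (M≡χ a b)
  ... | inj₁ a | inj₂ b = cong (ℤ._- [ elt a ≐ elt b ]) (M≡χ a b)
  ... | inj₂ a | inj₁ b = cong (ℤ._- [ elt a ≐ elt b ]) (M≡χ a b)
  ... | inj₂ a | inj₂ b = cong (λ c → ℤ.- (c ℤ.+ [ elt a ≐ elt b ])) (M≡χ a b)

  code-injective : ∀ {i j} → code i ≡ code j → i ≡ j
  code-injective {Fin.zero} {Fin.zero} e = refl
  code-injective {Fin.zero} {Fin.suc (Fin.suc j)} e with splitAt q j | e
  ... | inj₁ _ | ()
  ... | inj₂ _ | ()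
  code-injective {Fin.suc Fin.zero} {Fin.suc Fin.zero} e = refl
  code-injective {Fin.suc Fin.zero} {Fin.suc (Fin.suc j)} e with splitAt q j | e
  ... | inj₁ _ | ()
  ... | inj₂ _ | ()
  code-injective {Fin.suc (Fin.suc i)} {Fin.zero} e with splitAt q i | e
  ... | inj₁ _ | ()
  ... | inj₂ _ | ()
  code-injective {Fin.suc (Fin.suc i)} {Fin.suc Fin.zero} e with splitAt q i | e
  ... | inj₁ _ | ()
  ... | inj₂ _ | ()
  code-injective {Fin.suc (Fin.suc i)} {Fin.suc (Fin.suc j)} e = cong (Fin.suc ∘ Fin.suc)
    (trans (sym (Finₚ.join-splitAt q q i)) (trans (cong (Fin.join q q) (block-injective e)) (Finₚ.join-splitAt q q j)))
    where
    block-injective : ∀ {a b} → block a ≡ block b → a ≡ b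
    block-injective {inj₁ a} {inj₁ b} e = cong inj₁ (elt-injective (just-injective (cong proj₁ e)))
      where
      just-injective : ∀ {x y : K} → just x ≡ just y → x ≡ y
      just-injective refl = refl
    block-injective {inj₂ a} {inj₂ b} e = cong inj₂ (elt-injective (just-injective (cong proj₁ e)))
      where
      just-injective : ∀ {x y : K} → just x ≡ just y → x ≡ y
      just-injective refl = refl
    block-injective {inj₁ a} {inj₂ b} ()
    block-injective {inj₂ a} {inj₁ b} ()

  ∑-code : ∀ (f : Index → ℤ) → ∑ (f ∘ code) ≡ ∑ₚ (λ l → f (l , true)) ℤ.+ ∑ₚ (λ l → f (l , false))
  ∑-code f = begin
    a ℤ.+ (b ℤ.+ ∑ (λ j → f (block (splitAt q j))))
      ≡⟨ cong (λ s → a ℤ.+ (b ℤ.+ s)) (trans (∑-++ q (λ j → f (block (splitAt q j)))) (cong₂ ℤ._+_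
           (∑-cong (λ i → cong (f ∘ block) (Finₚ.splitAt-↑ˡ q i q))) (∑-cong (λ i → cong (f ∘ block) (Finₚ.splitAt-↑ʳ q q i))))) ⟩
    a ℤ.+ (b ℤ.+ (c ℤ.+ d))
      ≡⟨ regroup a b c d ⟩
    (a ℤ.+ c) ℤ.+ (b ℤ.+ d) ∎
    where
    a b c d : ℤ
    a = f (nothing , true)
    b = f (nothing , false)
    c = ∑ₖ (λ x → f (just x , true))
    d = ∑ₖ (λ x → f (just x , false))
    regroup : ∀ a b c d → a ℤ.+ (b ℤ.+ (c ℤ.+ d)) ≡ (a ℤ.+ c) ℤ.+ (b ℤ.+ d)
    regroup = ℤ-ring

  private
    ∑ₚ-CD : ∀ p r → ∑ₚ (λ l → C p l ℤ.* D r l) ≡ C p r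
    ∑ₚ-CD p r = trans (∑ₚ-cong (λ l → ℤₚ.*-comm (C p l) (D r l))) (∑ₚ-D r (C p))

    2[s+d] : ℤ → ℤ → ℤ
    2[s+d] s d = + 2 ℤ.* s ℤ.+ + 2 ℤ.* d

    same-block : ∀ p r → ∑ₚ (λ l → (C p l ℤ.+ D p l) ℤ.* (C r l ℤ.+ D r l)) ℤ.+ ∑ₚ (λ l → (C p l ℤ.- D p l) ℤ.* (C r l ℤ.- D r l))
      ≡ 2[s+d] (∑ₚ (λ l → C p l ℤ.* C r l)) (D r p)
    same-block p r = begin
      ∑ₚ f₁ ℤ.+ ∑ₚ f₂
        ≡⟨ ∑ₚ-combine f₁ f₂ (λ l → + 2 ℤ.* (C p l ℤ.* C r l) ℤ.+ + 2 ℤ.* (D p l ℤ.* D r l)) (λ l → expand (C p l) (D p l) (C r l) (D r l)) ⟩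
      ∑ₚ (λ l → + 2 ℤ.* (C p l ℤ.* C r l) ℤ.+ + 2 ℤ.* (D p l ℤ.* D r l))
        ≡⟨ ∑ₚ-linear (+ 2) (+ 2) (λ l → C p l ℤ.* C r l) (λ l → D p l ℤ.* D r l) ⟩
      2[s+d] (∑ₚ (λ l → C p l ℤ.* C r l)) (∑ₚ (λ l → D p l ℤ.* D r l))
        ≡⟨ cong (2[s+d] (∑ₚ (λ l → C p l ℤ.* C r l))) (∑ₚ-D p (D r)) ⟩
      2[s+d] (∑ₚ (λ l → C p l ℤ.* C r l)) (D r p) ∎
      where
      f₁ f₂ : Point → ℤ
      f₁ l = (C p l ℤ.+ D p l) ℤ.* (C r l ℤ.+ D r l)
      f₂ l = (C p l ℤ.- D p l) ℤ.* (C r l ℤ.- D r l)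
      expand : ∀ c d c′ d′ → ((c ℤ.+ d) ℤ.* (c′ ℤ.+ d′)) ℤ.+ ((c ℤ.- d) ℤ.* (c′ ℤ.- d′))
        ≡ + 2 ℤ.* (c ℤ.* c′) ℤ.+ + 2 ℤ.* (d ℤ.* d′)
      expand = ℤ-ring

    cross-block : ∀ p r → ∑ₚ (λ l → (C p l ℤ.+ D p l) ℤ.* (C r l ℤ.- D r l)) ℤ.+ ∑ₚ (λ l → (C p l ℤ.- D p l) ℤ.* ℤ.- (C r l ℤ.+ D r l)) ≡ + 0
    cross-block p r = begin
      ∑ₚ f₁ ℤ.+ ∑ₚ f₂
        ≡⟨ ∑ₚ-combine f₁ f₂ (λ l → + 2 ℤ.* (D p l ℤ.* C r l) ℤ.+ ℤ.- + 2 ℤ.* (C p l ℤ.* D r l)) (λ l → expand (C p l) (D p l) (C r l) (D r l)) ⟩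
      ∑ₚ (λ l → + 2 ℤ.* (D p l ℤ.* C r l) ℤ.+ ℤ.- + 2 ℤ.* (C p l ℤ.* D r l))
        ≡⟨ ∑ₚ-linear (+ 2) (ℤ.- + 2) (λ l → D p l ℤ.* C r l) (λ l → C p l ℤ.* D r l) ⟩
      + 2 ℤ.* ∑ₚ (λ l → D p l ℤ.* C r l) ℤ.+ ℤ.- + 2 ℤ.* ∑ₚ (λ l → C p l ℤ.* D r l)
        ≡⟨ cong₂ (λ a b → + 2 ℤ.* a ℤ.+ ℤ.- + 2 ℤ.* b) (trans (∑ₚ-D p (C r)) (C-sym r p)) (∑ₚ-CD p r) ⟩
      + 2 ℤ.* C p r ℤ.+ ℤ.- + 2 ℤ.* C p r ≡⟨ cancel (C p r) ⟩
      + 0 ∎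
      where
      f₁ f₂ : Point → ℤ
      f₁ l = (C p l ℤ.+ D p l) ℤ.* (C r l ℤ.- D r l)
      f₂ l = (C p l ℤ.- D p l) ℤ.* ℤ.- (C r l ℤ.+ D r l)
      cancel : ∀ a → + 2 ℤ.* a ℤ.+ ℤ.- + 2 ℤ.* a ≡ + 0
      cancel = ℤ-ring
      expand : ∀ c d c′ d′ → ((c ℤ.+ d) ℤ.* (c′ ℤ.- d′)) ℤ.+ ((c ℤ.- d) ℤ.* ℤ.- (c′ ℤ.+ d′))
        ≡ + 2 ℤ.* (d ℤ.* c′) ℤ.+ ℤ.- + 2 ℤ.* (c ℤ.* d′)
      expand = ℤ-ring

  inner : Index → Index → ℤ
  inner i j = ∑ₚ (λ l → H′ i (l , true) ℤ.* H′ j (l , true)) ℤ.+ ∑ₚ (λ l → H′ i (l , false) ℤ.* H′ j (l , false))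

  private
    inner-value : ∀ p s r → inner (p , s) (r , s) ≡ 2[s+d] (∑ₚ (λ l → C p l ℤ.* C r l)) (D r p)
    inner-value p true  r = same-block p r
    inner-value p false r = trans (ℤₚ.+-comm (∑ₚ (λ l → (C p l ℤ.- D p l) ℤ.* (C r l ℤ.- D r l))) _)
      (trans (cong (ℤ._+ ∑ₚ (λ l → (C p l ℤ.- D p l) ℤ.* (C r l ℤ.- D r l)))
        (∑ₚ-cong (λ l → negneg (C p l ℤ.+ D p l) (C r l ℤ.+ D r l)))) (same-block p r))
      where
      negneg : ∀ a b → ℤ.- a ℤ.* ℤ.- b ≡ a ℤ.* b
      negneg = ℤ-ring

  inner-refl : ∀ i → inner i i ≡ + order
  inner-refl (p , s) = begin
    inner (p , s) (p , s) ≡⟨ inner-value p s p ⟩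
    2[s+d] (∑ₚ (λ l → C p l ℤ.* C p l)) (D p p) ≡⟨ cong₂ 2[s+d] (∑ₚ-CC-refl p) (D-refl p) ⟩
    + 2 ℤ.* + q ℤ.+ + 2 ≡⟨ double (+ q) ⟩
    + 2 ℤ.+ (+ q ℤ.+ + q) ∎
    where
    double : ∀ a → + 2 ℤ.* a ℤ.+ + 2 ≡ + 2 ℤ.+ (a ℤ.+ a)
    double = ℤ-ring

  inner-≢ : ∀ i j → i ≢ j → inner i j ≡ + 0
  inner-≢ (p , true)  (r , false) i≢j = cross-block p r
  inner-≢ (p , false) (r , true)  i≢j = trans (cong₂ ℤ._+_
    (∑ₚ-cong (λ l → ℤₚ.*-comm (C p l ℤ.- D p l) (C r l ℤ.+ D r l)))
    (∑ₚ-cong (λ l → ℤₚ.*-comm (ℤ.- (C p l ℤ.+ D p l)) (C r l ℤ.- D r l)))) (cross-block r p)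
  inner-≢ (p , true)  (r , true)  i≢j = trans (inner-value p true r) (cong₂ 2[s+d] (∑ₚ-CC-≢ p r p≢r) (D-≢ r p (p≢r ∘ sym)))
    where
    p≢r : p ≢ r
    p≢r e = i≢j (cong (_, true) e)
  inner-≢ (p , false) (r , false) i≢j = trans (inner-value p false r) (cong₂ 2[s+d] (∑ₚ-CC-≢ p r p≢r) (D-≢ r p (p≢r ∘ sym)))
    where
    p≢r : p ≢ r
    p≢r e = i≢j (cong (_, false) e)

  private
    ±1 : ℤ → Set
    ±1 a = a ≡ + 1 ⊎ a ≡ ℤ.- + 1

    C-diag : ∀ p → C p p ≡ + 0
    C-diag nothing  = refl
    C-diag (just x) = trans (cong χ (-‿inverseʳ x)) χ-0

    C-off : ∀ p r → p ≢ r → ±1 (C p r)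
    C-off nothing  nothing  p≢r = contradiction refl p≢r
    C-off nothing  (just _) p≢r = inj₁ refl
    C-off (just _) nothing  p≢r = inj₁ refl
    C-off (just x) (just y) p≢r = χ-values (y - x) (λ e → p≢r (cong just (sym (x-y≡0 y x e))))

    C±D : ∀ p r → ±1 (C p r ℤ.+ D p r) × ±1 (C p r ℤ.- D p r)
    C±D p r with p ≟ₚ r
    ... | yes refl rewrite D-refl p | C-diag p = inj₁ refl , inj₂ refl
    ... | no p≢r rewrite D-≢ p r p≢r | ℤₚ.+-identityʳ (C p r) = C-off p r p≢r , C-off p r p≢r

    ±1-neg : ∀ {a} → ±1 a → ±1 (ℤ.- a)
    ±1-neg (inj₁ refl) = inj₂ refl
    ±1-neg (inj₂ refl) = inj₁ refl

  H′-entries : ∀ i j → H′ i j ≡ + 1 ⊎ H′ i j ≡ ℤ.- + 1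
  H′-entries (p , true)  (r , true)  = proj₁ (C±D p r)
  H′-entries (p , true)  (r , false) = proj₂ (C±D p r)
  H′-entries (p , false) (r , true)  = proj₂ (C±D p r)
  H′-entries (p , false) (r , false) = ±1-neg (proj₁ (C±D p r))

  H′-sym : ∀ i j → H′ i j ≡ H′ j i
  H′-sym (p , true)  (r , true)  = cong₂ ℤ._+_ (C-sym p r) (D-sym p r)
  H′-sym (p , true)  (r , false) = cong₂ ℤ._-_ (C-sym p r) (D-sym p r)
  H′-sym (p , false) (r , true)  = cong₂ ℤ._-_ (C-sym p r) (D-sym p r)
  H′-sym (p , false) (r , false) = cong ℤ.-_ (cong₂ ℤ._+_ (C-sym p r) (D-sym p r))

  H-sym : ∀ i j → H i j ≡ H j i
  H-sym i j = trans (H≡H′ i j) (trans (H′-sym (code i) (code j)) (sym (H≡H′ j i)))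

  H-inner : ∀ i j → ∑ (λ l → H i l ℤ.* H j l) ≡ inner (code i) (code j)
  H-inner i j = trans (∑-cong (λ l → cong₂ ℤ._*_ (H≡H′ i l) (H≡H′ j l)))
    (∑-code (λ l → H′ (code i) l ℤ.* H′ (code j) l))

  H-hadamard : IsHadamard order H
  H-hadamard = (λ i j → subst ±1 (sym (H≡H′ i j)) (H′-entries (code i) (code j)))
    , (λ i → trans (H-inner i i) (inner-refl (code i)))
    , (λ i j i≢j → trans (H-inner i j) (inner-≢ (code i) (code j) (i≢j ∘ code-injective)))

  module RowSums (u v : K → ℤ) (A B : ℤ)
    (∑u : ∑ₖ u ≡ A) (∑v : ∑ₖ v ≡ B)
    (∑χu : ∀ x → ∑ₖ (λ y → χ (y - x) ℤ.* u y) ℤ.+ + 1 ≡ u x ℤ.* A ℤ.+ v x ℤ.* B)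
    (∑χv : ∀ x → ∑ₖ (λ y → χ (y - x) ℤ.* v y) ≡ u x ℤ.* B ℤ.+ ℤ.- v x ℤ.* A)
    where

    ũ ṽ : Point → ℤ
    ũ nothing  = + 1
    ũ (just x) = u x
    ṽ nothing  = + 0
    ṽ (just x) = v x

    weight : Index → ℤ
    weight (p , true)  = ũ p ℤ.+ ṽ p
    weight (p , false) = ũ p ℤ.- ṽ p

    weightedRow : Index → ℤ
    weightedRow (p , true)  = + 2 ℤ.* (ũ p ℤ.* A ℤ.+ ṽ p ℤ.* (B ℤ.+ + 1))
    weightedRow (p , false) = + 2 ℤ.* (ũ p ℤ.* (B ℤ.- + 1) ℤ.- ṽ p ℤ.* A)

    private
      Cũ : ∀ p → ∑ₚ (λ l → C p l ℤ.* ũ l) ≡ ũ p ℤ.* A ℤ.+ ṽ p ℤ.* B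
      Cũ nothing = trans (ℤₚ.+-identityˡ _) (trans (∑-cong (λ i → ℤₚ.*-identityˡ (u (elt i))))
        (trans ∑u (one A B)))
        where
        one : ∀ a b → a ≡ + 1 ℤ.* a ℤ.+ + 0 ℤ.* b
        one = ℤ-ring
      Cũ (just x) = trans (ℤₚ.+-comm (+ 1) (∑ₖ (λ y → χ (y - x) ℤ.* u y))) (∑χu x)

      Cṽ : ∀ p → ∑ₚ (λ l → C p l ℤ.* ṽ l) ≡ ũ p ℤ.* B ℤ.+ ℤ.- ṽ p ℤ.* A
      Cṽ nothing = trans (ℤₚ.+-identityˡ _) (trans (∑-cong (λ i → ℤₚ.*-identityˡ (v (elt i))))
        (trans ∑v (one A B)))
        where
        one : ∀ a b → b ≡ + 1 ℤ.* b ℤ.+ + 0 ℤ.* a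
        one = ℤ-ring
      Cṽ (just x) = trans (ℤₚ.+-identityˡ (∑ₖ (λ y → χ (y - x) ℤ.* v y))) (∑χv x)

    H′-row : ∀ i → ∑ₚ (λ l → H′ i (l , true) ℤ.* weight (l , true)) ℤ.+ ∑ₚ (λ l → H′ i (l , false) ℤ.* weight (l , false)) ≡ weightedRow i
    H′-row (p , true) = begin
      _ ≡⟨ ∑ₚ-combine (λ l → (C p l ℤ.+ D p l) ℤ.* (ũ l ℤ.+ ṽ l)) (λ l → (C p l ℤ.- D p l) ℤ.* (ũ l ℤ.- ṽ l))
             (λ l → + 2 ℤ.* (C p l ℤ.* ũ l) ℤ.+ + 2 ℤ.* (D p l ℤ.* ṽ l)) (λ l → expand (C p l) (D p l) (ũ l) (ṽ l)) ⟩
      ∑ₚ (λ l → + 2 ℤ.* (C p l ℤ.* ũ l) ℤ.+ + 2 ℤ.* (D p l ℤ.* ṽ l))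
        ≡⟨ ∑ₚ-linear (+ 2) (+ 2) (λ l → C p l ℤ.* ũ l) (λ l → D p l ℤ.* ṽ l) ⟩
      + 2 ℤ.* ∑ₚ (λ l → C p l ℤ.* ũ l) ℤ.+ + 2 ℤ.* ∑ₚ (λ l → D p l ℤ.* ṽ l)
        ≡⟨ cong₂ (λ a b → + 2 ℤ.* a ℤ.+ + 2 ℤ.* b) (Cũ p) (∑ₚ-D p ṽ) ⟩
      + 2 ℤ.* (ũ p ℤ.* A ℤ.+ ṽ p ℤ.* B) ℤ.+ + 2 ℤ.* ṽ p
        ≡⟨ collect (ũ p) (ṽ p) A B ⟩
      weightedRow (p , true) ∎
      where
      expand : ∀ c d a b → ((c ℤ.+ d) ℤ.* (a ℤ.+ b)) ℤ.+ ((c ℤ.- d) ℤ.* (a ℤ.- b)) ≡ + 2 ℤ.* (c ℤ.* a) ℤ.+ + 2 ℤ.* (d ℤ.* b)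
      expand = ℤ-ring
      collect : ∀ a b x y → + 2 ℤ.* (a ℤ.* x ℤ.+ b ℤ.* y) ℤ.+ + 2 ℤ.* b ≡ + 2 ℤ.* (a ℤ.* x ℤ.+ b ℤ.* (y ℤ.+ + 1))
      collect = ℤ-ring
    H′-row (p , false) = begin
      _ ≡⟨ ∑ₚ-combine (λ l → (C p l ℤ.- D p l) ℤ.* (ũ l ℤ.+ ṽ l)) (λ l → ℤ.- (C p l ℤ.+ D p l) ℤ.* (ũ l ℤ.- ṽ l))
             (λ l → + 2 ℤ.* (C p l ℤ.* ṽ l) ℤ.+ ℤ.- + 2 ℤ.* (D p l ℤ.* ũ l)) (λ l → expand (C p l) (D p l) (ũ l) (ṽ l)) ⟩
      ∑ₚ (λ l → + 2 ℤ.* (C p l ℤ.* ṽ l) ℤ.+ ℤ.- + 2 ℤ.* (D p l ℤ.* ũ l))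
        ≡⟨ ∑ₚ-linear (+ 2) (ℤ.- + 2) (λ l → C p l ℤ.* ṽ l) (λ l → D p l ℤ.* ũ l) ⟩
      + 2 ℤ.* ∑ₚ (λ l → C p l ℤ.* ṽ l) ℤ.+ ℤ.- + 2 ℤ.* ∑ₚ (λ l → D p l ℤ.* ũ l)
        ≡⟨ cong₂ (λ a b → + 2 ℤ.* a ℤ.+ ℤ.- + 2 ℤ.* b) (Cṽ p) (∑ₚ-D p ũ) ⟩
      + 2 ℤ.* (ũ p ℤ.* B ℤ.+ ℤ.- ṽ p ℤ.* A) ℤ.+ ℤ.- + 2 ℤ.* ũ p
        ≡⟨ collect (ũ p) (ṽ p) A B ⟩
      weightedRow (p , false) ∎
      where
      expand : ∀ c d a b → ((c ℤ.- d) ℤ.* (a ℤ.+ b)) ℤ.+ (ℤ.- (c ℤ.+ d) ℤ.* (a ℤ.- b)) ≡ + 2 ℤ.* (c ℤ.* b) ℤ.+ ℤ.- + 2 ℤ.* (d ℤ.* a)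
      expand = ℤ-ring
      collect : ∀ a b x y → + 2 ℤ.* (a ℤ.* y ℤ.+ ℤ.- b ℤ.* x) ℤ.+ ℤ.- + 2 ℤ.* a ≡ + 2 ℤ.* (a ℤ.* (y ℤ.- + 1) ℤ.- b ℤ.* x)
      collect = ℤ-ring

    H-row : ∀ i → ∑ (λ j → H i j ℤ.* weight (code j)) ≡ weightedRow (code i)
    H-row i = trans (∑-cong (λ j → cong (ℤ._* weight (code j)) (H≡H′ i j)))
      (trans (∑-code (λ j → H′ (code i) j ℤ.* weight j)) (H′-row (code i)))

module Paley {q : ℕ} (F : FiniteField q) (t : ℕ) (0<t : 0 < t)
  (q≡1+4t : q ≡ 1+4× t) where
  open Field F
  open FieldSum F
  open QuarticCharacter F t 0<t q≡1+4t
  open CharacterSums F t 0<t q≡1+4t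
  open Construction F using (H; order; M)
  open Solver using (solve; _:=_; _:+_; _:*_; _:-_; :-_; con)

  private
    M-cases : ∀ a b (d : Dec (elt a ≡ elt b)) (s : Dec (∃ λ c → elt c * elt c ≡ elt b - elt a)) →
      (if ⌊ d ⌋ then + 0 else (if ⌊ s ⌋ then + 1 else ℤ.- + 1)) ≡ χ (elt b - elt a)
    M-cases a b (yes e) _ = sym (trans (cong χ (trans (cong (λ w → elt b - w) e) (-‿inverseʳ (elt b)))) χ-0)
    M-cases a b (no ne) (yes (c , e)) = sym (trans (cong χ (sym e)) (χ-square (elt c) c≢0))
      where
      c≢0 : elt c ≢ 0#
      c≢0 e′ = ne (sym (x-y≡0 (elt b) (elt a) (trans (sym e) (trans (cong (_* elt c) e′) (zeroˡ (elt c))))))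
    M-cases a b (no ne) (no ¬sq) = sym (χ-nonsquare (elt b - elt a) ¬sq)

    M-unfold : ∀ a b → M a b ≡ (if ⌊ elt a ≟ elt b ⌋ then + 0 else (if ⌊ isSquare? (elt b - elt a) ⌋ then + 1 else ℤ.- + 1))
    M-unfold a b with elt a ≟ elt b
    ... | yes _ = refl
    ... | no _  = refl

    M≡χ : ∀ a b → M a b ≡ χ (elt b - elt a)
    M≡χ a b = trans (M-unfold a b) (M-cases a b (elt a ≟ elt b) (isSquare? (elt b - elt a)))

    ∑χ-translate : ∀ x → ∑ₖ (λ y → χ (y - x)) ≡ + 0
    ∑χ-translate x = trans (sym (∑ₖ-translate χ (- x))) ∑χ≡0

  open PaleyMatrix F χ M≡χ χ-0 χ-neg χ-values ∑χ-translate ∑χ²≡q-1 ∑χχ≡-1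
  open RowSums u v A B refl refl ∑χu ∑χv

  private
    w-Unit : ∀ p → Unit (ũ p , ṽ p)
    w-Unit nothing  = unit-1
    w-Unit (just x) = ψ-Unit (N x) (N≢0 x)

    weight-±1 : ∀ i → weight i ≡ + 1 ⊎ weight i ≡ ℤ.- + 1
    weight-±1 (p , true) = unit (w-Unit p)
      where
      unit : ∀ {a b} → Unit (a , b) → a ℤ.+ b ≡ + 1 ⊎ a ℤ.+ b ≡ ℤ.- + 1
      unit unit-1  = inj₁ refl
      unit unit-i  = inj₁ refl
      unit unit--1 = inj₂ refl
      unit unit--i = inj₂ refl
    weight-±1 (p , false) = unit (w-Unit p)
      where
      unit : ∀ {a b} → Unit (a , b) → a ℤ.- b ≡ + 1 ⊎ a ℤ.- b ≡ ℤ.- + 1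
      unit unit-1  = inj₁ refl
      unit unit-i  = inj₂ refl
      unit unit--1 = inj₂ refl
      unit unit--i = inj₁ refl

  hadamard : IsHadamard order H
  hadamard = H-hadamard

  colSign : Fin order → ℤ
  colSign j = weight (code j)

  colSign-±1 : ∀ j → colSign j ≡ + 1 ⊎ colSign j ≡ ℤ.- + 1
  colSign-±1 j = weight-±1 (code j)

  signedRow : Fin order → ℤ
  signedRow i = ∑ (λ j → H i j ℤ.* colSign j)

  ∑signedRow² : ∑ (λ i → signedRow i ℤ.* signedRow i) ≡ + order ℤ.* + order
  ∑signedRow² = trans
    (∑-isometry H (+ order) H-sym (proj₁ (proj₂ H-hadamard)) (proj₂ (proj₂ H-hadamard)) colSign)
    (cong (+ order ℤ.*_) (trans (∑-cong (λ j → square (colSign-±1 j))) (trans (∑-const order (+ 1)) (ℤₚ.*-identityʳ (+ order)))))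
    where
    square : ∀ {a} → a ≡ + 1 ⊎ a ≡ ℤ.- + 1 → a ℤ.* a ≡ + 1
    square (inj₁ refl) = refl
    square (inj₂ refl) = refl

  private
    χ̃ : Point → ℤ
    χ̃ p = ũ p ℤ.* ũ p ℤ.+ ℤ.- + 1 ℤ.* (ṽ p ℤ.* ṽ p)

    row² : ∀ {a b} → Unit (a , b) → ∀ A B →
      (+ 2 ℤ.* (a ℤ.* A ℤ.+ b ℤ.* (B ℤ.+ + 1))) ℤ.* (+ 2 ℤ.* (a ℤ.* A ℤ.+ b ℤ.* (B ℤ.+ + 1)))
      ℤ.+ (+ 2 ℤ.* (a ℤ.* (B ℤ.- + 1) ℤ.- b ℤ.* A)) ℤ.* (+ 2 ℤ.* (a ℤ.* (B ℤ.- + 1) ℤ.- b ℤ.* A))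
      ≡ (+ 4 ℤ.* (A ℤ.* A ℤ.+ B ℤ.* B ℤ.+ + 1)) ℤ.* + 1 ℤ.+ (ℤ.- + 8 ℤ.* B) ℤ.* (a ℤ.* a ℤ.+ ℤ.- + 1 ℤ.* (b ℤ.* b))
    row² unit-1  = ℤ-ring
    row² unit-i  = ℤ-ring
    row² unit--1 = ℤ-ring
    row² unit--i = ℤ-ring

    S : ℤ
    S = A ℤ.* A ℤ.+ B ℤ.* B

    ∑signedRow²′ : ∑ (λ i → signedRow i ℤ.* signedRow i) ≡ (+ 4 ℤ.* (S ℤ.+ + 1)) ℤ.* (+ 1 ℤ.+ + q)
    ∑signedRow²′ = begin
      ∑ (λ i → signedRow i ℤ.* signedRow i)
        ≡⟨ ∑-cong (λ i → cong (λ r → r ℤ.* r) (H-row i)) ⟩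
      ∑ (λ i → weightedRow (code i) ℤ.* weightedRow (code i))
        ≡⟨ ∑-code (λ i → weightedRow i ℤ.* weightedRow i) ⟩
      ∑ₚ (λ p → weightedRow (p , true) ℤ.* weightedRow (p , true)) ℤ.+ ∑ₚ (λ p → weightedRow (p , false) ℤ.* weightedRow (p , false))
        ≡⟨ ∑ₚ-combine (λ p → weightedRow (p , true) ℤ.* weightedRow (p , true)) (λ p → weightedRow (p , false) ℤ.* weightedRow (p , false))
             (λ p → (+ 4 ℤ.* (S ℤ.+ + 1)) ℤ.* + 1 ℤ.+ (ℤ.- + 8 ℤ.* B) ℤ.* χ̃ p) (λ p → row² (w-Unit p) A B) ⟩
      ∑ₚ (λ p → (+ 4 ℤ.* (S ℤ.+ + 1)) ℤ.* + 1 ℤ.+ (ℤ.- + 8 ℤ.* B) ℤ.* χ̃ p)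
        ≡⟨ ∑ₚ-linear (+ 4 ℤ.* (S ℤ.+ + 1)) (ℤ.- + 8 ℤ.* B) (λ _ → + 1) χ̃ ⟩
      (+ 4 ℤ.* (S ℤ.+ + 1)) ℤ.* ∑ₚ (λ _ → + 1) ℤ.+ (ℤ.- + 8 ℤ.* B) ℤ.* ∑ₚ χ̃
        ≡⟨ cong₂ (λ a b → (+ 4 ℤ.* (S ℤ.+ + 1)) ℤ.* a ℤ.+ (ℤ.- + 8 ℤ.* B) ℤ.* b)
             (cong (λ s → + 1 ℤ.+ s) (trans (∑-const q (+ 1)) (ℤₚ.*-identityʳ (+ q)))) (cong (λ s → + 1 ℤ.+ s) ∑χN≡-1) ⟩
      (+ 4 ℤ.* (S ℤ.+ + 1)) ℤ.* (+ 1 ℤ.+ + q) ℤ.+ (ℤ.- + 8 ℤ.* B) ℤ.* + 0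
        ≡⟨ cong (λ s → (+ 4 ℤ.* (S ℤ.+ + 1)) ℤ.* (+ 1 ℤ.+ + q) ℤ.+ s) (ℤₚ.*-zeroʳ (ℤ.- + 8 ℤ.* B)) ⟩
      (+ 4 ℤ.* (S ℤ.+ + 1)) ℤ.* (+ 1 ℤ.+ + q) ℤ.+ + 0
        ≡⟨ ℤₚ.+-identityʳ _ ⟩
      (+ 4 ℤ.* (S ℤ.+ + 1)) ℤ.* (+ 1 ℤ.+ + q) ∎

  A²+B²≡q : A ℤ.* A ℤ.+ B ℤ.* B ≡ + q
  A²+B²≡q = cancel-1 S (+ q) (ℤₚ.*-cancelˡ-≡ (+ 4) (S ℤ.+ + 1) (+ q ℤ.+ + 1) (ℤₚ.*-cancelʳ-≡ (+ 4 ℤ.* (S ℤ.+ + 1)) (+ 4 ℤ.* (+ q ℤ.+ + 1)) (+ suc q)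
    (trans (sym ∑signedRow²′) (trans ∑signedRow² (square (+ q))))))
    where
    square : ∀ a → (+ 2 ℤ.+ (a ℤ.+ a)) ℤ.* (+ 2 ℤ.+ (a ℤ.+ a)) ≡ (+ 4 ℤ.* (a ℤ.+ + 1)) ℤ.* (+ 1 ℤ.+ a)
    square = ℤ-ring
    cancel-1 : ∀ a b → a ℤ.+ + 1 ≡ b ℤ.+ + 1 → a ≡ b
    cancel-1 a b e = trans (sub a) (trans (cong (ℤ._- + 1) e) (sym (sub b)))
      where
      sub : ∀ a → a ≡ (a ℤ.+ + 1) ℤ.- + 1
      sub = ℤ-ring

  private
    ∣2*_∣ : ∀ x → ∣ + 2 ℤ.* x ∣ ≡ 2 ℕ.* ∣ x ∣
    ∣2* x ∣ = ℤₚ.abs-* (+ 2) x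

    abs-neg : ∀ {x y} → x ≡ ℤ.- y → ∣ x ∣ ≡ ∣ y ∣
    abs-neg {x} {y} e = trans (cong ∣_∣ e) (ℤₚ.∣-i∣≡∣i∣ y)

  RowValue : ℤ → Set
  RowValue r = ∣ r ∣ ≡ 2 ℕ.* ∣ A ∣ ⊎ ∣ r ∣ ≡ 2 ℕ.* ∣ B ℤ.+ + 1 ∣ ⊎ ∣ r ∣ ≡ 2 ℕ.* ∣ B ℤ.- + 1 ∣

  signedRow-value : ∀ i → RowValue (signedRow i)
  signedRow-value i = subst RowValue (sym (H-row i)) (value (code i))
    where
    pos : ∀ {x y} → x ≡ y → ∣ + 2 ℤ.* x ∣ ≡ 2 ℕ.* ∣ y ∣
    pos {x} e = trans ∣2* x ∣ (cong (λ z → 2 ℕ.* ∣ z ∣) e)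
    neg : ∀ {x y} → x ≡ ℤ.- y → ∣ + 2 ℤ.* x ∣ ≡ 2 ℕ.* ∣ y ∣
    neg {x} e = trans ∣2* x ∣ (cong (2 ℕ.*_) (abs-neg e))
    r₁ : ∀ a b → + 1 ℤ.* a ℤ.+ + 0 ℤ.* (b ℤ.+ + 1) ≡ a
    r₁ = ℤ-ring
    r₂ : ∀ a b → + 0 ℤ.* a ℤ.+ + 1 ℤ.* (b ℤ.+ + 1) ≡ b ℤ.+ + 1
    r₂ = ℤ-ring
    r₃ : ∀ a b → ℤ.- + 1 ℤ.* a ℤ.+ + 0 ℤ.* (b ℤ.+ + 1) ≡ ℤ.- a
    r₃ = ℤ-ring
    r₄ : ∀ a b → + 0 ℤ.* a ℤ.+ ℤ.- + 1 ℤ.* (b ℤ.+ + 1) ≡ ℤ.- (b ℤ.+ + 1)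
    r₄ = ℤ-ring
    s₁ : ∀ a b → + 1 ℤ.* (b ℤ.- + 1) ℤ.- + 0 ℤ.* a ≡ b ℤ.- + 1
    s₁ = ℤ-ring
    s₂ : ∀ a b → + 0 ℤ.* (b ℤ.- + 1) ℤ.- + 1 ℤ.* a ≡ ℤ.- a
    s₂ = ℤ-ring
    s₃ : ∀ a b → ℤ.- + 1 ℤ.* (b ℤ.- + 1) ℤ.- + 0 ℤ.* a ≡ ℤ.- (b ℤ.- + 1)
    s₃ = ℤ-ring
    s₄ : ∀ a b → + 0 ℤ.* (b ℤ.- + 1) ℤ.- ℤ.- + 1 ℤ.* a ≡ a
    s₄ = ℤ-ring
    top : ∀ {a b} → Unit (a , b) → RowValue (+ 2 ℤ.* (a ℤ.* A ℤ.+ b ℤ.* (B ℤ.+ + 1)))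
    top unit-1  = inj₁ (pos (r₁ A B))
    top unit-i  = inj₂ (inj₁ (pos (r₂ A B)))
    top unit--1 = inj₁ (neg (r₃ A B))
    top unit--i = inj₂ (inj₁ (neg (r₄ A B)))
    bottom : ∀ {a b} → Unit (a , b) → RowValue (+ 2 ℤ.* (a ℤ.* (B ℤ.- + 1) ℤ.- b ℤ.* A))
    bottom unit-1  = inj₂ (inj₂ (pos (s₁ A B)))
    bottom unit-i  = inj₁ (neg (s₂ A B))
    bottom unit--1 = inj₂ (inj₂ (neg (s₃ A B)))
    bottom unit--i = inj₁ (pos (s₄ A B))
    value : ∀ i → RowValue (weightedRow i)
    value (p , true)  = top (w-Unit p)
    value (p , false) = bottom (w-Unit p)

  row-B-1 : ∃ λ i → ∣ signedRow i ∣ ≡ 2 ℕ.* ∣ B ℤ.- + 1 ∣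
  row-B-1 = Fin.suc Fin.zero , trans (cong ∣_∣ (H-row (Fin.suc Fin.zero)))
    (trans (ℤₚ.abs-* (+ 2) (+ 1 ℤ.* (B ℤ.- + 1) ℤ.- + 0 ℤ.* A)) (cong (λ z → 2 ℕ.* ∣ z ∣) (simplify A B)))
    where
    simplify : ∀ a b → + 1 ℤ.* (b ℤ.- + 1) ℤ.- + 0 ℤ.* a ≡ b ℤ.- + 1
    simplify = ℤ-ring

  -- At x = 0 the norm N 0 = - g is a nonsquare, so ψ (N 0) = ±i.
  row-B+1 : ∃ λ i → ∣ signedRow i ∣ ≡ 2 ℕ.* ∣ B ℤ.+ + 1 ∣
  row-B+1 = i₀ , trans (cong ∣_∣ (trans (H-row i₀) (cong weightedRow code-i₀))) (value (ψ-Unit (N 0#) (N≢0 0#)) χN0≡-1)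
    where
    i₀ : Fin order
    i₀ = Fin.suc (Fin.suc (index 0# ↑ˡ q))
    code-i₀ : code i₀ ≡ (just 0# , true)
    code-i₀ = trans (cong block (Finₚ.splitAt-↑ˡ q (index 0#) q)) (cong (λ x → just x , true) (elt-index 0#))
    χN0≡-1 : χ (N 0#) ≡ ℤ.- + 1
    χN0≡-1 = trans (cong χ (solve 1 (λ g → con (+ 0) :* con (+ 0) :- g := :- g) refl g)) (trans (χ-neg g) χ-g)
    r₂ : ∀ a b → + 0 ℤ.* a ℤ.+ + 1 ℤ.* (b ℤ.+ + 1) ≡ b ℤ.+ + 1
    r₂ = ℤ-ring
    r₄ : ∀ a b → + 0 ℤ.* a ℤ.+ ℤ.- + 1 ℤ.* (b ℤ.+ + 1) ≡ ℤ.- (b ℤ.+ + 1)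
    r₄ = ℤ-ring
    value : ∀ {a b} → Unit (a , b) → a ℤ.* a ℤ.+ ℤ.- + 1 ℤ.* (b ℤ.* b) ≡ ℤ.- + 1 →
      ∣ + 2 ℤ.* (a ℤ.* A ℤ.+ b ℤ.* (B ℤ.+ + 1)) ∣ ≡ 2 ℕ.* ∣ B ℤ.+ + 1 ∣
    value unit-i  e = trans (ℤₚ.abs-* (+ 2) (+ 0 ℤ.* A ℤ.+ + 1 ℤ.* (B ℤ.+ + 1))) (cong (λ z → 2 ℕ.* ∣ z ∣) (r₂ A B))
    value unit--i e = trans (ℤₚ.abs-* (+ 2) (+ 0 ℤ.* A ℤ.+ ℤ.- + 1 ℤ.* (B ℤ.+ + 1))) (cong (2 ℕ.*_) (abs-neg (r₄ A B)))

nCk*k!*l! : ∀ k l → ((k ℕ.+ l) choose k) ℕ.* (k ! ℕ.* l !) ≡ (k ℕ.+ l) !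
nCk*k!*l! k l = begin
  ((k ℕ.+ l) choose k) ℕ.* (k ! ℕ.* l !)
    ≡⟨ cong (λ j → ((k ℕ.+ l) choose k) ℕ.* (k ! ℕ.* j !)) (ℕₚ.m+n∸m≡n k l) ⟨
  ((k ℕ.+ l) choose k) ℕ.* (k ! ℕ.* (k ℕ.+ l ∸ k) !)
    ≡⟨ cong (ℕ._* (k ! ℕ.* (k ℕ.+ l ∸ k) !)) (nCk≡n!/k![n-k]! (ℕₚ.m≤m+n k l)) ⟩
  ((k ℕ.+ l) ! / (k ! ℕ.* (k ℕ.+ l ∸ k) !)) ℕ.* (k ! ℕ.* (k ℕ.+ l ∸ k) !)
    ≡⟨ m/n*n≡m (k![n∸k]!∣n! (ℕₚ.m≤m+n k l)) ⟩
  (k ℕ.+ l) ! ∎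
  where
  instance
    _ = k ℕₚ.!* (k ℕ.+ l ∸ k) !≢0

module _ {p : ℕ} (p-prime : Prime p) where
  private
    instance
      p≢0 : NonZero p
      p≢0 = prime⇒nonZero p-prime

  prime-∤1 : ¬ p ∣ 1
  prime-∤1 p∣1 = contradiction (∣.∣1⇒≡1 p∣1) (ℕ.nonTrivial⇒≢1 {{prime⇒nonTrivial p-prime}})

  ∤-* : ∀ {m n} → ¬ p ∣ m → ¬ p ∣ n → ¬ p ∣ m ℕ.* n
  ∤-* {m} {n} p∤m p∤n p∣mn = [ p∤m , p∤n ]′ (euclidsLemma m n p-prime p∣mn)

  ∤-remainder : ∀ a r → suc r < p → ¬ p ∣ p ℕ.* a ℕ.+ suc r
  ∤-remainder a r r<p p∣ = ℕₚ.<⇒≱ r<p (∣.∣⇒≤ (∣.∣m+n∣m⇒∣n p∣ (∣.m∣m*n a)))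

  factorial-p-part : ∀ a r → r < p → ∃ λ w → (¬ p ∣ w) × (p ℕ.* a ℕ.+ r) ! ≡ p ℕ.^ a ℕ.* (a ! ℕ.* w)
  factorial-p-part zero zero r<p = 1 , prime-∤1 , cong _! (trans (ℕₚ.+-identityʳ _) (ℕₚ.*-zeroʳ p))
  factorial-p-part (suc a) zero r<p = w , p∤w , (begin
      (p ℕ.* suc a ℕ.+ 0) ! ≡⟨ cong _! index ⟩
      suc n ! ≡⟨⟩
      suc n ℕ.* n ! ≡⟨ cong₂ ℕ._*_ (sym index) e ⟩
      (p ℕ.* suc a ℕ.+ 0) ℕ.* (p ℕ.^ a ℕ.* (a ! ℕ.* w)) ≡⟨ rearrange p a (p ℕ.^ a) (a !) w ⟩
      p ℕ.* p ℕ.^ a ℕ.* (suc a ℕ.* a ! ℕ.* w) ∎)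
    where
    n : ℕ
    n = p ℕ.* a ℕ.+ pred p
    previous : ∃ λ w → (¬ p ∣ w) × n ! ≡ p ℕ.^ a ℕ.* (a ! ℕ.* w)
    previous = factorial-p-part a (pred p) (ℕₚ.≤-reflexive (ℕₚ.suc-pred p))
    w : ℕ
    w = proj₁ previous
    p∤w : ¬ p ∣ w
    p∤w = proj₁ (proj₂ previous)
    e : n ! ≡ p ℕ.^ a ℕ.* (a ! ℕ.* w)
    e = proj₂ (proj₂ previous)
    index : p ℕ.* suc a ℕ.+ 0 ≡ suc n
    index = trans (shift p a) (trans (cong (p ℕ.* a ℕ.+_) (sym (ℕₚ.suc-pred p))) (ℕₚ.+-suc (p ℕ.* a) (pred p)))
      where
      shift : ∀ p a → p ℕ.* suc a ℕ.+ 0 ≡ p ℕ.* a ℕ.+ p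
      shift = ℕ-ring
    rearrange : ∀ p a x y w → (p ℕ.* suc a ℕ.+ 0) ℕ.* (x ℕ.* (y ℕ.* w)) ≡ p ℕ.* x ℕ.* (suc a ℕ.* y ℕ.* w)
    rearrange = ℕ-ring
  factorial-p-part a (suc r) r<p with factorial-p-part a r (ℕₚ.<-trans (ℕₚ.n<1+n r) r<p)
  ... | w , p∤w , e = (p ℕ.* a ℕ.+ suc r) ℕ.* w , ∤-* (∤-remainder a r r<p) p∤w , (begin
      (p ℕ.* a ℕ.+ suc r) ! ≡⟨ cong _! (ℕₚ.+-suc (p ℕ.* a) r) ⟩
      suc (p ℕ.* a ℕ.+ r) ℕ.* (p ℕ.* a ℕ.+ r) ! ≡⟨ cong₂ ℕ._*_ (sym (ℕₚ.+-suc (p ℕ.* a) r)) e ⟩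
      (p ℕ.* a ℕ.+ suc r) ℕ.* (p ℕ.^ a ℕ.* (a ! ℕ.* w)) ≡⟨ rearrange (p ℕ.* a ℕ.+ suc r) (p ℕ.^ a) (a !) w ⟩
      p ℕ.^ a ℕ.* (a ! ℕ.* ((p ℕ.* a ℕ.+ suc r) ℕ.* w)) ∎)
    where
    rearrange : ∀ n x y w → n ℕ.* (x ℕ.* (y ℕ.* w)) ≡ x ℕ.* (y ℕ.* (n ℕ.* w))
    rearrange = ℕ-ring

  -- One digit of Lucas' theorem, up to units.
  binomial-digit : ∀ b c r s → r ℕ.+ s < p → ¬ p ∣ ((b ℕ.+ c) choose b) →
    ¬ p ∣ (((p ℕ.* b ℕ.+ r) ℕ.+ (p ℕ.* c ℕ.+ s)) choose (p ℕ.* b ℕ.+ r))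
  binomial-digit b c r s r+s<p p∤C p∣C′ = ∤-* p∤C p∤w₃ (subst (p ∣_) (sym product) (∣.∣m⇒∣m*n (w₁ ℕ.* w₂) p∣C′))
    where
    part₁ = factorial-p-part b r (ℕₚ.≤-<-trans (ℕₚ.m≤m+n r s) r+s<p)
    part₂ = factorial-p-part c s (ℕₚ.≤-<-trans (ℕₚ.m≤n+m s r) r+s<p)
    part₃ = factorial-p-part (b ℕ.+ c) (r ℕ.+ s) r+s<p
    w₁ w₂ w₃ C₀ C₁ U : ℕ
    w₁ = proj₁ part₁
    w₂ = proj₁ part₂
    w₃ = proj₁ part₃
    p∤w₃ : ¬ p ∣ w₃
    p∤w₃ = proj₁ (proj₂ part₃)
    C₀ = (b ℕ.+ c) choose b
    C₁ = ((p ℕ.* b ℕ.+ r) ℕ.+ (p ℕ.* c ℕ.+ s)) choose (p ℕ.* b ℕ.+ r)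
    U = p ℕ.^ b ℕ.* p ℕ.^ c ℕ.* (b ! ℕ.* c !)
    instance
      U≢0 : NonZero U
      U≢0 = ℕₚ.m*n≢0 (p ℕ.^ b ℕ.* p ℕ.^ c) (b ! ℕ.* c !)
        {{ℕₚ.m*n≢0 (p ℕ.^ b) (p ℕ.^ c) {{ℕₚ.m^n≢0 p b}} {{ℕₚ.m^n≢0 p c}}}} {{b ℕₚ.!* c !≢0}}
    product : C₀ ℕ.* w₃ ≡ C₁ ℕ.* (w₁ ℕ.* w₂)
    product = ℕₚ.*-cancelˡ-≡ (C₀ ℕ.* w₃) (C₁ ℕ.* (w₁ ℕ.* w₂)) U (begin
      U ℕ.* (C₀ ℕ.* w₃)
        ≡⟨ rearrange₁ (p ℕ.^ b) (p ℕ.^ c) (b !) (c !) C₀ w₃ ⟩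
      (p ℕ.^ b ℕ.* p ℕ.^ c) ℕ.* (C₀ ℕ.* (b ! ℕ.* c !) ℕ.* w₃)
        ≡⟨ cong₂ (λ x y → x ℕ.* (y ℕ.* w₃)) (sym (ℕₚ.^-distribˡ-+-* p b c)) (nCk*k!*l! b c) ⟩
      p ℕ.^ (b ℕ.+ c) ℕ.* ((b ℕ.+ c) ! ℕ.* w₃)
        ≡⟨ proj₂ (proj₂ part₃) ⟨
      (p ℕ.* (b ℕ.+ c) ℕ.+ (r ℕ.+ s)) !
        ≡⟨ cong _! (regroup p b c r s) ⟩
      ((p ℕ.* b ℕ.+ r) ℕ.+ (p ℕ.* c ℕ.+ s)) !
        ≡⟨ nCk*k!*l! (p ℕ.* b ℕ.+ r) (p ℕ.* c ℕ.+ s) ⟨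
      C₁ ℕ.* ((p ℕ.* b ℕ.+ r) ! ℕ.* (p ℕ.* c ℕ.+ s) !)
        ≡⟨ cong₂ (λ x y → C₁ ℕ.* (x ℕ.* y)) (proj₂ (proj₂ part₁)) (proj₂ (proj₂ part₂)) ⟩
      C₁ ℕ.* ((p ℕ.^ b ℕ.* (b ! ℕ.* w₁)) ℕ.* (p ℕ.^ c ℕ.* (c ! ℕ.* w₂)))
        ≡⟨ rearrange₂ (p ℕ.^ b) (p ℕ.^ c) (b !) (c !) C₁ w₁ w₂ ⟩
      U ℕ.* (C₁ ℕ.* (w₁ ℕ.* w₂)) ∎)
      where
      rearrange₁ : ∀ x y b c n w → (x ℕ.* y ℕ.* (b ℕ.* c)) ℕ.* (n ℕ.* w) ≡ (x ℕ.* y) ℕ.* (n ℕ.* (b ℕ.* c) ℕ.* w)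
      rearrange₁ = ℕ-ring
      rearrange₂ : ∀ x y b c n v w → n ℕ.* ((x ℕ.* (b ℕ.* v)) ℕ.* (y ℕ.* (c ℕ.* w))) ≡ (x ℕ.* y ℕ.* (b ℕ.* c)) ℕ.* (n ℕ.* (v ℕ.* w))
      rearrange₂ = ℕ-ring
      regroup : ∀ p b c r s → p ℕ.* (b ℕ.+ c) ℕ.+ (r ℕ.+ s) ≡ (p ℕ.* b ℕ.+ r) ℕ.+ (p ℕ.* c ℕ.+ s)
      regroup = ℕ-ring

  -- The base p digits of t, 2t and 3t are constantly s, 2s and 3s, so no carry occurs.
  binomial-3t-2t : ∀ s → p ≡ 1+4× s → ∀ e t → p ℕ.^ e ≡ 1+4× t →
    ¬ p ∣ (((t ℕ.+ t) ℕ.+ t) choose (t ℕ.+ t))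
  binomial-3t-2t s p≡ e t q≡ = subst (λ t → ¬ p ∣ (((t ℕ.+ t) ℕ.+ t) choose (t ℕ.+ t)))
    (quadruple-injective {digits e} {t} (ℕₚ.suc-injective (trans (digits-sum e) q≡))) (digits-binomial e)
    where
    quadruple-injective : ∀ {a b} → (a ℕ.+ a) ℕ.+ (a ℕ.+ a) ≡ (b ℕ.+ b) ℕ.+ (b ℕ.+ b) → a ≡ b
    quadruple-injective {a} {b} eq = ℕₚ.*-cancelˡ-≡ a b 4 (trans (four a) (trans eq (sym (four b))))
      where
      four : ∀ a → 4 ℕ.* a ≡ (a ℕ.+ a) ℕ.+ (a ℕ.+ a)
      four = ℕ-ring
    digits : ℕ → ℕ
    digits zero    = 0
    digits (suc e) = p ℕ.* digits e ℕ.+ s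
    digits-sum : ∀ e → suc ((digits e ℕ.+ digits e) ℕ.+ (digits e ℕ.+ digits e)) ≡ p ℕ.^ e
    digits-sum zero    = refl
    digits-sum (suc e) = begin
      suc ((d′ ℕ.+ d′) ℕ.+ (d′ ℕ.+ d′)) ≡⟨ expand p (digits e) s ⟩
      p ℕ.* ((d ℕ.+ d) ℕ.+ (d ℕ.+ d)) ℕ.+ suc ((s ℕ.+ s) ℕ.+ (s ℕ.+ s)) ≡⟨ cong (p ℕ.* ((d ℕ.+ d) ℕ.+ (d ℕ.+ d)) ℕ.+_) p≡ ⟨
      p ℕ.* ((d ℕ.+ d) ℕ.+ (d ℕ.+ d)) ℕ.+ p ≡⟨ collect p ((d ℕ.+ d) ℕ.+ (d ℕ.+ d)) ⟩
      p ℕ.* suc ((d ℕ.+ d) ℕ.+ (d ℕ.+ d)) ≡⟨ cong (p ℕ.*_) (digits-sum e) ⟩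
      p ℕ.* p ℕ.^ e ∎
      where
      d d′ : ℕ
      d = digits e
      d′ = digits (suc e)
      expand : ∀ p d s → suc (((p ℕ.* d ℕ.+ s) ℕ.+ (p ℕ.* d ℕ.+ s)) ℕ.+ ((p ℕ.* d ℕ.+ s) ℕ.+ (p ℕ.* d ℕ.+ s)))
        ≡ p ℕ.* ((d ℕ.+ d) ℕ.+ (d ℕ.+ d)) ℕ.+ suc ((s ℕ.+ s) ℕ.+ (s ℕ.+ s))
      expand = ℕ-ring
      collect : ∀ p n → p ℕ.* n ℕ.+ p ≡ p ℕ.* suc n
      collect = ℕ-ring
    3s<p : (s ℕ.+ s) ℕ.+ s < p
    3s<p = subst ((s ℕ.+ s) ℕ.+ s <_) (sym p≡) (s≤s (ℕₚ.+-monoʳ-≤ (s ℕ.+ s) (ℕₚ.m≤m+n s s)))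
    digits-binomial : ∀ e → ¬ p ∣ (((digits e ℕ.+ digits e) ℕ.+ digits e) choose (digits e ℕ.+ digits e))
    digits-binomial zero    = prime-∤1
    digits-binomial (suc e) = subst (λ m → ¬ p ∣ ((m ℕ.+ (p ℕ.* d ℕ.+ s)) choose m)) (double p d s)
      (binomial-digit (d ℕ.+ d) d (s ℕ.+ s) s 3s<p (digits-binomial e))
      where
      d : ℕ
      d = digits e
      double : ∀ p d s → p ℕ.* (d ℕ.+ d) ℕ.+ (s ℕ.+ s) ≡ (p ℕ.* d ℕ.+ s) ℕ.+ (p ℕ.* d ℕ.+ s)
      double = ℕ-ring

module Characteristic {q : ℕ} (F : FiniteField q) {p e : ℕ} (p-prime : Prime p) (q≡p^e : q ≡ p ℕ.^ e) where
  open Field F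
  open Solver using (solve; _:=_; _:+_; _:*_; _:-_; :-_; con)
  open Algebra.Properties.Semiring.Sum semiring using (sum; ∑-distrib-+; sum-replicate)
  open FiniteSum.Over +-commutativeMonoid F
  open Algebra.Properties.Monoid.Mult.TCOptimised (CommutativeRing.+-monoid ring) using (×ᵤ≈×)

  total-1≡0 : total (λ _ → 1#) ≡ 0#
  total-1≡0 = begin
    total (λ _ → 1#) ≡⟨ solve 2 (λ a b → b := a :+ b :- a) refl (total (λ x → x)) (total (λ _ → 1#)) ⟩
    total (λ x → x) + total (λ _ → 1#) - total (λ x → x)
      ≡⟨ cong (_- total (λ x → x)) (∑-distrib-+ elt (λ _ → 1#)) ⟨
    total (λ x → x + 1#) - total (λ x → x)
      ≡⟨ cong (_- total (λ x → x)) (total-bijection (λ x → x) (_+ 1#) (_- 1#)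
           (λ x → solve 1 (λ x → x :- con (+ 1) :+ con (+ 1) := x) refl x) (λ x → solve 1 (λ x → x :+ con (+ 1) :- con (+ 1) := x) refl x)) ⟨
    total (λ x → x) - total (λ x → x) ≡⟨ -‿inverseʳ _ ⟩
    0# ∎

  ⟦q⟧≡0 : ⟦ + q ⟧ ≡ 0#
  ⟦q⟧≡0 = trans (sym (×ᵤ≈× q 1#)) (trans (sym (sum-replicate q)) total-1≡0)

  ⟦^⟧ : ∀ n k → ⟦ + (n ℕ.^ k) ⟧ ≡ ⟦ + n ⟧ ^ k
  ⟦^⟧ n zero    = refl
  ⟦^⟧ n (suc k) = trans (cong ⟦_⟧ (ℤₚ.pos-* n (n ℕ.^ k))) (trans (⟦⟧-* (+ n) (+ (n ℕ.^ k))) (cong (⟦ + n ⟧ *_) (⟦^⟧ n k)))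

  ⟦p⟧≡0 : ⟦ + p ⟧ ≡ 0#
  ⟦p⟧≡0 = lemma (⟦ + p ⟧ ≟ 0#)
    where
    lemma : Dec (⟦ + p ⟧ ≡ 0#) → ⟦ + p ⟧ ≡ 0#
    lemma (yes e≡) = e≡
    lemma (no ne)  = contradiction (trans (sym (⟦^⟧ p e)) (trans (cong (⟦_⟧ ∘ +_) (sym q≡p^e)) ⟦q⟧≡0)) (^-≢0 e ne)

  p∣n⇒⟦n⟧≡0 : ∀ {n} → p ∣ n → ⟦ + n ⟧ ≡ 0#
  p∣n⇒⟦n⟧≡0 (divides k refl) = trans (cong ⟦_⟧ (ℤₚ.pos-* k p)) (trans (⟦⟧-* (+ k) (+ p)) (trans (cong (⟦ + k ⟧ *_) ⟦p⟧≡0) (zeroʳ _)))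

  p∣∣i∣⇒⟦i⟧≡0 : ∀ i → p ∣ ∣ i ∣ → ⟦ i ⟧ ≡ 0#
  p∣∣i∣⇒⟦i⟧≡0 (+ n) p∣n = p∣n⇒⟦n⟧≡0 p∣n
  p∣∣i∣⇒⟦i⟧≡0 -[1+ n ] p∣n = trans (cong -_ (p∣n⇒⟦n⟧≡0 p∣n)) (solve 0 (:- con (+ 0) := con (+ 0)) refl)

  p∤n⇒⟦n⟧≢0 : ∀ {n} → ¬ p ∣ n → ⟦ + n ⟧ ≢ 0#
  p∤n⇒⟦n⟧≢0 {n} p∤n ⟦n⟧≡0 = bezout (coprime-Bézout coprime)
    where
    coprime : Coprime p n
    coprime {d} (d∣p , d∣n) with prime⇒irreducible p-prime d∣p
    ... | inj₁ d≡1 = d≡1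
    ... | inj₂ refl = contradiction d∣n p∤n
    multiple : ∀ k m → ⟦ + m ⟧ ≡ 0# → ⟦ + (k ℕ.* m) ⟧ ≡ 0#
    multiple k m z = trans (cong ⟦_⟧ (ℤₚ.pos-* k m)) (trans (⟦⟧-* (+ k) (+ m)) (trans (cong (⟦ + k ⟧ *_) z) (zeroʳ _)))
    absurd : ∀ a b → ⟦ + a ⟧ ≡ 0# → ⟦ + b ⟧ ≡ 0# → 1 ℕ.+ a ≢ b
    absurd a b a≡0 b≡0 eq = 0≢1 (trans (sym (trans (cong (⟦_⟧ ∘ +_) eq) b≡0))
      (trans (⟦⟧-+ (+ 1) (+ a)) (trans (cong (λ w → 1# + w) a≡0) (+-identityʳ 1#))))
    bezout : Bézout.Identity 1 p n → _
    bezout (Bézout.+- x y eq) = absurd (y ℕ.* n) (x ℕ.* p) (multiple y n ⟦n⟧≡0) (multiple x p ⟦p⟧≡0) eq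
    bezout (Bézout.-+ x y eq) = absurd (x ℕ.* p) (y ℕ.* n) (multiple x p ⟦p⟧≡0) (multiple y n ⟦n⟧≡0) eq

module Primitivity {q : ℕ} (F : FiniteField q) (t : ℕ) (0<t : 0 < t)
  (q≡1+4t : q ≡ 1+4× t)
  {p e : ℕ} (p-prime : Prime p) (q≡p^e : q ≡ p ℕ.^ e)
  (s : ℕ) (p≡1+4s : p ≡ 1+4× s) where
  open Field F
  open Characteristic F {p} {e} p-prime q≡p^e
  open QuarticCharacter F t 0<t q≡1+4t
  open CharacterSums F t 0<t q≡1+4t
  open Solver using (solve; _:=_; _:+_; _:*_; _:-_; :-_; con)
  open Algebra.Properties.Semiring.Sum semiring using (sum; ∑-distrib-+; *-distribˡ-sum; sum-cong-≗) renaming (∑-comm to sum-comm)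
  open FiniteSum +-commutativeMonoid using (sum-single)
  open FiniteSum.Over +-commutativeMonoid F
  open Algebra.Properties.Semiring.Mult semiring using (×-assoc-*) renaming (_×_ to _·_)
  open Algebra.Properties.Monoid.Mult.TCOptimised (CommutativeRing.+-monoid ring) using (×ᵤ≈×)
  module Binomial = Algebra.Properties.CommutativeSemiring.Binomial commutativeSemiring

  powerSum : ℕ → K
  powerSum j = total (_^ j)

  powerSum≡0 : ∀ j → (∃ λ a → a ≢ 0# × a ^ j ≢ 1#) → powerSum j ≡ 0#
  powerSum≡0 j (a , a≢0 , a^j≢1) = [ (λ e → contradiction (x-y≡0 (a ^ j) 1# e) a^j≢1) , (λ e → e) ]′
    (x*y≡0 (a ^ j - 1#) (powerSum j) (begin
      (a ^ j - 1#) * powerSum j ≡⟨ solve 2 (λ x y → (x :- con (+ 1)) :* y := x :* y :- y) refl (a ^ j) (powerSum j) ⟩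
      a ^ j * powerSum j - powerSum j ≡⟨ cong (_- powerSum j) (*-distribˡ-sum (a ^ j) (λ i → elt i ^ j)) ⟩
      total (λ x → a ^ j * x ^ j) - powerSum j ≡⟨ cong (_- powerSum j) (sum-cong-≗ (λ i → ^-distrib-* a (elt i) j)) ⟨
      total (λ x → (a * x) ^ j) - powerSum j ≡⟨ cong (_- powerSum j) (total-bijection (_^ j) (a *_) (inv a *_) left right) ⟨
      powerSum j - powerSum j ≡⟨ -‿inverseʳ _ ⟩
      0# ∎))
    where
    left : ∀ x → a * (inv a * x) ≡ x
    left x = trans (sym (*-assoc a (inv a) x)) (trans (cong (_* x) (*-inv a≢0)) (*-identityˡ x))
    right : ∀ x → inv a * (a * x) ≡ x
    right x = trans (solve 3 (λ a i x → i :* (a :* x) := a :* (i :* x)) refl a (inv a) x) (left x)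

  private
    4t : ℕ
    4t = (t ℕ.+ t) ℕ.+ (t ℕ.+ t)

    small : ∀ j → 0 < j → j < 4t → powerSum j ≡ 0#
    small j 0<j j<4t = powerSum≡0 j (∃-^≢1 j 0<j (subst (suc j <_) (sym q≡1+4t) (s≤s j<4t)))

    0^≡0 : ∀ j → 0 < j → 0# ^ j ≡ 0#
    0^≡0 (suc j) _ = zeroˡ (0# ^ j)

    reduce : ∀ j → 0 < j → powerSum (4t ℕ.+ j) ≡ powerSum j
    reduce j 0<j = sum-cong-≗ (λ i → pointwise (elt i) (elt i ≟ 0#))
      where
      pointwise : ∀ x → Dec (x ≡ 0#) → x ^ (4t ℕ.+ j) ≡ x ^ j
      pointwise x (yes refl) = trans (0^≡0 (4t ℕ.+ j) (ℕₚ.<-≤-trans 0<j (ℕₚ.m≤n+m j 4t))) (sym (0^≡0 j 0<j))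
      pointwise x (no x≢0) = trans (^-homo-* x 4t j) (trans (cong (_* x ^ j) (x^4t≡1 x x≢0)) (*-identityˡ (x ^ j)))

    powerSum-4t : powerSum 4t ≡ - 1#
    powerSum-4t = begin
      powerSum 4t ≡⟨ solve 1 (λ x → x := (x :+ con (+ 1)) :- con (+ 1)) refl (powerSum 4t) ⟩
      powerSum 4t + 1# - 1# ≡⟨ cong (λ w → powerSum 4t + w - 1#) (trans (total-single atZero 0# atZero-≢0) atZero-0) ⟨
      powerSum 4t + total atZero - 1# ≡⟨ cong (_- 1#) (∑-distrib-+ (λ i → elt i ^ 4t) (atZero ∘ elt)) ⟨
      total (λ x → x ^ 4t + atZero x) - 1# ≡⟨ cong (_- 1#) (sum-cong-≗ (λ i → pointwise (elt i) (elt i ≟ 0#))) ⟩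
      total (λ _ → 1#) - 1# ≡⟨ cong (_- 1#) total-1≡0 ⟩
      0# - 1# ≡⟨ +-identityˡ (- 1#) ⟩
      - 1# ∎
      where
      atZero : K → K
      atZero x with x ≟ 0#
      ... | yes _ = 1#
      ... | no _  = 0#
      atZero-0 : atZero 0# ≡ 1#
      atZero-0 with 0# ≟ 0#
      ... | yes _   = refl
      ... | no 0≢0 = contradiction refl 0≢0
      atZero-≢0 : ∀ x → x ≢ 0# → atZero x ≡ 0#
      atZero-≢0 x x≢0 with x ≟ 0#
      ... | yes x≡0 = contradiction x≡0 x≢0
      ... | no _    = refl
      0<4t : 0 < 4t
      0<4t = ℕₚ.<-≤-trans 0<t (ℕₚ.≤-trans (ℕₚ.m≤m+n t t) (ℕₚ.m≤m+n (t ℕ.+ t) (t ℕ.+ t)))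
      pointwise : ∀ x → Dec (x ≡ 0#) → x ^ 4t + atZero x ≡ 1#
      pointwise x (yes refl) = trans (cong₂ _+_ (0^≡0 4t 0<4t) atZero-0) (+-identityˡ 1#)
      pointwise x (no x≢0) = trans (cong₂ _+_ (x^4t≡1 x x≢0) (atZero-≢0 x x≢0)) (+-identityʳ 1#)

    n : ℕ
    n = (t ℕ.+ t) ℕ.+ t

    evenPowerSum≡0 : ∀ k → k ≤ n → k ≢ t ℕ.+ t → powerSum (k ℕ.+ k) ≡ 0#
    evenPowerSum≡0 zero    k≤n k≢2t = total-1≡0
    evenPowerSum≡0 k@(suc _) k≤n k≢2t with ℕₚ.<-cmp k (t ℕ.+ t)
    ... | tri< k<2t _ _ = small (k ℕ.+ k) (s≤s z≤n) (ℕₚ.+-mono-< k<2t k<2t)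
    ... | tri≈ _ k≡2t _ = contradiction k≡2t k≢2t
    ... | tri> _ _ k>2t = trans (cong powerSum k+k≡) (trans (reduce (i ℕ.+ i) 0<2i) (small (i ℕ.+ i) 0<2i 2i<4t))
      where
      i : ℕ
      i = k ∸ (t ℕ.+ t)
      2t+i≡k : (t ℕ.+ t) ℕ.+ i ≡ k
      2t+i≡k = ℕₚ.m+[n∸m]≡n (ℕₚ.<⇒≤ k>2t)
      k+k≡ : k ℕ.+ k ≡ 4t ℕ.+ (i ℕ.+ i)
      k+k≡ = trans (cong₂ ℕ._+_ (sym 2t+i≡k) (sym 2t+i≡k)) (regroup (t ℕ.+ t) i)
        where
        regroup : ∀ a b → (a ℕ.+ b) ℕ.+ (a ℕ.+ b) ≡ (a ℕ.+ a) ℕ.+ (b ℕ.+ b)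
        regroup = ℕ-ring
      0<i : 0 < i
      0<i = ℕₚ.m<n⇒0<n∸m k>2t
      0<2i : 0 < i ℕ.+ i
      0<2i = ℕₚ.<-≤-trans 0<i (ℕₚ.m≤m+n i i)
      i≤t : i ≤ t
      i≤t = ℕₚ.+-cancelˡ-≤ (t ℕ.+ t) i t (ℕₚ.≤-trans (ℕₚ.≤-reflexive 2t+i≡k) k≤n)
      2i<4t : i ℕ.+ i < 4t
      2i<4t = ℕₚ.≤-<-trans (ℕₚ.+-mono-≤ i≤t i≤t)
        (ℕₚ.m<m+n (t ℕ.+ t) (ℕₚ.<-≤-trans 0<t (ℕₚ.m≤m+n t t)))

    coefficient : Fin (suc n) → K
    coefficient k = ((n choose toℕ k) · 1#) * (- g) ^ (n ∸ toℕ k)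

    middle : Fin (suc n)
    middle = Fin.fromℕ< {t ℕ.+ t} (s≤s (ℕₚ.m≤m+n (t ℕ.+ t) t))

    toℕ-middle : toℕ middle ≡ t ℕ.+ t
    toℕ-middle = Finₚ.toℕ-fromℕ< _

  ∑N^3t : total (λ y → N y ^ n) ≡ coefficient middle * - 1#
  ∑N^3t = begin
    total (λ y → N y ^ n)
      ≡⟨ sum-cong-≗ (λ i → trans (Binomial.theorem n (elt i * elt i) (- g)) (sum-cong-≗ (λ k → term (elt i) k))) ⟩
    total (λ y → sum (λ k → coefficient k * y ^ (toℕ k ℕ.+ toℕ k)))
      ≡⟨ sum-comm (λ i k → coefficient k * elt i ^ (toℕ k ℕ.+ toℕ k)) ⟩
    sum (λ k → total (λ y → coefficient k * y ^ (toℕ k ℕ.+ toℕ k)))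
      ≡⟨ sum-cong-≗ (λ k → *-distribˡ-sum (coefficient k) (λ i → elt i ^ (toℕ k ℕ.+ toℕ k))) ⟨
    sum (λ k → coefficient k * powerSum (toℕ k ℕ.+ toℕ k))
      ≡⟨ sum-single (λ k → coefficient k * powerSum (toℕ k ℕ.+ toℕ k)) middle
           (λ k k≢ → trans (cong (coefficient k *_) (evenPowerSum≡0 (toℕ k) (ℕ.s≤s⁻¹ (Finₚ.toℕ<n k))
              (λ e → k≢ (Finₚ.toℕ-injective (trans e (sym toℕ-middle)))))) (zeroʳ _)) ⟩
    coefficient middle * powerSum (toℕ middle ℕ.+ toℕ middle)
      ≡⟨ cong (λ j → coefficient middle * powerSum (j ℕ.+ j)) toℕ-middle ⟩
    coefficient middle * powerSum 4t
      ≡⟨ cong (coefficient middle *_) powerSum-4t ⟩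
    coefficient middle * - 1# ∎
    where
    term : ∀ y k → (n choose toℕ k) · ((y * y) ^ toℕ k * (- g) ^ (n ∸ toℕ k)) ≡ coefficient k * y ^ (toℕ k ℕ.+ toℕ k)
    term y k = begin
      c · ((y * y) ^ toℕ k * G) ≡⟨ cong (c ·_) (*-identityˡ _) ⟨
      c · (1# * ((y * y) ^ toℕ k * G)) ≡⟨ ×-assoc-* c 1# _ ⟨
      (c · 1#) * ((y * y) ^ toℕ k * G) ≡⟨ cong (λ w → (c · 1#) * (w * G)) (trans (^-distrib-* y y (toℕ k)) (sym (^-homo-* y (toℕ k) (toℕ k)))) ⟩
      (c · 1#) * (y ^ (toℕ k ℕ.+ toℕ k) * G) ≡⟨ solve 3 (λ c y g → c :* (y :* g) := c :* g :* y) refl (c · 1#) (y ^ (toℕ k ℕ.+ toℕ k)) G ⟩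
      (c · 1#) * G * y ^ (toℕ k ℕ.+ toℕ k) ∎
      where
      c : ℕ
      c = n choose toℕ k
      G : K
      G = (- g) ^ (n ∸ toℕ k)

  private
    -x≢0 : ∀ {x} → x ≢ 0# → - x ≢ 0#
    -x≢0 {x} x≢0 e = x≢0 (trans (solve 1 (λ x → x := :- (:- x)) refl x) (trans (cong -_ e) (solve 0 (:- con (+ 0) := con (+ 0)) refl)))

    ∑N^3t≢0 : total (λ y → N y ^ n) ≢ 0#
    ∑N^3t≢0 sum≡0 = *-≢0 (*-≢0 binomial≢0 (^-≢0 (n ∸ toℕ middle) (-x≢0 g≢0))) (-x≢0 (0≢1 ∘ sym)) (trans (sym ∑N^3t) sum≡0)
      where
      binomial≢0 : (n choose toℕ middle) · 1# ≢ 0#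
      binomial≢0 z = p∤n⇒⟦n⟧≢0 (binomial-3t-2t p-prime s p≡1+4s e t (trans (sym q≡p^e) q≡1+4t))
        (trans (sym (×ᵤ≈× (n choose (t ℕ.+ t)) 1#)) (trans (cong (λ k → (n choose k) · 1#) (sym toℕ-middle)) z))

    Φ̄-∑ : ∀ {m} (f h : Fin m → ℤ) → Φ̄ (∑ f , ∑ h) ≡ sum (λ i → Φ̄ (f i , h i))
    Φ̄-∑ {zero} f h = solve 1 (λ i → con (+ 0) :- con (+ 0) :* i := con (+ 0)) refl ι
    Φ̄-∑ {suc m} f h = begin
      ⟦ f₀ ℤ.+ ∑ (f ∘ Fin.suc) ⟧ - ⟦ h₀ ℤ.+ ∑ (h ∘ Fin.suc) ⟧ * ι
        ≡⟨ cong₂ (λ a b → a - b * ι) (⟦⟧-+ f₀ (∑ (f ∘ Fin.suc))) (⟦⟧-+ h₀ (∑ (h ∘ Fin.suc))) ⟩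
      (⟦ f₀ ⟧ + ⟦ ∑ (f ∘ Fin.suc) ⟧) - (⟦ h₀ ⟧ + ⟦ ∑ (h ∘ Fin.suc) ⟧) * ι
        ≡⟨ solve 5 (λ a b c d i → (a :+ b) :- (c :+ d) :* i := (a :- c :* i) :+ (b :- d :* i)) refl ⟦ f₀ ⟧ ⟦ ∑ (f ∘ Fin.suc) ⟧ ⟦ h₀ ⟧ ⟦ ∑ (h ∘ Fin.suc) ⟧ ι ⟩
      Φ̄ (f₀ , h₀) + Φ̄ (∑ (f ∘ Fin.suc) , ∑ (h ∘ Fin.suc))
        ≡⟨ cong (λ w → Φ̄ (f₀ , h₀) + w) (Φ̄-∑ (f ∘ Fin.suc) (h ∘ Fin.suc)) ⟩
      Φ̄ (f₀ , h₀) + sum (λ i → Φ̄ (f (Fin.suc i) , h (Fin.suc i))) ∎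
      where
      f₀ h₀ : ℤ
      f₀ = f Fin.zero
      h₀ = h Fin.zero

  p∤AB : ¬ ((p ∣ ∣ A ∣) × (p ∣ ∣ B ∣))
  p∤AB (p∣A , p∣B) = ∑N^3t≢0 (begin
    total (λ y → N y ^ n) ≡⟨ sum-cong-≗ (λ i → pointwise (N (elt i)) (N≢0 (elt i))) ⟨
    total (λ y → Φ̄ (ψ (N y))) ≡⟨ Φ̄-∑ (u ∘ elt) (v ∘ elt) ⟨
    ⟦ A ⟧ - ⟦ B ⟧ * ι ≡⟨ cong₂ (λ a b → a - b * ι) (p∣∣i∣⇒⟦i⟧≡0 A p∣A) (p∣∣i∣⇒⟦i⟧≡0 B p∣B) ⟩
    0# - 0# * ι ≡⟨ solve 1 (λ i → con (+ 0) :- con (+ 0) :* i := con (+ 0)) refl ι ⟩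
    0# ∎)
    where
    pointwise : ∀ x → x ≢ 0# → Φ̄ (ψ x) ≡ x ^ n
    pointwise x x≢0 = trans (Φ̄-ψ x x≢0) (trans (*-comm _ _)
      (trans (cong (_* x ^ t) (sym (^-homo-* x t t))) (sym (^-homo-* x (t ℕ.+ t) t))))

module IntegerLemmas where
  open import Data.Integer using (_+_; _*_; -_; _-_)

  i*j≡0 : ∀ i j → i * j ≡ + 0 → i ≡ + 0 ⊎ j ≡ + 0
  i*j≡0 i j = ℤₚ.i*j≡0⇒i≡0∨j≡0 i

  i-j≡0 : ∀ i j → i - j ≡ + 0 → i ≡ j
  i-j≡0 = ℤₚ.i-j≡0⇒i≡j

  i²≡j² : ∀ i j → i * i ≡ j * j → i ≡ j ⊎ i ≡ - j
  i²≡j² i j e = Sum.map (i-j≡0 i j) (λ z → i-j≡0 i (- j) (trans (double-neg i j) z))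
    (i*j≡0 (i - j) (i + j) (trans (factor i j) (trans (cong (_- (j * j)) e) (ℤₚ.+-inverseʳ (j * j)))))
    where
    factor : ∀ i j → (i - j) * (i + j) ≡ i * i - j * j
    factor = ℤ-ring
    double-neg : ∀ i j → i - - j ≡ i + j
    double-neg = ℤ-ring

  i²≡j²⇒∣i∣≡∣j∣ : ∀ i j → i * i ≡ j * j → ∣ i ∣ ≡ ∣ j ∣
  i²≡j²⇒∣i∣≡∣j∣ i j e = [ cong ∣_∣ , (λ z → trans (cong ∣_∣ z) (ℤₚ.∣-i∣≡∣i∣ j)) ]′ (i²≡j² i j e)

  module TwoSquares {p : ℕ} (p-prime : Prime p) (p∤2 : ¬ p ∣ 2) where

    p∣ij : ∀ i j → + p ∣ℤ i * j → + p ∣ℤ i ⊎ + p ∣ℤ j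
    p∣ij i j p∣ = Sum.map ℤ∣.∣ᵤ⇒∣ ℤ∣.∣ᵤ⇒∣ (euclidsLemma ∣ i ∣ ∣ j ∣ p-prime (subst (p ∣_) (ℤₚ.abs-* i j) (ℤ∣.∣⇒∣ᵤ p∣)))

    p∣2i : ∀ i → + p ∣ℤ + 2 * i → + p ∣ℤ i
    p∣2i i p∣ = [ (λ p∣2 → contradiction (ℤ∣.∣⇒∣ᵤ p∣2) p∤2) , (λ p∣i → p∣i) ]′ (p∣ij (+ 2) i p∣)

    p^e∣mn : ∀ e m n → ¬ p ∣ m → p ℕ.^ e ∣ m ℕ.* n → p ℕ.^ e ∣ n
    p^e∣mn zero    m n p∤m _ = ∣.1∣ n
    p^e∣mn (suc e) m n p∤m p^∣ with euclidsLemma m n p-prime (∣.∣-trans (∣.m∣m*n (p ℕ.^ e)) p^∣)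
    ... | inj₁ p∣m = contradiction p∣m p∤m
    ... | inj₂ (divides n′ refl) = subst (p ℕ.* p ℕ.^ e ∣_) (ℕₚ.*-comm p n′)
      (∣.*-monoʳ-∣ p (p^e∣mn e m n′ p∤m (∣.*-cancelˡ-∣ p (subst (p ℕ.* p ℕ.^ e ∣_) rearrange p^∣))))
      where
      instance
        _ = prime⇒nonZero p-prime
      rearrange : m ℕ.* (n′ ℕ.* p) ≡ p ℕ.* (m ℕ.* n′)
      rearrange = trans (sym (ℕₚ.*-assoc m n′ p)) (ℕₚ.*-comm (m ℕ.* n′) p)

    module _ (e : ℕ) where
      q : ℕ
      q = p ℕ.^ suc e

      private
        instance
          _ = prime⇒nonZero p-prime
          _ = ℕₚ.m^n≢0 p (suc e)

        p∣q : + p ∣ℤ + q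
        p∣q = ℤ∣.∣ᵤ⇒∣ (∣.m∣m*n (p ℕ.^ e))

      record Primitive (a b : ℤ) : Set where
        field
          norm      : a * a + b * b ≡ + q
          coprime : ¬ (+ p ∣ℤ a × + p ∣ℤ b)

        p∤a : ¬ + p ∣ℤ a
        p∤a p∣a = coprime (p∣a , [ (λ x → x) , (λ x → x) ]′ (p∣ij b b (subst (+ p ∣ℤ_) (sub a b) (ℤ∣.∣m∣n⇒∣m-n (subst (+ p ∣ℤ_) (sym norm) p∣q) (ℤ∣.∣m⇒∣m*n a p∣a)))))
          where
          sub : ∀ a b → a * a + b * b - a * a ≡ b * b
          sub = ℤ-ring

      swap : ∀ {a b} → Primitive a b → Primitive b a
      swap {a} {b} P = record { norm = trans (ℤₚ.+-comm (b * b) (a * a)) (Primitive.norm P)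
                      ; coprime = λ x → Primitive.coprime P (proj₂ x , proj₁ x) }

      private
        q≢0 : + q ≢ + 0
        q≢0 z = ℕ.≢-nonZero⁻¹ q (ℤₚ.+-injective z)

        difference : ∀ a c x y → x * y ≡ + q * (a * a - c * c) → x ≡ + 0 → a * a ≡ c * c
        difference a c x y xy≡ x≡0 = [ (λ z → contradiction z q≢0) , i-j≡0 (a * a) (c * c) ]′
          (i*j≡0 (+ q) (a * a - c * c) (trans (sym xy≡) (trans (cong (_* y) x≡0) (ℤₚ.*-zeroˡ y))))

        cross-product : ∀ {a b c d} → Primitive a b → Primitive c d →
          (a * d - b * c) * (a * d + b * c) ≡ + q * (a * a - c * c)
        cross-product {a} {b} {c} {d} P P′ = trans (expand a b c d)
          (trans (cong₂ (λ s s′ → a * a * s′ - s * (c * c)) (Primitive.norm P) (Primitive.norm P′)) (collect (+ q) (a * a) (c * c)))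
          where
          expand : ∀ a b c d → (a * d - b * c) * (a * d + b * c)
            ≡ a * a * (c * c + d * d) - (a * a + b * b) * (c * c)
          expand = ℤ-ring
          collect : ∀ q x y → x * q - q * y ≡ q * (x - y)
          collect = ℤ-ring

        other-square : ∀ {a b c d} → Primitive a b → Primitive c d → a * a ≡ c * c → b * b ≡ d * d
        other-square {a} {b} {c} {d} P P′ e = +-cancelˡ (a * a) (b * b) (d * d)
          (trans (Primitive.norm P) (trans (sym (Primitive.norm P′)) (cong (_+ d * d) (sym e))))

        SameSquares : ℤ → ℤ → ℤ → ℤ → Set
        SameSquares a b c d = (a * a ≡ c * c × b * b ≡ d * d) ⊎ (a * a ≡ d * d × b * b ≡ c * c)

        -- (ad - bc)² + (ac + bd)² = q², so ad - bc = 0 or ac + bd = 0.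
        divisible : ∀ {a b c d} → Primitive a b → Primitive c d → q ∣ ∣ a * d - b * c ∣ → SameSquares a b c d
        divisible {a} {b} {c} {d} P P′ (divides k X≡kq) = cases k X≡kq
          where
          X Y Z W : ℤ
          X = a * d - b * c
          Y = a * d + b * c
          Z = a * c + b * d
          W = a * c - b * d
          XY : X * Y ≡ + q * (a * a - c * c)
          XY = cross-product P P′
          ZW : Z * W ≡ + q * (a * a - d * d)
          ZW = trans (ℤₚ.*-comm Z W) (cross-product P (swap P′))
          ∣i∣² : ∀ i → i * i ≡ + (∣ i ∣ ℕ.* ∣ i ∣)
          ∣i∣² (+ n)    = sym (ℤₚ.pos-* n n)
          ∣i∣² -[1+ n ] = refl
          squares : ∣ X ∣ ℕ.* ∣ X ∣ ℕ.+ ∣ Z ∣ ℕ.* ∣ Z ∣ ≡ q ℕ.* q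
          squares = ℤₚ.+-injective (begin
            + (∣ X ∣ ℕ.* ∣ X ∣) + + (∣ Z ∣ ℕ.* ∣ Z ∣) ≡⟨ cong₂ _+_ (∣i∣² X) (∣i∣² Z) ⟨
            X * X + Z * Z ≡⟨ brahmagupta a b c d ⟩
            (a * a + b * b) * (c * c + d * d) ≡⟨ cong₂ _*_ (Primitive.norm P) (Primitive.norm P′) ⟩
            + q * + q ≡⟨ ℤₚ.pos-* q q ⟨
            + (q ℕ.* q) ∎)
            where
            brahmagupta : ∀ a b c d → (a * d - b * c) * (a * d - b * c) + (a * c + b * d) * (a * c + b * d)
              ≡ (a * a + b * b) * (c * c + d * d)
            brahmagupta = ℤ-ring
          cases : ∀ k → ∣ X ∣ ≡ k ℕ.* q → SameSquares a b c d
          cases zero X≡0 = inj₁ (a² , other-square P P′ a²)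
            where
            a² : a * a ≡ c * c
            a² = difference a c X Y XY (ℤₚ.∣i∣≡0⇒i≡0 X≡0)
          cases (suc k) X≡ = inj₂ (a² , other-square P (swap P′) a²)
            where
            q≤X : q ≤ ∣ X ∣
            q≤X = ℕₚ.≤-trans (ℕₚ.m≤m+n q (k ℕ.* q)) (ℕₚ.≤-reflexive (sym X≡))
            Z²≡0 : ∣ Z ∣ ℕ.* ∣ Z ∣ ≡ 0
            Z²≡0 = ℕₚ.n≤0⇒n≡0 (ℕₚ.+-cancelˡ-≤ (q ℕ.* q) _ _ (ℕₚ.≤-trans (ℕₚ.+-monoˡ-≤ (∣ Z ∣ ℕ.* ∣ Z ∣) (ℕₚ.*-mono-≤ q≤X q≤X))
              (ℕₚ.≤-trans (ℕₚ.≤-reflexive squares) (ℕₚ.≤-reflexive (sym (ℕₚ.+-identityʳ (q ℕ.* q)))))))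
            Z≡0 : Z ≡ + 0
            Z≡0 = ℤₚ.∣i∣≡0⇒i≡0 ([ (λ x → x) , (λ x → x) ]′ (ℕₚ.m*n≡0⇒m≡0∨n≡0 ∣ Z ∣ Z²≡0))
            a² : a * a ≡ d * d
            a² = difference a d Z W ZW Z≡0

      sameSquares : ∀ {a b c d} → Primitive a b → Primitive c d →
        (a * a ≡ c * c × b * b ≡ d * d) ⊎ (a * a ≡ d * d × b * b ≡ c * c)
      sameSquares {a} {b} {c} {d} P P′ = decide (p ∣.∣? ∣ X ∣)
        where
        X Y : ℤ
        X = a * d - b * c
        Y = a * d + b * c
        q∣XY : q ∣ ∣ X ∣ ℕ.* ∣ Y ∣
        q∣XY = divides ∣ a * a - c * c ∣ (trans (sym (ℤₚ.abs-* X Y)) (trans (cong ∣_∣ (cross-product P P′)) (trans (ℤₚ.abs-* (+ q) (a * a - c * c)) (ℕₚ.*-comm q _))))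
        not-both : ¬ ((p ∣ ∣ X ∣) × (p ∣ ∣ Y ∣))
        not-both (p∣X , p∣Y) = [ Primitive.p∤a P , Primitive.p∤a (swap P′) ]′
          (p∣ij a d (p∣2i (a * d) (subst (+ p ∣ℤ_) (add a b c d) (ℤ∣.∣m∣n⇒∣m+n (ℤ∣.∣ᵤ⇒∣ {+ p} {X} p∣X) (ℤ∣.∣ᵤ⇒∣ {+ p} {Y} p∣Y)))))
          where
          add : ∀ a b c d → (a * d - b * c) + (a * d + b * c) ≡ + 2 * (a * d)
          add = ℤ-ring
        Negate : Primitive (- c) d
        Negate = record { norm = trans (neg² c d) (Primitive.norm P′)
                        ; coprime = λ x → Primitive.coprime P′ (subst (+ p ∣ℤ_) (ℤₚ.neg-involutive c) (ℤ∣.∣m⇒∣-m (proj₁ x)) , proj₂ x) }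
          where
          neg² : ∀ c d → - c * - c + d * d ≡ c * c + d * d
          neg² = ℤ-ring
        decide : Dec (p ∣ (∣ X ∣)) → (a * a ≡ c * c × b * b ≡ d * d) ⊎ (a * a ≡ d * d × b * b ≡ c * c)
        decide (yes p∣X) = divisible P P′ (p^e∣mn (suc e) ∣ Y ∣ ∣ X ∣ (λ p∣Y → not-both (p∣X , p∣Y)) (subst (q ∣_) (ℕₚ.*-comm ∣ X ∣ ∣ Y ∣) q∣XY))
        decide (no p∤X) = Sum.map (λ x → trans (proj₁ x) (neg² c) , proj₂ x) (λ x → proj₁ x , trans (proj₂ x) (neg² c))
          (divisible P Negate (subst (λ i → q ∣ ∣ i ∣) (Y≡ a b c d) (p^e∣mn (suc e) ∣ X ∣ ∣ Y ∣ p∤X q∣XY)))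
          where
          neg² : ∀ c → - c * - c ≡ c * c
          neg² = ℤ-ring
          Y≡ : ∀ a b c d → a * d + b * c ≡ a * d - b * - c
          Y≡ = ℤ-ring

  ℕ-parity : ∀ n → ∃ λ h → n ≡ h ℕ.+ h ⊎ n ≡ suc (h ℕ.+ h)
  ℕ-parity zero = 0 , inj₁ refl
  ℕ-parity (suc n) with ℕ-parity n
  ... | h , inj₁ refl = h , inj₂ refl
  ... | h , inj₂ refl = suc h , inj₁ (cong suc (sym (ℕₚ.+-suc h h)))

  ℤ-parity : ∀ i → ∃ λ h → i ≡ + 2 * h ⊎ i ≡ + 2 * h + + 1
  ℤ-parity (+ n) with ℕ-parity n
  ... | h , inj₁ refl = + h , inj₁ (double (+ h))
    where
    double : ∀ h → h + h ≡ + 2 * h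
    double = ℤ-ring
  ... | h , inj₂ refl = + h , inj₂ (double (+ h))
    where
    double : ∀ h → + 1 + (h + h) ≡ + 2 * h + + 1
    double = ℤ-ring
  ℤ-parity -[1+ n ] with ℕ-parity (suc n)
  ... | h , inj₁ e = - + h , inj₁ (trans (cong (λ k → - (+ k)) e) (double (+ h)))
    where
    double : ∀ h → - (h + h) ≡ + 2 * (- h)
    double = ℤ-ring
  ... | h , inj₂ e = - + h - + 1 , inj₂ (trans (cong (λ k → - (+ k)) e) (double (+ h)))
    where
    double : ∀ h → - (+ 1 + (h + h)) ≡ + 2 * (- h - + 1) + + 1
    double = ℤ-ring

  unit≢even : ∀ s x → s * s ≡ + 1 → s ≢ + 2 * x
  unit≢even s x s²≡1 s≡2x = 2*≢1 (x * s) (trans (sym (ℤₚ.*-assoc (+ 2) x s)) (trans (cong (_* s) (sym s≡2x)) s²≡1))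
    where
    2*n≢1 : ∀ n → 2 ℕ.* n ≢ 1
    2*n≢1 zero    ()
    2*n≢1 (suc n) e = ℕₚ.1+n≢0 (ℕₚ.suc-injective (trans (shift n) e))
      where
      shift : ∀ n → suc (suc (2 ℕ.* n)) ≡ 2 ℕ.* suc n
      shift = ℕ-ring
    2*≢1 : ∀ y → + 2 * y ≢ + 1
    2*≢1 y e = 2*n≢1 ∣ y ∣ (trans (sym (ℤₚ.abs-* (+ 2) y)) (cong ∣_∣ e))

  i*j≡1⇒i²≡1 : ∀ i j → i * j ≡ + 1 → i * i ≡ + 1
  i*j≡1⇒i²≡1 i j e = square i (ℕₚ.m*n≡1⇒m≡1 ∣ i ∣ ∣ j ∣ (trans (sym (ℤₚ.abs-* i j)) (cong ∣_∣ e)))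
    where
    square : ∀ i → ∣ i ∣ ≡ 1 → i * i ≡ + 1
    square (+ 1)    refl = refl
    square -[1+ 0 ] refl = refl

open IntegerLemmas

module TwoAdic {C : Set} {add mul : C → C → C} {neg : C → C} {zero# one# : C}
  (isCommutativeRing : IsCommutativeRing _≡_ add mul neg zero# one#) where

  ring : CommutativeRing 0ℓ 0ℓ
  ring = record { isCommutativeRing = isCommutativeRing }

  open CommutativeRing ring using (_+_; _*_; 0#; 1#; *-identityʳ; *-comm)
  open IntegerImage ring using (⟦_⟧; ⟦⟧-+; ⟦⟧-*; module Solver)
  open Solver using (solve; _:=_; _:+_; _:*_; con)
  open Algebra.Properties.Semiring.Exp (CommutativeRing.semiring ring) using (_^_; ^-homo-*; ^-assocʳ)

  1+4_ : C → C
  1+4 θ = 1# + ⟦ + 4 ⟧ * θ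

  form : C → C → C → C → C
  form θ N j κ = 1# + ⟦ + 4 ⟧ * (N * (θ * ((1# + ⟦ + 2 ⟧ * j) + ⟦ + 2 ⟧ * (θ * κ))))

  -- (1 + 4θ)ᵏ - 1 is 4Nθ times an odd number, N being the 2-part of k.
  Shape : C → C → Set
  Shape θ x = ∃ λ N → ∃ λ j → ∃ λ κ → N ≢ + 0 × x ≡ form θ ⟦ N ⟧ ⟦ j ⟧ κ

  shape-1 : ∀ θ → Shape θ (1+4 θ)
  shape-1 θ = + 1 , + 0 , 0# , (λ ()) , solve 1 (λ θ → con (+ 1) :+ con (+ 4) :* θ :=
    con (+ 1) :+ con (+ 4) :* (con (+ 1) :* (θ :* ((con (+ 1) :+ con (+ 2) :* con (+ 0)) :+ con (+ 2) :* (θ :* con (+ 0)))))) refl θ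

  shape-square : ∀ θ x → Shape θ x → Shape θ (x * x)
  shape-square θ x (N , j , κ , N≢0 , x≡) = + 2 ℤ.* N , j , κ + ⟦ N ⟧ * (β * β) ,
    (λ e → [ (λ ()) , N≢0 ]′ (i*j≡0 (+ 2) N e)) ,
    trans (cong₂ _*_ x≡ x≡) (trans
      (solve 4 (λ θ N j κ →
        let β = (con (+ 1) :+ con (+ 2) :* j) :+ con (+ 2) :* (θ :* κ)
            y = con (+ 1) :+ con (+ 4) :* (N :* (θ :* β)) in
        y :* y := con (+ 1) :+ con (+ 4) :* ((con (+ 2) :* N) :* (θ :* ((con (+ 1) :+ con (+ 2) :* j) :+ con (+ 2) :* (θ :* (κ :+ N :* (β :* β)))))))
        refl θ ⟦ N ⟧ ⟦ j ⟧ κ)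
      (cong (λ M → form θ M ⟦ j ⟧ (κ + ⟦ N ⟧ * (β * β))) (sym (⟦⟧-* (+ 2) N))))
    where
    β : C
    β = (1# + ⟦ + 2 ⟧ * ⟦ j ⟧) + ⟦ + 2 ⟧ * (θ * κ)

  shape-odd : ∀ θ x → Shape θ x → Shape θ ((1+4 θ) * (x * x))
  shape-odd θ x (N , j , κ , N≢0 , x≡) = + 1 , N ℤ.* (+ 1 ℤ.+ + 2 ℤ.* j) , κ′ , (λ ()) ,
    trans (cong (λ y → (1+4 θ) * (y * y)) x≡) (trans
      (solve 4 (λ θ N j κ →
        let o = con (+ 1) :+ con (+ 2) :* j
            β = o :+ con (+ 2) :* (θ :* κ)
            κ₂ = κ :+ N :* (β :* β)
            y = con (+ 1) :+ con (+ 4) :* (N :* (θ :* β)) in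
        (con (+ 1) :+ con (+ 4) :* θ) :* (y :* y)
        := con (+ 1) :+ con (+ 4) :* (con (+ 1) :* (θ :* ((con (+ 1) :+ con (+ 2) :* (N :* o))
             :+ con (+ 2) :* (θ :* (con (+ 2) :* (N :* κ₂) :+ con (+ 4) :* (N :* (o :+ con (+ 2) :* (θ :* κ₂)))))))))
        refl θ ⟦ N ⟧ ⟦ j ⟧ κ)
      (cong (λ m → form θ 1# m κ′) (sym embed)))
    where
    o β κ₂ κ′ : C
    o = 1# + ⟦ + 2 ⟧ * ⟦ j ⟧
    β = o + ⟦ + 2 ⟧ * (θ * κ)
    κ₂ = κ + ⟦ N ⟧ * (β * β)
    κ′ = ⟦ + 2 ⟧ * (⟦ N ⟧ * κ₂) + ⟦ + 4 ⟧ * (⟦ N ⟧ * (o + ⟦ + 2 ⟧ * (θ * κ₂)))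
    embed : ⟦ N ℤ.* (+ 1 ℤ.+ + 2 ℤ.* j) ⟧ ≡ ⟦ N ⟧ * o
    embed = trans (⟦⟧-* N (+ 1 ℤ.+ + 2 ℤ.* j)) (cong (⟦ N ⟧ *_) (trans (⟦⟧-+ (+ 1) (+ 2 ℤ.* j)) (cong (λ w → 1# + w) (⟦⟧-* (+ 2) j))))

  shape-power : ∀ θ k → 0 < k → Shape θ ((1+4 θ) ^ k)
  shape-power θ = <-rec (λ k → 0 < k → Shape θ ((1+4 θ) ^ k)) step
    where
    step : ∀ k → (∀ {h} → h < k → 0 < h → Shape θ ((1+4 θ) ^ h)) → 0 < k → Shape θ ((1+4 θ) ^ k)
    step k rec 0<k with ℕ-parity k
    ... | zero  , inj₁ refl = contradiction 0<k λ ()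
    ... | zero  , inj₂ refl = subst (Shape θ) (sym (*-identityʳ (1+4 θ))) (shape-1 θ)
    ... | h@(suc h′) , inj₁ refl = subst (Shape θ) (sym (^-homo-* (1+4 θ) h h))
      (shape-square θ ((1+4 θ) ^ h) (rec (ℕₚ.m<m+n h (s≤s z≤n)) (s≤s z≤n)))
    ... | h@(suc h′) , inj₂ refl = subst (Shape θ) (sym (cong ((1+4 θ) *_) (^-homo-* (1+4 θ) h h)))
      (shape-odd θ ((1+4 θ) ^ h) (rec (s≤s (ℕₚ.m≤m+n h h)) (s≤s z≤n)))

  module Functional (S : C → ℤ) (S-+ : ∀ x y → S (x + y) ≡ S x ℤ.+ S y) (S-⟦⟧ : ∀ n x → S (⟦ n ⟧ * x) ≡ n ℤ.* S x) where

    case-1 : ∀ ζ z ω P s → ζ ≡ 1+4 (⟦ P ⟧ * ω) → S z ≡ s → S (z * ω) ≡ P ℤ.* (ℤ.- + 5 ℤ.* s) → s ℤ.* s ≡ + 1 → P ≢ + 0 →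
      ∀ k → 0 < k → let T = S (ζ ^ k * z) in T ℤ.* T ≢ + 1
    case-1 ζ z ω P s refl Sz S[zω] s²≡1 P≢0 k 0<k T²≡1 = [ T≢s , T≢-s ]′ (i²≡j² T s (trans T²≡1 (sym s²≡1)))
      where
      T : ℤ
      T = S (ζ ^ k * z)
      shape : Shape (⟦ P ⟧ * ω) (ζ ^ k)
      shape = shape-power (⟦ P ⟧ * ω) k 0<k
      N j E Q X : ℤ
      κ y₁ y₂ y₃ : C
      N = proj₁ shape
      j = proj₁ (proj₂ shape)
      κ = proj₁ (proj₂ (proj₂ shape))
      N≢0 : N ≢ + 0
      N≢0 = proj₁ (proj₂ (proj₂ (proj₂ shape)))
      y₁ = z * (ω * (ω * κ))
      E = S y₁
      Q = (+ 1 ℤ.+ + 2 ℤ.* j) ℤ.* (ℤ.- + 5 ℤ.* s) ℤ.+ + 2 ℤ.* E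
      X = N ℤ.* (P ℤ.* (P ℤ.* Q))
      y₂ = z * ω + ⟦ + 2 ⟧ * (⟦ j ⟧ * (z * ω))
      y₃ = y₂ + ⟦ + 2 ⟧ * (⟦ P ⟧ * y₁)
      S-y₂ : S y₂ ≡ P ℤ.* (ℤ.- + 5 ℤ.* s) ℤ.+ + 2 ℤ.* (j ℤ.* (P ℤ.* (ℤ.- + 5 ℤ.* s)))
      S-y₂ = trans (S-+ (z * ω) (⟦ + 2 ⟧ * (⟦ j ⟧ * (z * ω)))) (cong₂ ℤ._+_ S[zω]
        (trans (S-⟦⟧ (+ 2) (⟦ j ⟧ * (z * ω))) (cong (+ 2 ℤ.*_) (trans (S-⟦⟧ j (z * ω)) (cong (j ℤ.*_) S[zω])))))
      S-y₃ : S y₃ ≡ P ℤ.* Q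
      S-y₃ = trans (S-+ y₂ (⟦ + 2 ⟧ * (⟦ P ⟧ * y₁))) (trans (cong₂ ℤ._+_ S-y₂
        (trans (S-⟦⟧ (+ 2) (⟦ P ⟧ * y₁)) (cong (+ 2 ℤ.*_) (S-⟦⟧ P y₁)))) (collect s P j E))
        where
        collect : ∀ s P j E → (P ℤ.* (ℤ.- + 5 ℤ.* s) ℤ.+ + 2 ℤ.* (j ℤ.* (P ℤ.* (ℤ.- + 5 ℤ.* s)))) ℤ.+ + 2 ℤ.* (P ℤ.* E)
          ≡ P ℤ.* ((+ 1 ℤ.+ + 2 ℤ.* j) ℤ.* (ℤ.- + 5 ℤ.* s) ℤ.+ + 2 ℤ.* E)
        collect = ℤ-ring
      T≡ : T ≡ s ℤ.+ + 4 ℤ.* X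
      T≡ = begin
        S (ζ ^ k * z)
          ≡⟨ cong (λ x → S (x * z)) (proj₂ (proj₂ (proj₂ (proj₂ shape)))) ⟩
        S (form (⟦ P ⟧ * ω) ⟦ N ⟧ ⟦ j ⟧ κ * z)
          ≡⟨ cong S (solve 6 (λ P ω N j κ z → let θ = P :* ω in
               (con (+ 1) :+ con (+ 4) :* (N :* (θ :* ((con (+ 1) :+ con (+ 2) :* j) :+ con (+ 2) :* (θ :* κ))))) :* z
               := z :+ con (+ 4) :* (N :* (P :* ((z :* ω :+ con (+ 2) :* (j :* (z :* ω))) :+ con (+ 2) :* (P :* (z :* (ω :* (ω :* κ))))))))
               refl ⟦ P ⟧ ω ⟦ N ⟧ ⟦ j ⟧ κ z) ⟩
        S (z + ⟦ + 4 ⟧ * (⟦ N ⟧ * (⟦ P ⟧ * y₃)))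
          ≡⟨ trans (S-+ z (⟦ + 4 ⟧ * (⟦ N ⟧ * (⟦ P ⟧ * y₃)))) (cong₂ ℤ._+_ Sz (trans (S-⟦⟧ (+ 4) (⟦ N ⟧ * (⟦ P ⟧ * y₃)))
               (cong (+ 4 ℤ.*_) (trans (S-⟦⟧ N (⟦ P ⟧ * y₃)) (cong (N ℤ.*_) (trans (S-⟦⟧ P y₃) (cong (P ℤ.*_) S-y₃))))))) ⟩
        s ℤ.+ + 4 ℤ.* X ∎
      Q≢0 : Q ≢ + 0
      Q≢0 Q≡0 = unit≢even s (E ℤ.- + 2 ℤ.* s ℤ.- + 5 ℤ.* (s ℤ.* j)) s²≡1 (begin
        s ≡⟨ ℤₚ.+-identityʳ s ⟨
        s ℤ.+ + 0 ≡⟨ cong (λ x → s ℤ.+ x) Q≡0 ⟨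
        s ℤ.+ Q ≡⟨ odd s j E ⟩
        + 2 ℤ.* (E ℤ.- + 2 ℤ.* s ℤ.- + 5 ℤ.* (s ℤ.* j)) ∎)
        where
        odd : ∀ s j E → s ℤ.+ ((+ 1 ℤ.+ + 2 ℤ.* j) ℤ.* (ℤ.- + 5 ℤ.* s) ℤ.+ + 2 ℤ.* E) ≡ + 2 ℤ.* (E ℤ.- + 2 ℤ.* s ℤ.- + 5 ℤ.* (s ℤ.* j))
        odd = ℤ-ring
      nonzero : + 4 ℤ.* X ≢ + 0
      nonzero e = [ (λ ()) , (λ e₁ → [ N≢0 , (λ e₂ → [ P≢0 , (λ e₃ → [ P≢0 , Q≢0 ]′ (i*j≡0 P Q e₃)) ]′ (i*j≡0 P (P ℤ.* Q) e₂)) ]′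
        (i*j≡0 N (P ℤ.* (P ℤ.* Q)) e₁)) ]′ (i*j≡0 (+ 4) X e)
      T≢s : T ≢ s
      T≢s e = nonzero (+-cancelˡ s (+ 4 ℤ.* X) (+ 0) (trans (sym T≡) (trans e (sym (ℤₚ.+-identityʳ s)))))
      T≢-s : T ≢ ℤ.- s
      T≢-s e = unit≢even s (ℤ.- X) s²≡1 (ℤₚ.*-cancelˡ-≡ (+ 2) s (+ 2 ℤ.* (ℤ.- X)) (begin
        + 2 ℤ.* s ≡⟨ rearrange s X ⟩
        (s ℤ.+ + 4 ℤ.* X) ℤ.+ (s ℤ.- + 4 ℤ.* X) ≡⟨ cong (ℤ._+ (s ℤ.- + 4 ℤ.* X)) (trans (sym T≡) e) ⟩
        ℤ.- s ℤ.+ (s ℤ.- + 4 ℤ.* X) ≡⟨ rearrange′ s X ⟩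
        + 2 ℤ.* (+ 2 ℤ.* (ℤ.- X)) ∎))
        where
        rearrange : ∀ s X → + 2 ℤ.* s ≡ (s ℤ.+ + 4 ℤ.* X) ℤ.+ (s ℤ.- + 4 ℤ.* X)
        rearrange = ℤ-ring
        rearrange′ : ∀ s X → ℤ.- s ℤ.+ (s ℤ.- + 4 ℤ.* X) ≡ + 2 ℤ.* (+ 2 ℤ.* (ℤ.- X))
        rearrange′ = ℤ-ring

    case-3 : ∀ ζ y ω P d → ζ ≡ 1+4 (⟦ P ⟧ * ω) → S y ≡ d ℤ.* (+ 1 ℤ.+ + 6 ℤ.* P) → d ℤ.* d ≡ + 1 → P ≢ + 0 → (∃ λ h → P ≡ + 2 ℤ.* h) →
      ∀ k → let T = S (ζ ^ k * y) in T ℤ.* T ≢ + 1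
    case-3 ζ y ω P d refl Sy d²≡1 P≢0 (h , P≡2h) k T²≡1 = [ T≢d , T≢-d ]′ (i²≡j² T d (trans T²≡1 (sym d²≡1)))
      where
      T : ℤ
      T = S (ζ ^ k * y)
      power : ∀ k → ∃ λ μ → ζ ^ k ≡ 1+4 (⟦ P ⟧ * μ)
      power zero = 0# , solve 1 (λ P → con (+ 1) := con (+ 1) :+ con (+ 4) :* (P :* con (+ 0))) refl ⟦ P ⟧
      power (suc k) = let μ , e = power k in (ω + μ) + ⟦ + 4 ⟧ * (⟦ P ⟧ * (ω * μ)) , trans (cong (ζ *_) e)
        (solve 3 (λ P ω μ → (con (+ 1) :+ con (+ 4) :* (P :* ω)) :* (con (+ 1) :+ con (+ 4) :* (P :* μ))
          := con (+ 1) :+ con (+ 4) :* (P :* ((ω :+ μ) :+ con (+ 4) :* (P :* (ω :* μ))))) refl ⟦ P ⟧ ω μ)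
      μ : C
      μ = proj₁ (power k)
      E W : ℤ
      E = S (y * μ)
      W = + 3 ℤ.* d ℤ.+ + 2 ℤ.* E
      T≡ : T ≡ d ℤ.* (+ 1 ℤ.+ + 6 ℤ.* P) ℤ.+ + 4 ℤ.* (P ℤ.* E)
      T≡ = begin
        S (ζ ^ k * y) ≡⟨ cong (λ x → S (x * y)) (proj₂ (power k)) ⟩
        S ((1+4 (⟦ P ⟧ * μ)) * y)
          ≡⟨ cong S (solve 3 (λ P μ y → (con (+ 1) :+ con (+ 4) :* (P :* μ)) :* y := y :+ con (+ 4) :* (P :* (y :* μ))) refl ⟦ P ⟧ μ y) ⟩
        S (y + ⟦ + 4 ⟧ * (⟦ P ⟧ * (y * μ)))
          ≡⟨ trans (S-+ y (⟦ + 4 ⟧ * (⟦ P ⟧ * (y * μ)))) (cong₂ ℤ._+_ Sy (trans (S-⟦⟧ (+ 4) (⟦ P ⟧ * (y * μ))) (cong (+ 4 ℤ.*_) (S-⟦⟧ P (y * μ))))) ⟩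
        d ℤ.* (+ 1 ℤ.+ + 6 ℤ.* P) ℤ.+ + 4 ℤ.* (P ℤ.* E) ∎
      T≢d : T ≢ d
      T≢d e = [ (λ ()) , (λ e₁ → [ P≢0 , W≢0 ]′ (i*j≡0 P W e₁)) ]′
        (i*j≡0 (+ 2) (P ℤ.* W) (trans (expand d P E) (trans (cong (ℤ._- d) (trans (sym T≡) e)) (ℤₚ.+-inverseʳ d))))
        where
        expand : ∀ d P E → + 2 ℤ.* (P ℤ.* (+ 3 ℤ.* d ℤ.+ + 2 ℤ.* E)) ≡ d ℤ.* (+ 1 ℤ.+ + 6 ℤ.* P) ℤ.+ + 4 ℤ.* (P ℤ.* E) ℤ.- d
        expand = ℤ-ring
        odd : ∀ d E → d ≡ (+ 3 ℤ.* d ℤ.+ + 2 ℤ.* E) ℤ.+ + 2 ℤ.* (ℤ.- E ℤ.- d)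
        odd = ℤ-ring
        W≢0 : W ≢ + 0
        W≢0 W≡0 = unit≢even d (ℤ.- E ℤ.- d) d²≡1 (trans (odd d E) (trans (cong (ℤ._+ (+ 2 ℤ.* (ℤ.- E ℤ.- d))) W≡0) (ℤₚ.+-identityˡ (+ 2 ℤ.* (ℤ.- E ℤ.- d)))))
      T≢-d : T ≢ ℤ.- d
      T≢-d e = unit≢even d (ℤ.- (h ℤ.* W)) d²≡1 (trans d≡ (trans (cong (λ x → ℤ.- (x ℤ.* W)) P≡2h) (pull h W)))
        where
        pull : ∀ h x → ℤ.- (+ 2 ℤ.* h ℤ.* x) ≡ + 2 ℤ.* (ℤ.- (h ℤ.* x))
        pull = ℤ-ring
        rearrange : ∀ d P E → + 2 ℤ.* d ≡ (d ℤ.* (+ 1 ℤ.+ + 6 ℤ.* P) ℤ.+ + 4 ℤ.* (P ℤ.* E)) ℤ.+ (d ℤ.- + 2 ℤ.* (P ℤ.* (+ 3 ℤ.* d ℤ.+ + 2 ℤ.* E)))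
        rearrange = ℤ-ring
        rearrange′ : ∀ d PW → ℤ.- d ℤ.+ (d ℤ.- + 2 ℤ.* PW) ≡ + 2 ℤ.* (ℤ.- PW)
        rearrange′ = ℤ-ring
        d≡ : d ≡ ℤ.- (P ℤ.* W)
        d≡ = ℤₚ.*-cancelˡ-≡ (+ 2) d (ℤ.- (P ℤ.* W))
          (trans (rearrange d P E) (trans (cong (ℤ._+ (d ℤ.- + 2 ℤ.* (P ℤ.* W))) (trans (sym T≡) e)) (rearrange′ d (P ℤ.* W))))

    odd-power : ∀ z → (∀ k → 0 < k → let T = S (((z * z) * (z * z)) ^ k * z) in T ℤ.* T ≢ + 1) →
      (∀ k → let T = S (((z * z) * (z * z)) ^ k * (z * (z * z))) in T ℤ.* T ≢ + 1) →
      ∀ h → 0 < h → let T = S (z ^ suc (h ℕ.+ h)) in T ℤ.* T ≢ + 1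
    odd-power z ne₁ ne₃ h 0<h T²≡1 = cases (ℕ-parity h)
      where
      z⁴ : ∀ k → z ^ ((k ℕ.+ k) ℕ.+ (k ℕ.+ k)) ≡ ((z * z) * (z * z)) ^ k
      z⁴ k = trans (cong (z ^_) (four k)) (trans (sym (^-assocʳ z 4 k))
        (cong (_^ k) (solve 1 (λ z → z :* (z :* (z :* (z :* con (+ 1)))) := (z :* z) :* (z :* z)) refl z)))
        where
        four : ∀ k → (k ℕ.+ k) ℕ.+ (k ℕ.+ k) ≡ 4 ℕ.* k
        four = ℕ-ring
      transport : ∀ {x y} → x ≡ y → S x ℤ.* S x ≡ + 1 → S y ℤ.* S y ≡ + 1
      transport refl e = e
      cases : (∃ λ k → h ≡ k ℕ.+ k ⊎ h ≡ suc (k ℕ.+ k)) → ⊥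
      cases (zero , inj₁ refl) = contradiction 0<h λ ()
      cases (k@(suc _) , inj₁ refl) = ne₁ k (s≤s z≤n) (transport (trans (cong (z *_) (z⁴ k)) (*-comm z _)) T²≡1)
      cases (k , inj₂ refl) = ne₃ k (transport (trans (cong (z ^_) (exponent k)) (trans (cong (λ y → z * (z * (z * y))) (z⁴ k))
        (solve 2 (λ z y → z :* (z :* (z :* y)) := y :* (z :* (z :* z))) refl z (((z * z) * (z * z)) ^ k)))) T²≡1)
        where
        exponent : ∀ k → suc (suc (k ℕ.+ k) ℕ.+ suc (k ℕ.+ k)) ≡ 3 ℕ.+ ((k ℕ.+ k) ℕ.+ (k ℕ.+ k))
        exponent = ℕ-ring

module GaussianPowers where
  open import Data.Integer using (_+_; _*_; -_; _-_)

  private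
    module 𝔾 = CommutativeRing ℤ[i]-ring
  open Gauss using (_⊗_; _⊕_; isCommutativeRing′)
  open Algebra.Properties.Semiring.Exp 𝔾.semiring using (_^_; ^-assocʳ)
  open IntegerImage ℤ[i]-ring using (⟦_⟧)

  ⟨_⟩ : ℤ → ℤ[i]
  ⟨ n ⟩ = n , + 0

  ⟦⟧≡⟨⟩ : ∀ n → ⟦ n ⟧ ≡ ⟨ n ⟩
  ⟦⟧≡⟨⟩ = λ { (+ n) → nonneg n ; -[1+ n ] → cong 𝔾.-_ (nonneg (suc n)) }
    where
    open Algebra.Properties.Semiring.Mult.TCOptimised 𝔾.semiring using (1+×)
    nonneg : ∀ n → ⟦ + n ⟧ ≡ ⟨ + n ⟩
    nonneg zero    = refl
    nonneg (suc n) = trans (1+× n (+ 1 , + 0)) (cong ((+ 1 , + 0) ⊕_) (nonneg n))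

  S : ℤ[i] → ℤ
  S (a , b) = a + b

  S-⊕ : ∀ x y → S (x ⊕ y) ≡ S x + S y
  S-⊕ (a , b) (c , d) = swap a b c d
    where
    swap : ∀ a b c d → (a + c) + (b + d) ≡ (a + b) + (c + d)
    swap = ℤ-ring

  S-⟨⟩ : ∀ n x → S (⟨ n ⟩ ⊗ x) ≡ n * S x
  S-⟨⟩ n (a , b) = pull n a b
    where
    pull : ∀ n a b → (n * a + - + 1 * (+ 0 * b)) + (n * b + + 0 * a) ≡ n * (a + b)
    pull = ℤ-ring

  S-⟦⟧ : ∀ n x → S (⟦ n ⟧ ⊗ x) ≡ n * S x
  S-⟦⟧ n x = trans (cong (λ w → S (w ⊗ x)) (⟦⟧≡⟨⟩ n)) (S-⟨⟩ n x)

  open TwoAdic isCommutativeRing′ using (module Functional)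
  open Functional S S-⊕ S-⟦⟧ using (case-1; case-3; odd-power)

  fourth : ℤ[i] → ℤ[i]
  fourth z = (z ⊗ z) ⊗ (z ⊗ z)

  module _ (A B : ℤ) where
    private
      z : ℤ[i]
      z = A , B
      P s d : ℤ
      P = A * B
      s = A + B
      d = A - B

      re₄ im₄ : ℤ
      re₄ = proj₁ (fourth z)
      im₄ = proj₂ (fourth z)

      re₄-factor : ∀ A B → (A * A + - + 1 * (B * B)) * (A * A + - + 1 * (B * B)) + - + 1 * ((A * B + B * A) * (A * B + B * A))
        ≡ ((A + B) * (A + B)) * ((A - B) * (A - B)) - + 4 * ((A * B) * (A * B))
      re₄-factor = ℤ-ring

      S-fourth : ∀ w → S (fourth z ⊗ w) ≡ re₄ * S w + (+ 4 * (P * (s * d))) * (proj₁ w - proj₂ w)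
      S-fourth (a , b) = trans (mult re₄ im₄ a b) (cong (λ i → re₄ * (a + b) + i * (a - b)) (im₄-factor A B))
        where
        mult : ∀ r i a b → (r * a + - + 1 * (i * b)) + (r * b + i * a) ≡ r * (a + b) + i * (a - b)
        mult = ℤ-ring
        im₄-factor : ∀ A B → (A * A + - + 1 * (B * B)) * (A * B + B * A) + (A * B + B * A) * (A * A + - + 1 * (B * B))
          ≡ + 4 * ((A * B) * ((A + B) * (A - B)))
        im₄-factor = ℤ-ring

      divides-step : ∀ e f → s * d ≡ e * f → ∀ w → (∃ λ c → S w ≡ e * c) → ∀ k → ∃ λ c → S ((fourth z ^ k) ⊗ w) ≡ e * c
      divides-step e f sd≡ef w (c , Sw) zero = c , trans (cong S (𝔾.*-identityˡ w)) Sw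
      divides-step e f sd≡ef w (c , Sw) (suc k) with divides-step e f sd≡ef w (c , Sw) k
      ... | c′ , eq = re₄ * c′ + (+ 4 * (P * f)) * (proj₁ w′ - proj₂ w′) , (begin
        S ((fourth z ⊗ (fourth z ^ k)) ⊗ w) ≡⟨ cong S (𝔾.*-assoc (fourth z) (fourth z ^ k) w) ⟩
        S (fourth z ⊗ w′) ≡⟨ S-fourth w′ ⟩
        re₄ * S w′ + (+ 4 * (P * (s * d))) * δ ≡⟨ cong₂ (λ x y → re₄ * x + (+ 4 * (P * y)) * δ) eq sd≡ef ⟩
        re₄ * (e * c′) + (+ 4 * (P * (e * f))) * δ ≡⟨ collect re₄ e c′ P f δ ⟩
        e * (re₄ * c′ + (+ 4 * (P * f)) * δ) ∎)
        where
        w′ : ℤ[i]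
        w′ = (fourth z ^ k) ⊗ w
        δ : ℤ
        δ = proj₁ w′ - proj₂ w′
        collect : ∀ r e c p f x → r * (e * c) + (+ 4 * (p * (e * f))) * x ≡ e * (r * c + (+ 4 * (p * f)) * x)
        collect = ℤ-ring

      unit-from-multiple : ∀ e c T → T ≡ e * c → T * T ≡ + 1 → e * e ≡ + 1
      unit-from-multiple e c T T≡ T² = i*j≡1⇒i²≡1 e (c * (e * c)) (trans (sym (ℤₚ.*-assoc e c (e * c))) (trans (cong₂ _*_ (sym T≡) (sym T≡)) T²))

    exponent-1 : P ≢ + 0 → ∀ k → 0 < k → let T = S ((fourth z ^ k) ⊗ z) in T * T ≢ + 1
    exponent-1 P≢0 k 0<k T²≡1 =
      case-1 (fourth z) z ω P s (trans z⁴≡1+4Pω (cong (λ p → ⟨ + 1 ⟩ ⊕ (⟨ + 4 ⟩ ⊗ (p ⊗ ω))) (sym (⟦⟧≡⟨⟩ P)))) refl S[zω] s²≡1 P≢0 k 0<k T²≡1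
      where
      s²≡1 : s * s ≡ + 1
      s²≡1 = let c , e = divides-step s d refl z (+ 1 , sym (ℤₚ.*-identityʳ s)) k in unit-from-multiple s c _ e T²≡1
      ω : ℤ[i]
      ω = (- + 1 - P) , (d * s)
      z⁴≡1+4Pω : fourth z ≡ ⟨ + 1 ⟩ ⊕ (⟨ + 4 ⟩ ⊗ (⟨ P ⟩ ⊗ ω))
      z⁴≡1+4Pω = cong₂ _,_
        (begin
          re₄ ≡⟨ re₄-factor A B ⟩
          (s * s) * (d * d) - + 4 * (P * P) ≡⟨ cong (λ x → x * (d * d) - + 4 * (P * P)) s²≡1 ⟩
          + 1 * (d * d) - + 4 * (P * P) ≡⟨ d² A B ⟩
          s * s - + 4 * P - + 4 * (P * P) ≡⟨ cong (λ x → x - + 4 * P - + 4 * (P * P)) s²≡1 ⟩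
          + 1 - + 4 * P - + 4 * (P * P) ≡⟨ re P (d * s) ⟩
          proj₁ (⟨ + 1 ⟩ ⊕ (⟨ + 4 ⟩ ⊗ (⟨ P ⟩ ⊗ ω))) ∎)
        (im A B)
        where
        d² : ∀ A B → + 1 * ((A - B) * (A - B)) - + 4 * ((A * B) * (A * B)) ≡ (A + B) * (A + B) - + 4 * (A * B) - + 4 * ((A * B) * (A * B))
        d² = ℤ-ring
        re : ∀ P y → + 1 - + 4 * P - + 4 * (P * P)
          ≡ + 1 + (+ 4 * (P * (- + 1 - P) + - + 1 * (+ 0 * y)) + - + 1 * (+ 0 * (P * y + + 0 * (- + 1 - P))))
        re = ℤ-ring
        im : ∀ A B → (A * A + - + 1 * (B * B)) * (A * B + B * A) + (A * B + B * A) * (A * A + - + 1 * (B * B))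
          ≡ + 0 + (+ 4 * ((A * B) * ((A - B) * (A + B)) + + 0 * (- + 1 - A * B)) + + 0 * ((A * B) * (- + 1 - A * B) + - + 1 * (+ 0 * ((A - B) * (A + B)))))
        im = ℤ-ring
      S[zω] : S (z ⊗ ω) ≡ P * (- + 5 * s)
      S[zω] = begin
        S (z ⊗ ω) ≡⟨ expand A B ⟩
        s * (- + 1 - P + (s * s - + 4 * P)) ≡⟨ cong (λ x → s * (- + 1 - P + (x - + 4 * P))) s²≡1 ⟩
        s * (- + 1 - P + (+ 1 - + 4 * P)) ≡⟨ collect s P ⟩
        P * (- + 5 * s) ∎
        where
        expand : ∀ A B → (A * (- + 1 - A * B) + - + 1 * (B * ((A - B) * (A + B)))) + (A * ((A - B) * (A + B)) + B * (- + 1 - A * B))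
          ≡ (A + B) * (- + 1 - A * B + ((A + B) * (A + B) - + 4 * (A * B)))
        expand = ℤ-ring
        collect : ∀ s P → s * (- + 1 - P + (+ 1 - + 4 * P)) ≡ P * (- + 5 * s)
        collect = ℤ-ring

    exponent-3 : P ≢ + 0 → ∀ k → let T = S ((fourth z ^ k) ⊗ (z ⊗ (z ⊗ z))) in T * T ≢ + 1
    exponent-3 P≢0 k T²≡1 =
      case-3 (fourth z) z³ ω P d (trans z⁴≡1+4Pω (cong (λ p → ⟨ + 1 ⟩ ⊕ (⟨ + 4 ⟩ ⊗ (p ⊗ ω))) (sym (⟦⟧≡⟨⟩ P))))
        (trans (Sz³ A B) (cong (λ x → d * (x + + 6 * P)) d²≡1)) d²≡1 P≢0 P-even k T²≡1
      where
      z³ : ℤ[i]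
      z³ = z ⊗ (z ⊗ z)
      Sz³ : ∀ A B → (A * (A * A + - + 1 * (B * B)) + - + 1 * (B * (A * B + B * A))) + (A * (A * B + B * A) + B * (A * A + - + 1 * (B * B)))
        ≡ (A - B) * ((A - B) * (A - B) + + 6 * (A * B))
      Sz³ = ℤ-ring
      d²≡1 : d * d ≡ + 1
      d²≡1 = let c , e = divides-step d s (ℤₚ.*-comm s d) z³ (d * d + + 6 * P , Sz³ A B) k in unit-from-multiple d c _ e T²≡1
      ω : ℤ[i]
      ω = (+ 1 - P) , (d * s)
      z⁴≡1+4Pω : fourth z ≡ ⟨ + 1 ⟩ ⊕ (⟨ + 4 ⟩ ⊗ (⟨ P ⟩ ⊗ ω))
      z⁴≡1+4Pω = cong₂ _,_
        (begin
          re₄ ≡⟨ re₄-factor A B ⟩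
          (s * s) * (d * d) - + 4 * (P * P) ≡⟨ cong (λ x → (s * s) * x - + 4 * (P * P)) d²≡1 ⟩
          (s * s) * + 1 - + 4 * (P * P) ≡⟨ s² A B ⟩
          d * d + + 4 * P - + 4 * (P * P) ≡⟨ cong (λ x → x + + 4 * P - + 4 * (P * P)) d²≡1 ⟩
          + 1 + + 4 * P - + 4 * (P * P) ≡⟨ re P (d * s) ⟩
          proj₁ (⟨ + 1 ⟩ ⊕ (⟨ + 4 ⟩ ⊗ (⟨ P ⟩ ⊗ ω))) ∎)
        (im A B)
        where
        s² : ∀ A B → ((A + B) * (A + B)) * + 1 - + 4 * ((A * B) * (A * B)) ≡ (A - B) * (A - B) + + 4 * (A * B) - + 4 * ((A * B) * (A * B))
        s² = ℤ-ring
        re : ∀ P y → + 1 + + 4 * P - + 4 * (P * P)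
          ≡ + 1 + (+ 4 * (P * (+ 1 - P) + - + 1 * (+ 0 * y)) + - + 1 * (+ 0 * (P * y + + 0 * (+ 1 - P))))
        re = ℤ-ring
        im : ∀ A B → (A * A + - + 1 * (B * B)) * (A * B + B * A) + (A * B + B * A) * (A * A + - + 1 * (B * B))
          ≡ + 0 + (+ 4 * ((A * B) * ((A - B) * (A + B)) + + 0 * (+ 1 - A * B)) + + 0 * ((A * B) * (+ 1 - A * B) + - + 1 * (+ 0 * ((A - B) * (A + B)))))
        im = ℤ-ring
      P-even : ∃ λ h → P ≡ + 2 * h
      P-even = cases (ℤ-parity A) (ℤ-parity B)
        where
        cases : (∃ λ h → A ≡ + 2 * h ⊎ A ≡ + 2 * h + + 1) → (∃ λ h → B ≡ + 2 * h ⊎ B ≡ + 2 * h + + 1) → ∃ λ h → P ≡ + 2 * h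
        cases (h , inj₁ e) _ = h * B , trans (cong (_* B) e) (ℤₚ.*-assoc (+ 2) h B)
        cases (h , inj₂ _) (h′ , inj₁ e) = A * h′ , trans (cong (A *_) e) (pull A h′)
          where
          pull : ∀ a h → a * (+ 2 * h) ≡ + 2 * (a * h)
          pull = ℤ-ring
        cases (h , inj₂ e) (h′ , inj₂ e′) = contradiction (trans (cong₂ _-_ e e′) (sub h h′)) (unit≢even d (h - h′) d²≡1)
          where
          sub : ∀ h h′ → (+ 2 * h + + 1) - (+ 2 * h′ + + 1) ≡ + 2 * (h - h′)
          sub = ℤ-ring

    odd-power-sum : P ≢ + 0 → ∀ h → 0 < h → let T = S (z ^ suc (h ℕ.+ h)) in T * T ≢ + 1
    odd-power-sum P≢0 = odd-power z (exponent-1 P≢0) (exponent-3 P≢0)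

  norm : ℤ[i] → ℤ
  norm (a , b) = a * a + b * b

  norm-⊗ : ∀ z w → norm (z ⊗ w) ≡ norm z * norm w
  norm-⊗ (a , b) (c , d) = brahmagupta a b c d
    where
    brahmagupta : ∀ a b c d →
      (a * c + - + 1 * (b * d)) * (a * c + - + 1 * (b * d)) + (a * d + b * c) * (a * d + b * c)
      ≡ (a * a + b * b) * (c * c + d * d)
    brahmagupta = ℤ-ring

  norm-^ : ∀ z q n → norm z ≡ + q → norm (z ^ n) ≡ + (q ℕ.^ n)
  norm-^ z q zero    e = refl
  norm-^ z q (suc n) e = trans (norm-⊗ z (z ^ n)) (trans (cong₂ _*_ e (norm-^ z q n e)) (sym (ℤₚ.pos-* q (q ℕ.^ n))))

  conj-⊗ : ∀ z w → conj (z ⊗ w) ≡ conj z ⊗ conj w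
  conj-⊗ (a , b) (c , d) = cong₂ _,_ (re a b c d) (im a b c d)
    where
    re : ∀ a b c d → a * c + - + 1 * (b * d) ≡ a * c + - + 1 * (- b * - d)
    re = ℤ-ring
    im : ∀ a b c d → - (a * d + b * c) ≡ a * - d + - b * c
    im = ℤ-ring

  conj-^ : ∀ z n → conj (z ^ n) ≡ conj z ^ n
  conj-^ z zero    = refl
  conj-^ z (suc n) = trans (conj-⊗ z (z ^ n)) (cong (conj z ⊗_) (conj-^ z n))

  module OddPower {p : ℕ} (p-prime : Prime p) (p∤2 : ¬ p ∣ 2) where
    open TwoSquares p-prime p∤2

    p∤1 : ¬ + p ∣ℤ + 1
    p∤1 p∣1 = contradiction (∣.∣1⇒≡1 (ℤ∣.∣⇒∣ᵤ p∣1)) (ℕ.nonTrivial⇒≢1 {{prime⇒nonTrivial p-prime}})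

    module _ (f : ℕ) {A B : ℤ} (Z : Primitive f A B) where
      open Primitive Z using (p∤a) renaming (norm to normZ)

      private
        z : ℤ[i]
        z = A , B

        p∤b : ¬ + p ∣ℤ B
        p∤b = Primitive.p∤a (swap f Z)

        p∤i*j : ∀ i j → ¬ + p ∣ℤ i → ¬ + p ∣ℤ j → ¬ + p ∣ℤ i * j
        p∤i*j i j p∤i p∤j p∣ij′ = [ p∤i , p∤j ]′ (p∣ij i j p∣ij′)

        0-divisible : ∀ {i} → i ≡ + 0 → + p ∣ℤ i
        0-divisible refl = ℤ∣.divides (+ 0) (sym (ℤₚ.*-zeroˡ (+ p)))

        -- z² = 2A z - |z|², so modulo p the powers of z are multiples of z.
        multiple : ∀ n → ∃ λ c → ∃ λ x → ∃ λ y → (¬ + p ∣ℤ c) × z ^ suc n ≡ (c * A + + p * x , c * B + + p * y)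
        multiple zero = + 1 , + 0 , + 0 , p∤1 , trans (CommutativeRing.*-identityʳ ℤ[i]-ring z) (cong₂ _,_ (simplify A (+ p)) (simplify B (+ p)))
          where
          simplify : ∀ a p → a ≡ + 1 * a + p * + 0
          simplify = ℤ-ring
        multiple (suc n) with multiple n
        ... | c , x , y , p∤c , e = + 2 * A * c , A * x - B * y - c * + (p ℕ.^ f) , A * y + B * x ,
          p∤i*j (+ 2 * A) c (p∤i*j (+ 2) A (λ p∣2 → p∤2 (ℤ∣.∣⇒∣ᵤ p∣2)) p∤a) p∤c ,
          trans (cong (z ⊗_) e) (cong₂ _,_
            (trans (re A B c x y (+ p)) (trans (cong (λ N → (+ 2 * A * c) * A + + p * (A * x - B * y) - c * N) (trans normZ (ℤₚ.pos-* p (p ℕ.^ f))))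
              (re′ ((+ 2 * A * c) * A) (+ p) (A * x - B * y) c (+ (p ℕ.^ f)))))
            (im A B c x y (+ p)))
          where
          re : ∀ A B c x y p → A * (c * A + p * x) + - + 1 * (B * (c * B + p * y))
            ≡ (+ 2 * A * c) * A + p * (A * x - B * y) - c * (A * A + B * B)
          re = ℤ-ring
          re′ : ∀ k p w c r → k + p * w - c * (p * r) ≡ k + p * (w - c * r)
          re′ = ℤ-ring
          im : ∀ A B c x y p → A * (c * B + p * y) + B * (c * A + p * x) ≡ (+ 2 * A * c) * B + p * (A * y + B * x)
          im = ℤ-ring

        p∤re : ∀ n → ¬ + p ∣ℤ proj₁ (z ^ suc n)
        p∤re n p∣ with multiple n
        ... | c , x , y , p∤c , e = p∤i*j c A p∤c p∤a (ℤ∣.∣m+n∣n⇒∣m (subst (+ p ∣ℤ_) (cong proj₁ e) p∣) (ℤ∣.divides x (ℤₚ.*-comm (+ p) x)))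

      -- A case of Størmer's theorem on x² + 1 = 2yⁿ, with x = 2m + 1.
      no-odd-power : ∀ h → 0 < h → ∀ (m : ℤ) → m * m + (m + + 1) * (m + + 1) ≢ + ((p ℕ.^ suc f) ℕ.^ suc (h ℕ.+ h))
      no-odd-power h 0<h m m-norm = [ (λ s → cases (proj₁ s) (proj₂ s)) , (λ s → cases′ (proj₁ s) (proj₂ s)) ]′ (sameSquares e W M)
        where
        n e : ℕ
        n = suc (h ℕ.+ h)
        e = (h ℕ.+ h) ℕ.+ f ℕ.* n
        exponent : suc f ℕ.* n ≡ suc e
        exponent = refl
        power : (p ℕ.^ suc f) ℕ.^ n ≡ p ℕ.^ suc e
        power = ℕₚ.^-*-assoc p (suc f) n
        C D : ℤ
        C = proj₁ (z ^ n)
        D = proj₂ (z ^ n)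
        W : Primitive e C D
        W = record { norm = trans (norm-^ z (p ℕ.^ suc f) n normZ) (cong +_ power) ; coprime = λ x → p∤re (h ℕ.+ h) (proj₁ x) }
        M : Primitive e m (m + + 1)
        M = record { norm = trans m-norm (cong +_ power) ; coprime = λ x → p∤1 (subst (+ p ∣ℤ_) (difference m) (ℤ∣.∣m∣n⇒∣m-n (proj₂ x) (proj₁ x))) }
          where
          difference : ∀ m → (m + + 1) - m ≡ + 1
          difference = ℤ-ring
        AB≢0 : A * B ≢ + 0
        AB≢0 ab≡0 = [ (λ a≡0 → p∤a (0-divisible a≡0)) , (λ b≡0 → p∤b (0-divisible b≡0)) ]′ (i*j≡0 A B ab≡0)
        C+D : (C + D) * (C + D) ≢ + 1
        C+D = odd-power-sum A B AB≢0 h 0<h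
        C-D : (C + - D) * (C + - D) ≢ + 1
        C-D sq = odd-power-sum A (- B) -AB≢0 h 0<h (trans (cong (λ w → S w * S w) (sym (conj-^ z n))) sq)
          where
          -AB≢0 : A * - B ≢ + 0
          -AB≢0 ab≡0 = [ (λ a≡0 → p∤a (0-divisible a≡0)) , (λ b≡0 → p∤b (0-divisible (trans (sym (ℤₚ.neg-involutive B)) (cong -_ b≡0)))) ]′ (i*j≡0 A (- B) ab≡0)
        consecutive : C * C + D * D ≡ m * m + (m + + 1) * (m + + 1) → (C * D) * (C * D) ≡ (m * (m + + 1)) * (m * (m + + 1)) → ⊥
        consecutive sum product = [ (λ cd → C-D (trans (minus C D) (trans (cong₂ (λ s t → s - + 2 * t) sum cd) (one m))))
                                  , (λ cd → C+D (trans (plus C D) (trans (cong₂ (λ s t → s + + 2 * t) sum cd) (one′ m)))) ]′ (i²≡j² (C * D) (m * (m + + 1)) product)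
          where
          plus : ∀ c d → (c + d) * (c + d) ≡ (c * c + d * d) + + 2 * (c * d)
          plus = ℤ-ring
          minus : ∀ c d → (c + - d) * (c + - d) ≡ (c * c + d * d) - + 2 * (c * d)
          minus = ℤ-ring
          one : ∀ m → (m * m + (m + + 1) * (m + + 1)) - + 2 * (m * (m + + 1)) ≡ + 1
          one = ℤ-ring
          one′ : ∀ m → (m * m + (m + + 1) * (m + + 1)) + + 2 * (- (m * (m + + 1))) ≡ + 1
          one′ = ℤ-ring
        rearrange : ∀ c d → (c * d) * (c * d) ≡ (c * c) * (d * d)
        rearrange = ℤ-ring
        cases : C * C ≡ m * m → D * D ≡ (m + + 1) * (m + + 1) → ⊥
        cases c² d² = consecutive (cong₂ _+_ c² d²) (trans (rearrange C D) (trans (cong₂ _*_ c² d²) (sym (rearrange m (m + + 1)))))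
        cases′ : C * C ≡ (m + + 1) * (m + + 1) → D * D ≡ m * m → ⊥
        cases′ c² d² = consecutive (trans (cong₂ _+_ c² d²) (ℤₚ.+-comm ((m + + 1) * (m + + 1)) (m * m)))
          (trans (rearrange C D) (trans (cong₂ _*_ c² d²) (trans (ℤₚ.*-comm ((m + + 1) * (m + + 1)) (m * m)) (sym (rearrange m (m + + 1))))))

open GaussianPowers using (module OddPower)

module PrimeField {p : ℕ} (p-prime : Prime p) where
  private
    instance
      p≢0 : NonZero p
      p≢0 = prime⇒nonZero p-prime

  cls : ℕ → Fin p
  cls n = n mod p

  toℕ-cls : ∀ n → toℕ (cls n) ≡ n % p
  toℕ-cls n = Finₚ.toℕ-fromℕ< (m%n<n n p)

  cls-≡ : ∀ m n → m % p ≡ n % p → cls m ≡ cls n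
  cls-≡ m n e = Finₚ.toℕ-injective (trans (toℕ-cls m) (trans e (sym (toℕ-cls n))))

  cls-toℕ : ∀ x → cls (toℕ x) ≡ x
  cls-toℕ x = Finₚ.toℕ-injective (trans (toℕ-cls (toℕ x)) (m<n⇒m%n≡m (Finₚ.toℕ<n x)))

  _⊞_ _⊠_ : Fin p → Fin p → Fin p
  x ⊞ y = cls (toℕ x ℕ.+ toℕ y)
  x ⊠ y = cls (toℕ x ℕ.* toℕ y)

  ⊟_ : Fin p → Fin p
  ⊟ x = cls (p ∸ toℕ x)

  cls-+ : ∀ m n → cls m ⊞ cls n ≡ cls (m ℕ.+ n)
  cls-+ m n = trans (cong₂ (λ a b → cls (a ℕ.+ b)) (toℕ-cls m) (toℕ-cls n)) (cls-≡ _ _ (sym (%-distribˡ-+ m n p)))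

  cls-* : ∀ m n → cls m ⊠ cls n ≡ cls (m ℕ.* n)
  cls-* m n = trans (cong₂ (λ a b → cls (a ℕ.* b)) (toℕ-cls m) (toℕ-cls n)) (cls-≡ _ _ (sym (%-distribˡ-* m n p)))

  cls-p* : ∀ n → cls (n ℕ.* p) ≡ cls 0
  cls-p* n = cls-≡ _ _ (trans (m*n%n≡0 n p) (sym (m*n%n≡0 0 p)))

  private
    +ˡ : ∀ x n → x ⊞ cls n ≡ cls (toℕ x ℕ.+ n)
    +ˡ x n = trans (cong (_⊞ cls n) (sym (cls-toℕ x))) (cls-+ (toℕ x) n)

    *ˡ : ∀ x n → x ⊠ cls n ≡ cls (toℕ x ℕ.* n)
    *ˡ x n = trans (cong (_⊠ cls n) (sym (cls-toℕ x))) (cls-* (toℕ x) n)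

    ⊞-comm : ∀ x y → x ⊞ y ≡ y ⊞ x
    ⊞-comm x y = cong cls (ℕₚ.+-comm (toℕ x) (toℕ y))

    ⊠-comm : ∀ x y → x ⊠ y ≡ y ⊠ x
    ⊠-comm x y = cong cls (ℕₚ.*-comm (toℕ x) (toℕ y))

    ⊞-assoc : ∀ x y z → (x ⊞ y) ⊞ z ≡ x ⊞ (y ⊞ z)
    ⊞-assoc x y z = trans (⊞-comm (x ⊞ y) z) (trans (+ˡ z (toℕ x ℕ.+ toℕ y)) (trans (cong cls (shuffle (toℕ x) (toℕ y) (toℕ z))) (sym (+ˡ x (toℕ y ℕ.+ toℕ z)))))
      where
      shuffle : ∀ x y z → z ℕ.+ (x ℕ.+ y) ≡ x ℕ.+ (y ℕ.+ z)
      shuffle = ℕ-ring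

    ⊠-assoc : ∀ x y z → (x ⊠ y) ⊠ z ≡ x ⊠ (y ⊠ z)
    ⊠-assoc x y z = trans (⊠-comm (x ⊠ y) z) (trans (*ˡ z (toℕ x ℕ.* toℕ y)) (trans (cong cls (shuffle (toℕ x) (toℕ y) (toℕ z))) (sym (*ˡ x (toℕ y ℕ.* toℕ z)))))
      where
      shuffle : ∀ x y z → z ℕ.* (x ℕ.* y) ≡ x ℕ.* (y ℕ.* z)
      shuffle = ℕ-ring

    ⊞-identityʳ : ∀ x → x ⊞ cls 0 ≡ x
    ⊞-identityʳ x = trans (+ˡ x 0) (trans (cong cls (ℕₚ.+-identityʳ (toℕ x))) (cls-toℕ x))

    ⊠-identityʳ : ∀ x → x ⊠ cls 1 ≡ x
    ⊠-identityʳ x = trans (*ˡ x 1) (trans (cong cls (ℕₚ.*-identityʳ (toℕ x))) (cls-toℕ x))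

    ⊟-inverseʳ : ∀ x → x ⊞ (⊟ x) ≡ cls 0
    ⊟-inverseʳ x = trans (+ˡ x (p ∸ toℕ x)) (cls-≡ _ _ (trans (cong (_% p) (ℕₚ.m+[n∸m]≡n (ℕₚ.<⇒≤ (Finₚ.toℕ<n x)))) (trans (n%n≡0 p) (sym (m*n%n≡0 0 p)))))

    ⊠-distribˡ : ∀ x y z → x ⊠ (y ⊞ z) ≡ (x ⊠ y) ⊞ (x ⊠ z)
    ⊠-distribˡ x y z = trans (*ˡ x (toℕ y ℕ.+ toℕ z)) (trans (cong cls (ℕₚ.*-distribˡ-+ (toℕ x) (toℕ y) (toℕ z))) (sym (cls-+ (toℕ x ℕ.* toℕ y) (toℕ x ℕ.* toℕ z))))

  isCommutativeRing : IsCommutativeRing _≡_ _⊞_ _⊠_ ⊟_ (cls 0) (cls 1)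
  isCommutativeRing = record
    { isRing = record
      { +-isAbelianGroup = record
        { isGroup = record
          { isMonoid = record
            { isSemigroup = record
              { isMagma = record { isEquivalence = isEquivalence ; ∙-cong = cong₂ _⊞_ }
              ; assoc = ⊞-assoc }
            ; identity = (λ x → trans (⊞-comm (cls 0) x) (⊞-identityʳ x)) , ⊞-identityʳ }
          ; inverse = (λ x → trans (⊞-comm (⊟ x) x) (⊟-inverseʳ x)) , ⊟-inverseʳ
          ; ⁻¹-cong = cong ⊟_ }
        ; comm = ⊞-comm }
      ; *-cong = cong₂ _⊠_
      ; *-assoc = ⊠-assoc
      ; *-identity = (λ x → trans (⊠-comm (cls 1) x) (⊠-identityʳ x)) , ⊠-identityʳ
      ; distrib = ⊠-distribˡ , λ x y z → trans (⊠-comm (y ⊞ z) x) (trans (⊠-distribˡ x y z) (cong₂ _⊞_ (⊠-comm x y) (⊠-comm x z))) }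
    ; *-comm = ⊠-comm }

  private
    ring : CommutativeRing 0ℓ 0ℓ
    ring = record { isCommutativeRing = isCommutativeRing }

    1<p : 1 < p
    1<p = ℕ.nonTrivial⇒n>1 p {{prime⇒nonTrivial p-prime}}

    0≢1 : cls 0 ≢ cls 1
    0≢1 e = contradiction (trans (sym (trans (toℕ-cls 0) (m<n⇒m%n≡m (ℕₚ.<-trans (s≤s z≤n) 1<p)))) (trans (cong toℕ e) (trans (toℕ-cls 1) (m<n⇒m%n≡m 1<p)))) λ ()

    inverse : ∀ x → x ≢ cls 0 → ∃ λ y → x ⊠ y ≡ cls 1
    inverse x x≢0 = bezout (coprime-Bézout (prime⇒coprime p-prime {{ℕ.≢-nonZero a≢0}} (Finₚ.toℕ<n x)))
      where
      open IntegerImage ring using (module Solver)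
      open Solver using (solve; _:=_; _:+_; _:*_; :-_; con)
      a : ℕ
      a = toℕ x
      a≢0 : a ≢ 0
      a≢0 e = x≢0 (trans (sym (cls-toℕ x)) (cong cls e))
      bezout : Bézout.Identity 1 p a → ∃ λ y → x ⊠ y ≡ cls 1
      bezout (Bézout.-+ u v eq) = cls v , (begin
        x ⊠ cls v ≡⟨ *ˡ x v ⟩
        cls (a ℕ.* v) ≡⟨ cong cls (trans (ℕₚ.*-comm a v) (sym eq)) ⟩
        cls (1 ℕ.+ u ℕ.* p) ≡⟨ cls-+ 1 (u ℕ.* p) ⟨
        cls 1 ⊞ cls (u ℕ.* p) ≡⟨ cong (cls 1 ⊞_) (cls-p* u) ⟩
        cls 1 ⊞ cls 0 ≡⟨ ⊞-identityʳ (cls 1) ⟩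
        cls 1 ∎)
      bezout (Bézout.+- u v eq) = ⊟ (cls v) , (begin
        x ⊠ (⊟ (cls v)) ≡⟨ solve 2 (λ x v → x :* (:- v) := con (+ 1) :+ :- (con (+ 1) :+ x :* v)) refl x (cls v) ⟩
        cls 1 ⊞ (⊟ (cls 1 ⊞ (x ⊠ cls v))) ≡⟨ cong (λ w → cls 1 ⊞ (⊟ w)) 1+xv≡0 ⟩
        cls 1 ⊞ (⊟ (cls 0)) ≡⟨ solve 0 (con (+ 1) :+ :- con (+ 0) := con (+ 1)) refl ⟩
        cls 1 ∎)
        where
        1+xv≡0 : cls 1 ⊞ (x ⊠ cls v) ≡ cls 0
        1+xv≡0 = begin
          cls 1 ⊞ (x ⊠ cls v) ≡⟨ cong (cls 1 ⊞_) (*ˡ x v) ⟩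
          cls 1 ⊞ cls (a ℕ.* v) ≡⟨ cls-+ 1 (a ℕ.* v) ⟩
          cls (1 ℕ.+ a ℕ.* v) ≡⟨ cong cls (trans (cong (1 ℕ.+_) (ℕₚ.*-comm a v)) eq) ⟩
          cls (u ℕ.* p) ≡⟨ cls-p* u ⟩
          cls 0 ∎

  primeField : FiniteField p
  primeField = record
    { isCommutativeRing = isCommutativeRing
    ; 0≢1 = 0≢1
    ; inverse = inverse
    ; _≟_ = Finₚ._≟_
    ; enum = ↔-id (Fin p) }

module _ {q : ℕ} (F : FiniteField q) where
  open Field F
  open Solver using (solve; _:=_; _:+_; _:*_; _:-_; :-_; con)

  quadraticExtension : ∀ d → (∀ x → x * x ≢ d) → FiniteField (q ℕ.* q)
  quadraticExtension d d-nonsquare = record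
    { isCommutativeRing = isCommutativeRing′
    ; 0≢1 = λ e → 0≢1 (cong proj₁ e)
    ; inverse = λ { (a , b) ne → (a * inv (n a b) , - b * inv (n a b)) , inverse-law a b ne }
    ; _≟_ = ≡-dec _≟_ _≟_
    ; enum = (enum ×-↔ enum) ↔-∘ Finₚ.*↔× }
    where
    open Adjoin√ (FiniteField.isCommutativeRing F) d using (isCommutativeRing′)
    n : K → K → K
    n a b = a * a - d * (b * b)
    n≢0 : ∀ a b → (a , b) ≢ (0# , 0#) → n a b ≢ 0#
    n≢0 a b ne n≡0 = lemma (b ≟ 0#)
      where
      a²≡db² : a * a ≡ d * (b * b)
      a²≡db² = x-y≡0 (a * a) (d * (b * b)) n≡0
      lemma : Dec (b ≡ 0#) → ⊥
      lemma (yes b≡0) = ne (cong₂ _,_ ([ (λ z → z) , (λ z → z) ]′ (x*y≡0 a a (trans a²≡db² (trans (cong (λ w → d * (w * w)) b≡0) (solve 1 (λ d → d :* (con (+ 0) :* con (+ 0)) := con (+ 0)) refl d))))) b≡0)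
      lemma (no b≢0) = d-nonsquare (a * inv b) (begin
        (a * inv b) * (a * inv b) ≡⟨ solve 2 (λ a i → (a :* i) :* (a :* i) := (a :* a) :* (i :* i)) refl a (inv b) ⟩
        (a * a) * (inv b * inv b) ≡⟨ cong (_* (inv b * inv b)) a²≡db² ⟩
        d * (b * b) * (inv b * inv b) ≡⟨ solve 3 (λ d b i → d :* (b :* b) :* (i :* i) := d :* ((b :* i) :* (b :* i))) refl d b (inv b) ⟩
        d * ((b * inv b) * (b * inv b)) ≡⟨ cong (λ w → d * (w * w)) (*-inv b≢0) ⟩
        d * (1# * 1#) ≡⟨ solve 1 (λ d → d :* (con (+ 1) :* con (+ 1)) := d) refl d ⟩
        d ∎)
    inverse-law : ∀ a b → (a , b) ≢ (0# , 0#) →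
      (a * (a * inv (n a b)) + d * (b * (- b * inv (n a b))) , a * (- b * inv (n a b)) + b * (a * inv (n a b))) ≡ (1# , 0#)
    inverse-law a b ne = cong₂ _,_
      (trans (solve 4 (λ a b d i → a :* (a :* i) :+ d :* (b :* (:- b :* i)) := (a :* a :- d :* (b :* b)) :* i) refl a b d (inv (n a b))) (*-inv (n≢0 a b ne)))
      (solve 3 (λ a b i → a :* (:- b :* i) :+ b :* (a :* i) := con (+ 0)) refl a b (inv (n a b)))

1mod4-^ : ∀ {p} s → p ≡ 1+4× s → 0 < s → ∀ n → 0 < n → ∃ λ t → 0 < t × p ℕ.^ n ≡ 1+4× t
1mod4-^ {p} s p≡ 0<s 1 _ = s , 0<s , trans (ℕₚ.*-identityʳ p) p≡
1mod4-^ {p} s p≡ 0<s (suc n@(suc _)) _ with 1mod4-^ s p≡ 0<s n (s≤s z≤n)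
... | t , 0<t , e = t ℕ.+ (s ℕ.+ 4 ℕ.* (s ℕ.* t)) , ℕₚ.<-≤-trans 0<t (ℕₚ.m≤m+n t _) , trans (cong₂ ℕ._*_ p≡ e) (expand s t)
  where
  expand : ∀ s t → suc ((s ℕ.+ s) ℕ.+ (s ℕ.+ s)) ℕ.* suc ((t ℕ.+ t) ℕ.+ (t ℕ.+ t))
    ≡ suc (((t ℕ.+ (s ℕ.+ 4 ℕ.* (s ℕ.* t))) ℕ.+ (t ℕ.+ (s ℕ.+ 4 ℕ.* (s ℕ.* t)))) ℕ.+ ((t ℕ.+ (s ℕ.+ 4 ℕ.* (s ℕ.* t))) ℕ.+ (t ℕ.+ (s ℕ.+ 4 ℕ.* (s ℕ.* t)))))
  expand = ℕ-ring

0<2^k : ∀ k → 0 < 2 ℕ.^ k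
0<2^k k = ℕₚ.m^n>0 2 k

fieldTower : ∀ {p} → Prime p → ∀ s → p ≡ 1+4× s → 0 < s → ∀ k → FiniteField (p ℕ.^ (2 ℕ.^ k))
fieldTower {p} p-prime s p≡ 0<s zero = subst FiniteField (sym (ℕₚ.*-identityʳ p)) (PrimeField.primeField p-prime)
fieldTower {p} p-prime s p≡ 0<s (suc k) = subst FiniteField (square (2 ℕ.^ k)) (quadraticExtension F g (λ x e → N≢0 x (trans (cong (_- g) e) (-‿inverseʳ g))))
  where
  F : FiniteField (p ℕ.^ (2 ℕ.^ k))
  F = fieldTower p-prime s p≡ 0<s k
  t-data : ∃ λ t → 0 < t × p ℕ.^ (2 ℕ.^ k) ≡ 1+4× t
  t-data = 1mod4-^ s p≡ 0<s (2 ℕ.^ k) (0<2^k k)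
  open Field F
  open QuarticCharacter F (proj₁ t-data) (proj₁ (proj₂ t-data)) (proj₂ (proj₂ t-data))
  open CharacterSums F (proj₁ t-data) (proj₁ (proj₂ t-data)) (proj₂ (proj₂ t-data))
  square : ∀ n → p ℕ.^ n ℕ.* p ℕ.^ n ≡ p ℕ.^ (2 ℕ.* n)
  square n = trans (sym (ℕₚ.^-distribˡ-+-* p n n)) (cong (λ m → p ℕ.^ (n ℕ.+ m)) (sym (ℕₚ.+-identityʳ n)))

-- 2 (m² + (m+1)²) = (2m+1)² + 1, so - 1 is a square modulo p.
prime-1mod4 : ∀ {p} → Prime p → ¬ p ∣ 2 → ∀ m → p ∣ m ℕ.* m ℕ.+ suc m ℕ.* suc m → ∃ λ s → 0 < s × p ≡ 1+4× s
prime-1mod4 {p} p-prime p∤2 m p∣q = cases (ℕ-parity p)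
  where
  open Field (PrimeField.primeField p-prime)
  open Characteristic (PrimeField.primeField p-prime) {p} {1} p-prime (sym (ℕₚ.*-identityʳ p))
  open Solver using (solve; _:=_; _:+_; _:*_; _:-_; :-_; con)
  x : K
  x = ⟦ + suc (m ℕ.+ m) ⟧
  x²≡-1 : x * x ≡ - 1#
  x²≡-1 = begin
    x * x ≡⟨ solve 1 (λ y → y := (y :+ con (+ 1)) :- con (+ 1)) refl (x * x) ⟩
    x * x + 1# - 1# ≡⟨ cong (_- 1#) (trans (cong (_+ 1#) (sym (⟦⟧-* (+ suc (m ℕ.+ m)) (+ suc (m ℕ.+ m))))) (sym (⟦⟧-+ (+ suc (m ℕ.+ m) ℤ.* + suc (m ℕ.+ m)) (+ 1)))) ⟩
    ⟦ + suc (m ℕ.+ m) ℤ.* + suc (m ℕ.+ m) ℤ.+ + 1 ⟧ - 1#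
      ≡⟨ cong (λ w → ⟦ w ℤ.+ + 1 ⟧ - 1#) (ℤₚ.pos-* (suc (m ℕ.+ m)) (suc (m ℕ.+ m))) ⟨
    ⟦ + (suc (m ℕ.+ m) ℕ.* suc (m ℕ.+ m) ℕ.+ 1) ⟧ - 1# ≡⟨ cong (_- 1#) (p∣n⇒⟦n⟧≡0 (subst (p ∣_) (double m) (∣.∣n⇒∣m*n 2 p∣q))) ⟩
    0# - 1# ≡⟨ +-identityˡ (- 1#) ⟩
    - 1# ∎
    where
    double : ∀ m → 2 ℕ.* (m ℕ.* m ℕ.+ suc m ℕ.* suc m) ≡ suc (m ℕ.+ m) ℕ.* suc (m ℕ.+ m) ℕ.+ 1
    double = ℕ-ring
  1≢-1 : 1# ≢ - 1#
  1≢-1 e = p∤n⇒⟦n⟧≢0 p∤2 (trans (cong (λ w → w + 1#) e) (-‿inverseˡ 1#))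
  x≢0 : x ≢ 0#
  x≢0 x≡0 = 0≢1 (trans (solve 0 (con (+ 0) := :- (con (+ 0) :* con (+ 0))) refl) (trans (cong (λ w → - (w * w)) (sym x≡0)) (trans (cong -_ x²≡-1) (solve 0 (:- (:- con (+ 1)) := con (+ 1)) refl))))
  odd-case : ∀ k → p ≢ suc (suc (k ℕ.+ k) ℕ.+ suc (k ℕ.+ k))
  odd-case k p≡ = 1≢-1 (trans (sym x^[p-1]≡1) x^[p-1]≡-1)
    where
    h : ℕ
    h = suc (k ℕ.+ k)
    x^[p-1]≡1 : x ^ (h ℕ.+ h) ≡ 1#
    x^[p-1]≡1 = *-cancelˡ x x≢0 (trans (subst (λ n → x ^ n ≡ x) p≡ (fermat x x≢0)) (sym (*-identityʳ x)))
    power : ∀ k → (- 1#) ^ (k ℕ.+ k) ≡ 1#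
    power k = trans (^-homo-* (- 1#) k k) (trans (sym (^-distrib-* (- 1#) (- 1#) k)) (trans (cong (_^ k) (solve 0 ((:- con (+ 1)) :* (:- con (+ 1)) := con (+ 1)) refl)) (1^n≡1 k)))
    x^[p-1]≡-1 : x ^ (h ℕ.+ h) ≡ - 1#
    x^[p-1]≡-1 = begin
      x ^ (h ℕ.+ h) ≡⟨ trans (^-homo-* x h h) (sym (^-distrib-* x x h)) ⟩
      (x * x) ^ h ≡⟨ cong (_^ h) x²≡-1 ⟩
      - 1# * (- 1#) ^ (k ℕ.+ k) ≡⟨ cong (- 1# *_) (power k) ⟩
      - 1# * 1# ≡⟨ *-identityʳ (- 1#) ⟩
      - 1# ∎
  cases : (∃ λ h → p ≡ h ℕ.+ h ⊎ p ≡ suc (h ℕ.+ h)) → ∃ λ s → 0 < s × p ≡ 1+4× s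
  cases (h , inj₁ p≡2h) = contradiction 2∣p even
    where
    2∣p : 2 ∣ p
    2∣p = divides h (trans p≡2h (trans (cong (h ℕ.+_) (sym (ℕₚ.+-identityʳ h))) (ℕₚ.*-comm 2 h)))
    odd : ∀ m → m ℕ.* m ℕ.+ suc m ℕ.* suc m ≡ 1 ℕ.+ (m ℕ.* m ℕ.+ m) ℕ.* 2
    odd = ℕ-ring
    even : ¬ 2 ∣ p
    even 2∣p = contradiction (∣.∣1⇒≡1 (∣.∣m+n∣m⇒∣n (subst (2 ∣_) (trans (odd m) (ℕₚ.+-comm 1 _)) (∣.∣-trans 2∣p p∣q)) (∣.n∣m*n (m ℕ.* m ℕ.+ m)))) λ ()
  cases (h , inj₂ p≡) with ℕ-parity h
  ... | zero , inj₁ refl = contradiction p≡ (ℕ.nonTrivial⇒≢1 {{prime⇒nonTrivial p-prime}})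
  ... | s@(suc _) , inj₁ refl = s , s≤s z≤n , p≡
  ... | k , inj₂ refl = contradiction p≡ (odd-case k)

sign-±1 : ∀ b → sign b ≡ + 1 ⊎ sign b ≡ ℤ.- + 1
sign-±1 true  = inj₂ refl
sign-±1 false = inj₁ refl

sign² : ∀ b → sign b ℤ.* sign b ≡ + 1
sign² true  = refl
sign² false = refl

±1-* : ∀ {a b} → a ≡ + 1 ⊎ a ≡ ℤ.- + 1 → b ≡ + 1 ⊎ b ≡ ℤ.- + 1 → a ℤ.* b ≡ + 1 ⊎ a ℤ.* b ≡ ℤ.- + 1
±1-* (inj₁ refl) (inj₁ refl) = inj₁ refl
±1-* (inj₁ refl) (inj₂ refl) = inj₂ refl
±1-* (inj₂ refl) (inj₁ refl) = inj₂ refl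
±1-* (inj₂ refl) (inj₂ refl) = inj₁ refl

rescale-hadamard : ∀ {n} (r c : Fin n → Bool) (H : Matrix n) → IsHadamard n H → IsHadamard n (rescale r c H)
rescale-hadamard r c H (entries , diag , off) =
    (λ i j → ±1-* (±1-* (sign-±1 (r i)) (entries i j)) (sign-±1 (c j)))
  , (λ i → trans (inner i i) (trans (cong₂ ℤ._*_ (sign² (r i)) (diag i)) (ℤₚ.*-identityˡ _)))
  , (λ i j i≢j → trans (inner i j) (trans (cong ((sign (r i) ℤ.* sign (r j)) ℤ.*_) (off i j i≢j)) (ℤₚ.*-zeroʳ (sign (r i) ℤ.* sign (r j)))))
  where
  rearrange : ∀ a b x y s → (a ℤ.* x ℤ.* s) ℤ.* (b ℤ.* y ℤ.* s) ≡ (s ℤ.* s) ℤ.* ((a ℤ.* b) ℤ.* (x ℤ.* y))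
  rearrange = ℤ-ring
  inner : ∀ i j → ∑ (λ l → rescale r c H i l ℤ.* rescale r c H j l) ≡ (sign (r i) ℤ.* sign (r j)) ℤ.* ∑ (λ l → H i l ℤ.* H j l)
  inner i j = trans (∑-cong (λ l → trans (rearrange (sign (r i)) (sign (r j)) (H i l) (H j l) (sign (c l)))
      (trans (cong (ℤ._* ((sign (r i) ℤ.* sign (r j)) ℤ.* (H i l ℤ.* H j l))) (sign² (c l))) (ℤₚ.*-identityˡ _))))
    (∑-*ˡ (sign (r i) ℤ.* sign (r j)) (λ l → H i l ℤ.* H j l))

isNegative : ℤ → Bool
isNegative (+ _)    = false
isNegative -[1+ _ ] = true

sign-isNegative : ∀ i → sign (isNegative i) ℤ.* i ≡ + ∣ i ∣
sign-isNegative (+ n)    = ℤₚ.*-identityˡ (+ n)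
sign-isNegative -[1+ n ] = ℤₚ.-1*i≡-i -[1+ n ]

sign-isNegative-±1 : ∀ {i} → i ≡ + 1 ⊎ i ≡ ℤ.- + 1 → sign (isNegative i) ≡ i
sign-isNegative-±1 (inj₁ refl) = refl
sign-isNegative-±1 (inj₂ refl) = refl

∣i∣²≡i² : ∀ i → + ∣ i ∣ ℤ.* + ∣ i ∣ ≡ i ℤ.* i
∣i∣²≡i² (+ n)    = refl
∣i∣²≡i² -[1+ n ] = refl

twoValued-sum : ∀ {n} (ρ : Fin n → ℕ) a b → (∀ i → ρ i ≡ a ⊎ ρ i ≡ b) →
  ∑ (λ i → + ρ i ℤ.* + ρ i) ≡ (+ a ℤ.+ + b) ℤ.* ∑ (λ i → + ρ i) ℤ.+ ℤ.- (+ a ℤ.* + b) ℤ.* + n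
twoValued-sum {n} ρ a b values = begin
  ∑ (λ i → + ρ i ℤ.* + ρ i)
    ≡⟨ ∑-cong (λ i → quadratic (ρ i) (values i)) ⟩
  ∑ (λ i → (+ a ℤ.+ + b) ℤ.* + ρ i ℤ.+ ℤ.- (+ a ℤ.* + b))
    ≡⟨ ∑-+ (λ i → (+ a ℤ.+ + b) ℤ.* + ρ i) (λ _ → ℤ.- (+ a ℤ.* + b)) ⟩
  ∑ (λ i → (+ a ℤ.+ + b) ℤ.* + ρ i) ℤ.+ ∑ {n} (λ _ → ℤ.- (+ a ℤ.* + b))
    ≡⟨ cong₂ ℤ._+_ (∑-*ˡ (+ a ℤ.+ + b) (λ i → + ρ i)) (trans (∑-const n (ℤ.- (+ a ℤ.* + b))) (ℤₚ.*-comm (+ n) (ℤ.- (+ a ℤ.* + b)))) ⟩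
  (+ a ℤ.+ + b) ℤ.* ∑ (λ i → + ρ i) ℤ.+ ℤ.- (+ a ℤ.* + b) ℤ.* + n ∎
  where
  vieta : ∀ x y → x ℤ.* x ≡ (x ℤ.+ y) ℤ.* x ℤ.+ ℤ.- (x ℤ.* y)
  vieta = ℤ-ring
  vieta′ : ∀ x y → y ℤ.* y ≡ (x ℤ.+ y) ℤ.* y ℤ.+ ℤ.- (x ℤ.* y)
  vieta′ = ℤ-ring
  quadratic : ∀ x → x ≡ a ⊎ x ≡ b → + x ℤ.* + x ≡ (+ a ℤ.+ + b) ℤ.* + x ℤ.+ ℤ.- (+ a ℤ.* + b)
  quadratic x (inj₁ refl) = vieta (+ x) (+ b)
  quadratic x (inj₂ refl) = vieta′ (+ a) (+ x)

1mod4-∤2 : ∀ {p s} → 0 < s → p ≡ 1+4× s → ¬ p ∣ 2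
1mod4-∤2 {p} {suc s} _ refl p∣2 = ℕₚ.<⇒≱ (s≤s (ℕₚ.≤-trans (s≤s (ℕₚ.m≤n+m 1 s)) (ℕₚ.m≤m+n (suc (s ℕ.+ 1)) _))) (∣.∣⇒≤ (subst (_∣ 2) (shape s) p∣2))
  where
  shape : ∀ s → suc ((suc s ℕ.+ suc s) ℕ.+ (suc s ℕ.+ suc s)) ≡ suc (suc (s ℕ.+ 1) ℕ.+ (3 ℕ.* s ℕ.+ 2))
  shape = ℕ-ring

module Bound (m′ : ℕ) where
  open import Data.Integer using (_+_; _*_; -_; _-_)
  m n₄ n q : ℕ
  m = suc m′
  n₄ = m ℕ.* m ℕ.+ m ℕ.+ 1
  q = m ℕ.* m ℕ.+ suc m ℕ.* suc m
  n = 2 ℕ.+ (q ℕ.+ q)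

  n≡4n₄ : n ≡ 4 ℕ.* n₄
  n≡4n₄ = expand m
    where
    expand : ∀ m → 2 ℕ.+ ((m ℕ.* m ℕ.+ suc m ℕ.* suc m) ℕ.+ (m ℕ.* m ℕ.+ suc m ℕ.* suc m)) ≡ 4 ℕ.* (m ℕ.* m ℕ.+ m ℕ.+ 1)
    expand = ℕ-ring

  evenSqrtFloor-unique : ∀ k → IsEvenSqrtFloor n k → k ≡ m ℕ.* 2
  evenSqrtFloor-unique k (divides j refl , k²≤n , n<[k+2]²) = cong (ℕ._* 2) (ℕₚ.≤-antisym j≤m m≤j)
    where
    j²≤n₄ : j ℕ.* j ≤ n₄
    j²≤n₄ = ℕₚ.*-cancelˡ-≤ 4 (ℕₚ.≤-trans (ℕₚ.≤-reflexive (square j)) (ℕₚ.≤-trans k²≤n (ℕₚ.≤-reflexive n≡4n₄)))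
      where
      square : ∀ j → 4 ℕ.* (j ℕ.* j) ≡ j ℕ.* 2 ℕ.* (j ℕ.* 2)
      square = ℕ-ring
    n₄<[j+1]² : n₄ < suc j ℕ.* suc j
    n₄<[j+1]² = ℕₚ.*-cancelˡ-< 4 n₄ (suc j ℕ.* suc j) (ℕₚ.≤-trans (ℕₚ.≤-reflexive (cong suc (sym n≡4n₄))) (ℕₚ.≤-trans n<[k+2]² (ℕₚ.≤-reflexive (square j))))
      where
      square : ∀ j → (j ℕ.* 2 ℕ.+ 2) ℕ.* (j ℕ.* 2 ℕ.+ 2) ≡ 4 ℕ.* (suc j ℕ.* suc j)
      square = ℕ-ring
    j≤m : j ≤ m
    j≤m = ℕₚ.≮⇒≥ λ m<j → ℕₚ.<⇒≱ (n₄<[m+1]²) (ℕₚ.≤-trans (ℕₚ.*-mono-≤ m<j m<j) j²≤n₄)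
      where
      expand : ∀ m′ → let m = suc m′ in suc (m ℕ.* m ℕ.+ m ℕ.+ 1) ℕ.+ m′ ≡ suc m ℕ.* suc m
      expand = ℕ-ring
      n₄<[m+1]² : n₄ < suc m ℕ.* suc m
      n₄<[m+1]² = ℕₚ.≤-trans (ℕₚ.m≤m+n (suc n₄) m′) (ℕₚ.≤-reflexive (expand m′))
    m≤j : m ≤ j
    m≤j = ℕₚ.≮⇒≥ λ j<m → ℕₚ.<⇒≱ n₄<[j+1]² (ℕₚ.≤-trans (ℕₚ.*-mono-≤ j<m j<m) (ℕₚ.≤-trans (ℕₚ.m≤m+n (m ℕ.* m) m) (ℕₚ.m≤m+n (m ℕ.* m ℕ.+ m) 1)))

  private
    +n : + n ≡ + 4 * (+ m * + m + + m + + 1)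
    +n = trans (cong +_ n≡4n₄) (trans (ℤₚ.pos-* 4 n₄) (cong (λ x → + 4 * (x + + m + + 1)) (ℤₚ.pos-* m m)))

    +[a+b]² : ∀ a b → + ((a ℕ.+ b) ℕ.* (a ℕ.+ b)) ≡ (+ a + + b) * (+ a + + b)
    +[a+b]² a b = ℤₚ.pos-* (a ℕ.+ b) (a ℕ.+ b)

    +k : + (m ℕ.* 2) ≡ + m * + 2
    +k = ℤₚ.pos-* m 2

    below : ∣ + n - + (m ℕ.* 2 ℕ.* (m ℕ.* 2)) ∣ ≡ 4 ℕ.+ 4 ℕ.* m
    below = cong ∣_∣ (trans (cong₂ _-_ +n (trans (ℤₚ.pos-* (m ℕ.* 2) (m ℕ.* 2)) (cong (λ x → x * x) +k)))
      (trans (expand (+ m)) (cong (λ x → + 4 + x) (sym (ℤₚ.pos-* 4 m)))))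
      where
      expand : ∀ m → + 4 * (m * m + m + + 1) - m * + 2 * (m * + 2) ≡ + 4 + + 4 * m
      expand = ℤ-ring

    above : ∣ + n - + ((m ℕ.* 2 ℕ.+ 2) ℕ.* (m ℕ.* 2 ℕ.+ 2)) ∣ ≡ 4 ℕ.* m
    above = trans (cong ∣_∣ (trans (cong₂ _-_ +n (trans (+[a+b]² (m ℕ.* 2) 2) (cong (λ x → (x + + 2) * (x + + 2)) +k)))
      (trans (expand (+ m)) (cong -_ (sym (ℤₚ.pos-* 4 m)))))) (ℤₚ.∣-i∣≡∣i∣ (+ (4 ℕ.* m)))
      where
      expand : ∀ m → + 4 * (m * m + m + + 1) - (m * + 2 + + 2) * (m * + 2 + + 2) ≡ - (+ 4 * m)
      expand = ℤ-ring

    ≮⇒<ᵇ≡false : ∀ a b → ¬ a < b → (a <ᵇ b) ≡ false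
    ≮⇒<ᵇ≡false a b a≮b with a <ᵇ b in eq
    ... | false = refl
    ... | true  = contradiction (ℕₚ.<ᵇ⇒< a b (subst Bool.T (sym eq) tt)) a≮b

  tOf≡ : tOf n (m ℕ.* 2) ≡ + m * + 2 - + 2
  tOf≡ = trans (cong (λ b → if b then + (m ℕ.* 2) else + (m ℕ.* 2) - + 2)
      (trans (cong₂ _<ᵇ_ below above) (≮⇒<ᵇ≡false (4 ℕ.+ 4 ℕ.* m) (4 ℕ.* m) (ℕₚ.≤⇒≯ (ℕₚ.m≤n+m (4 ℕ.* m) 4)))))
    (cong (_- + 2) +k)

  private
    intPart-exact : ∀ x d → intPart (+ (x ℕ.* suc d)) (+ suc d) ≡ + x
    intPart-exact x d = cong +_ (m*n/n≡m x (suc d))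

  sOf≡ : sOf n (m ℕ.* 2) ≡ + n₄
  sOf≡ = trans (cong₂ intPart numerator denominator) (intPart-exact n₄ (m′ ℕ.+ 15 ℕ.* m))
    where
    numerator : + n * ((tOf n (m ℕ.* 2) + + 4) * (tOf n (m ℕ.* 2) + + 4) - + n) ≡ + (n₄ ℕ.* (16 ℕ.* m))
    numerator = begin
      + n * ((tOf n (m ℕ.* 2) + + 4) * (tOf n (m ℕ.* 2) + + 4) - + n)
        ≡⟨ cong₂ (λ x y → x * ((y + + 4) * (y + + 4) - x)) +n tOf≡ ⟩
      (+ 4 * N₄) * ((+ m * + 2 - + 2 + + 4) * (+ m * + 2 - + 2 + + 4) - (+ 4 * N₄))
        ≡⟨ cong ((+ 4 * N₄) *_) (expand (+ m)) ⟩
      (+ 4 * N₄) * (+ 4 * + m)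
        ≡⟨ collect N₄ (+ m) ⟩
      N₄ * (+ 16 * + m)
        ≡⟨ cong₂ _*_ (cong (λ x → x + + m + + 1) (sym (ℤₚ.pos-* m m))) (sym (ℤₚ.pos-* 16 m)) ⟩
      + n₄ * + (16 ℕ.* m)
        ≡⟨ ℤₚ.pos-* n₄ (16 ℕ.* m) ⟨
      + (n₄ ℕ.* (16 ℕ.* m)) ∎
      where
      N₄ : ℤ
      N₄ = + m * + m + + m + + 1
      expand : ∀ m → (m * + 2 - + 2 + + 4) * (m * + 2 - + 2 + + 4) - + 4 * (m * m + m + + 1) ≡ + 4 * m
      expand = ℤ-ring
      collect : ∀ a m → (+ 4 * a) * (+ 4 * m) ≡ a * (+ 16 * m)
      collect = ℤ-ring
    denominator : + 8 * tOf n (m ℕ.* 2) + + 16 ≡ + (16 ℕ.* m)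
    denominator = trans (cong (λ x → + 8 * x + + 16) tOf≡) (trans (expand (+ m)) (sym (ℤₚ.pos-* 16 m)))
      where
      expand : ∀ m → + 8 * (m * + 2 - + 2) + + 16 ≡ + 16 * m
      expand = ℤ-ring

  excessBound≡ : ∀ k → IsEvenSqrtFloor n k → excessBound n k ≡ + n * (+ 2 * + m + + 1)
  excessBound≡ k is with evenSqrtFloor-unique k is
  ... | refl = begin
    + n * (tOf n (m ℕ.* 2) + + 4) - + 4 * sOf n (m ℕ.* 2)
      ≡⟨ cong₂ (λ x y → + n * (x + + 4) - + 4 * y) tOf≡ sOf≡ ⟩
    + n * (+ m * + 2 - + 2 + + 4) - + 4 * + n₄
      ≡⟨ cong (λ x → + n * (+ m * + 2 - + 2 + + 4) - x) (trans (sym (ℤₚ.pos-* 4 n₄)) (cong +_ (sym n≡4n₄))) ⟩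
    + n * (+ m * + 2 - + 2 + + 4) - + n
      ≡⟨ collect (+ n) (+ m) ⟩
    + n * (+ 2 * + m + + 1) ∎
    where
    collect : ∀ n m → n * (m * + 2 - + 2 + + 4) - n ≡ n * (+ 2 * m + + 1)
    collect = ℤ-ring

  ±suc : ∀ i k → ∣ i ∣ ≡ suc k → (∣ i + + 1 ∣ ≡ suc (suc k) × ∣ i - + 1 ∣ ≡ k) ⊎ (∣ i + + 1 ∣ ≡ k × ∣ i - + 1 ∣ ≡ suc (suc k))
  ±suc (+ suc k)  k refl = inj₁ (cong suc (ℕₚ.+-comm k 1) , refl)
  ±suc -[1+ k ]   k refl = inj₂ (abs-⊖ k , cong (suc ∘ suc) (ℕₚ.+-identityʳ k))
    where
    abs-⊖ : ∀ k → ∣ -[1+ k ] + + 1 ∣ ≡ k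
    abs-⊖ zero    = refl
    abs-⊖ (suc k) = refl

module PrimitiveSum {q : ℕ} (F : FiniteField q) (t : ℕ) (0<t : 0 < t) (q≡1+4t : q ≡ 1+4× t)
  {p : ℕ} (e : ℕ) (p-prime : Prime p) (p∤2 : ¬ p ∣ 2) (q≡p^e : q ≡ p ℕ.^ suc e)
  (s : ℕ) (p≡1+4s : p ≡ 1+4× s) where
  open CharacterSums F t 0<t q≡1+4t using (A; B)
  open Paley F t 0<t q≡1+4t using (A²+B²≡q)
  open Primitivity F t 0<t q≡1+4t {p} {suc e} p-prime q≡p^e s p≡1+4s using (p∤AB)
  open TwoSquares p-prime p∤2 using (Primitive)

  AB-primitive : Primitive e A B
  AB-primitive = record
    { norm = trans A²+B²≡q (cong +_ q≡p^e)
    ; coprime = λ { (p∣A , p∣B) → p∤AB (ℤ∣.∣⇒∣ᵤ p∣A , ℤ∣.∣⇒∣ᵤ p∣B) } }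

MaxExcess : ∀ {n} → Matrix n → Set
MaxExcess {n} H = IsHadamard n H × IsBiregular H × HasMaxExcess H

Rescaling : ∀ {q} → FiniteField q → Set
Rescaling {q} F = Σ (Fin (2 ℕ.+ (q ℕ.+ q)) → Bool) λ r → Σ (Fin (2 ℕ.+ (q ℕ.+ q)) → Bool) λ c →
  MaxExcess (rescale r c (Construction.H F))

module RescaledPaley (m′ : ℕ) (F : FiniteField (Bound.q m′))
  (p e : ℕ) (p-prime : Prime p) (q≡p^e : Bound.q m′ ≡ p ℕ.^ suc e)
  (s : ℕ) (0<s : 0 < s) (p≡1+4s : p ≡ 1+4× s)
  (t : ℕ) (0<t : 0 < t) (q≡1+4t : Bound.q m′ ≡ 1+4× t) where
  open import Data.Integer using (_+_; _*_; -_; _-_)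
  open Bound m′
  open Construction F using (H)
  open CharacterSums F t 0<t q≡1+4t using (A; B)
  open Paley F t 0<t q≡1+4t

  private
    p∤2 : ¬ p ∣ 2
    p∤2 = 1mod4-∤2 0<s p≡1+4s
    open TwoSquares p-prime p∤2 using (Primitive; sameSquares)
    open OddPower p-prime p∤2 using (p∤1)
    open PrimitiveSum F t 0<t q≡1+4t e p-prime p∤2 q≡p^e s p≡1+4s using (AB-primitive)

  private
    m-primitive : Primitive e (+ m) (+ suc m)
    m-primitive = record
      { norm = trans (cong₂ _+_ (sym (ℤₚ.pos-* m m)) (sym (ℤₚ.pos-* (suc m) (suc m)))) (cong +_ q≡p^e)
      ; coprime = λ { (p∣m , p∣1+m) → p∤1 (ℤ∣.∣m+n∣n⇒∣m {+ p} {+ 1} {+ m} p∣1+m p∣m) } }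

  rowSign colSignᵇ : Fin n → Bool
  rowSign i = isNegative (signedRow i)
  colSignᵇ j = isNegative (colSign j)

  H* : Matrix n
  H* = rescale rowSign colSignᵇ H

  rowSum-H* : ∀ i → rowSum H* i ≡ + ∣ signedRow i ∣
  rowSum-H* i = begin
    ∑ (λ j → sign (rowSign i) * H i j * sign (colSignᵇ j))
      ≡⟨ ∑-cong (λ j → trans (cong (sign (rowSign i) * H i j *_) (sign-isNegative-±1 (colSign-±1 j))) (ℤₚ.*-assoc (sign (rowSign i)) (H i j) (colSign j))) ⟩
    ∑ (λ j → sign (rowSign i) * (H i j * colSign j))
      ≡⟨ ∑-*ˡ (sign (rowSign i)) (λ j → H i j * colSign j) ⟩
    sign (rowSign i) * signedRow i
      ≡⟨ sign-isNegative (signedRow i) ⟩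
    + ∣ signedRow i ∣ ∎

  private
    conclude : ∀ α β → α ≢ β → (∀ i → ∣ signedRow i ∣ ≡ α ⊎ ∣ signedRow i ∣ ≡ β) →
      (∃ λ i → ∣ signedRow i ∣ ≡ α) → (∃ λ i → ∣ signedRow i ∣ ≡ β) →
      (α ℕ.+ β) ℕ.* (2 ℕ.* m ℕ.+ 1) ≡ n ℕ.+ α ℕ.* β → .{{_ : NonZero (α ℕ.+ β)}} → MaxExcess H*
    conclude α β α≢β values (i , ei) (j , ej) identity =
        rescale-hadamard rowSign colSignᵇ H hadamard
      , (+ α , + β , (λ e → α≢β (ℤₚ.+-injective e)) , ℤ.+≤+ z≤n , ℤ.+≤+ z≤n
        , (λ l → Sum.map (λ e → trans (rowSum-H* l) (cong +_ e)) (λ e → trans (rowSum-H* l) (cong +_ e)) (values l))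
        , (i , trans (rowSum-H* i) (cong +_ ei)) , (j , trans (rowSum-H* j) (cong +_ ej)))
      , λ k is → trans excess≡ (sym (excessBound≡ k is))
      where
      E : ℤ
      E = ∑ (λ i → + ∣ signedRow i ∣)
      squares : + n * + n ≡ (+ α + + β) * E + - (+ α * + β) * + n
      squares = begin
        + n * + n ≡⟨ ∑signedRow² ⟨
        ∑ (λ i → signedRow i * signedRow i) ≡⟨ ∑-cong (λ i → ∣i∣²≡i² (signedRow i)) ⟨
        ∑ (λ i → + ∣ signedRow i ∣ * + ∣ signedRow i ∣) ≡⟨ twoValued-sum (λ i → ∣ signedRow i ∣) α β values ⟩
        (+ α + + β) * E + - (+ α * + β) * + n ∎
      identity′ : (+ α + + β) * (+ 2 * + m + + 1) ≡ + n + + α * + β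
      identity′ = trans (trans (cong (λ x → (+ α + + β) * (x + + 1)) (sym (ℤₚ.pos-* 2 m))) (sym (ℤₚ.pos-* (α ℕ.+ β) (2 ℕ.* m ℕ.+ 1))))
        (trans (cong +_ identity) (cong (λ x → + n + x) (ℤₚ.pos-* α β)))
      E≡ : E ≡ + n * (+ 2 * + m + + 1)
      E≡ = ℤₚ.*-cancelˡ-≡ (+ (α ℕ.+ β)) E (+ n * (+ 2 * + m + + 1)) (begin
        (+ α + + β) * E ≡⟨ isolate ((+ α + + β) * E) (+ α * + β) (+ n) ⟩
        ((+ α + + β) * E + - (+ α * + β) * + n) + (+ α * + β) * + n ≡⟨ cong (_+ (+ α * + β) * + n) squares ⟨
        + n * + n + (+ α * + β) * + n ≡⟨ collect (+ n) (+ α * + β) ⟩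
        + n * (+ n + + α * + β) ≡⟨ cong (+ n *_) identity′ ⟨
        + n * ((+ α + + β) * (+ 2 * + m + + 1)) ≡⟨ swap (+ n) (+ α + + β) (+ 2 * + m + + 1) ⟩
        (+ α + + β) * (+ n * (+ 2 * + m + + 1)) ∎)
        where
        isolate : ∀ x y n → x ≡ (x + - y * n) + y * n
        isolate = ℤ-ring
        collect : ∀ n y → n * n + y * n ≡ n * (n + y)
        collect = ℤ-ring
        swap : ∀ a b c → a * (b * c) ≡ b * (a * c)
        swap = ℤ-ring
      excess≡ : excess H* ≡ + n * (+ 2 * + m + + 1)
      excess≡ = trans (∑-cong rowSum-H*) E≡

    rows : ∀ a y → ∣ A ∣ ≡ a → (∣ B + + 1 ∣ ≡ y × ∣ B - + 1 ∣ ≡ a) ⊎ (∣ B + + 1 ∣ ≡ a × ∣ B - + 1 ∣ ≡ y) →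
      (∀ i → ∣ signedRow i ∣ ≡ 2 ℕ.* a ⊎ ∣ signedRow i ∣ ≡ 2 ℕ.* y) × (∃ λ i → ∣ signedRow i ∣ ≡ 2 ℕ.* a) × (∃ λ i → ∣ signedRow i ∣ ≡ 2 ℕ.* y)
    rows a y ∣A∣ (inj₁ (B+1 , B-1)) =
        (λ i → [ (λ e → inj₁ (via ∣A∣ e)) , [ (λ e → inj₂ (via B+1 e)) , (λ e → inj₁ (via B-1 e)) ]′ ]′ (signedRow-value i))
      , (proj₁ row-B-1 , via B-1 (proj₂ row-B-1)) , (proj₁ row-B+1 , via B+1 (proj₂ row-B+1))
      where
      via : ∀ {x b c : ℕ} → b ≡ c → x ≡ 2 ℕ.* b → x ≡ 2 ℕ.* c
      via refl e = e
    rows a y ∣A∣ (inj₂ (B+1 , B-1)) =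
        (λ i → [ (λ e → inj₁ (via ∣A∣ e)) , [ (λ e → inj₁ (via B+1 e)) , (λ e → inj₂ (via B-1 e)) ]′ ]′ (signedRow-value i))
      , (proj₁ row-B+1 , via B+1 (proj₂ row-B+1)) , (proj₁ row-B-1 , via B-1 (proj₂ row-B-1))
      where
      via : ∀ {x b c : ℕ} → b ≡ c → x ≡ 2 ℕ.* b → x ≡ 2 ℕ.* c
      via refl e = e

    2*-≢ : ∀ a b → a ≢ b → 2 ℕ.* a ≢ 2 ℕ.* b
    2*-≢ a b a≢b e = a≢b (ℕₚ.*-cancelˡ-≡ a b 2 e)

    case-A≡m : ∣ A ∣ ≡ m → ∣ B ∣ ≡ suc m → MaxExcess H*
    case-A≡m ∣A∣ ∣B∣ = let values , attained₁ , attained₂ = rows m (suc (suc m)) ∣A∣ (±suc B m ∣B∣) in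
      conclude (2 ℕ.* m) (2 ℕ.* suc (suc m)) (2*-≢ m (suc (suc m)) (λ e → ℕₚ.<⇒≢ (ℕₚ.m<n⇒m<1+n (ℕₚ.n<1+n m)) e)) values attained₁ attained₂ (identity m)
      where
      identity : ∀ m → (2 ℕ.* m ℕ.+ 2 ℕ.* suc (suc m)) ℕ.* (2 ℕ.* m ℕ.+ 1)
        ≡ 2 ℕ.+ ((m ℕ.* m ℕ.+ suc m ℕ.* suc m) ℕ.+ (m ℕ.* m ℕ.+ suc m ℕ.* suc m)) ℕ.+ 2 ℕ.* m ℕ.* (2 ℕ.* suc (suc m))
      identity = ℕ-ring

    case-A≡m+1 : ∣ A ∣ ≡ suc m → ∣ B ∣ ≡ m → MaxExcess H*
    case-A≡m+1 ∣A∣ ∣B∣ = let values , attained₁ , attained₂ = rows (suc m) m′ ∣A∣ (Sum.swap (±suc B m′ ∣B∣)) in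
      conclude (2 ℕ.* suc m) (2 ℕ.* m′) (2*-≢ (suc m) m′ (λ e → ℕₚ.<⇒≢ (ℕₚ.m<n⇒m<1+n (ℕₚ.n<1+n m′)) (sym e))) values attained₁ attained₂ (identity m′)
      where
      identity : ∀ m′ → let m = suc m′ in (2 ℕ.* suc m ℕ.+ 2 ℕ.* m′) ℕ.* (2 ℕ.* m ℕ.+ 1)
        ≡ 2 ℕ.+ ((m ℕ.* m ℕ.+ suc m ℕ.* suc m) ℕ.+ (m ℕ.* m ℕ.+ suc m ℕ.* suc m)) ℕ.+ 2 ℕ.* suc m ℕ.* (2 ℕ.* m′)
      identity = ℕ-ring

  rescaling : Rescaling F
  rescaling = rowSign , colSignᵇ ,
    [ (λ { (a² , b²) → case-A≡m (i²≡j²⇒∣i∣≡∣j∣ A (+ m) a²) (i²≡j²⇒∣i∣≡∣j∣ B (+ suc m) b²) })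
    , (λ { (a² , b²) → case-A≡m+1 (i²≡j²⇒∣i∣≡∣j∣ A (+ suc m) a²) (i²≡j²⇒∣i∣≡∣j∣ B (+ m) b²) }) ]′
    (sameSquares e AB-primitive m-primitive)

odd-part : ∀ e → 0 < e → ∃ λ k → ∃ λ h → e ≡ 2 ℕ.^ k ℕ.* suc (h ℕ.+ h)
odd-part = <-rec (λ e → 0 < e → ∃ λ k → ∃ λ h → e ≡ 2 ℕ.^ k ℕ.* suc (h ℕ.+ h)) step
  where
  step : ∀ e → (∀ {d} → d < e → 0 < d → ∃ λ k → ∃ λ h → d ≡ 2 ℕ.^ k ℕ.* suc (h ℕ.+ h)) →
    0 < e → ∃ λ k → ∃ λ h → e ≡ 2 ℕ.^ k ℕ.* suc (h ℕ.+ h)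
  step e rec 0<e with ℕ-parity e
  ... | h , inj₂ refl = 0 , h , sym (ℕₚ.*-identityˡ (suc (h ℕ.+ h)))
  ... | zero , inj₁ refl = contradiction 0<e λ ()
  ... | d@(suc _) , inj₁ refl = let k , h , d≡ = rec (ℕₚ.m<m+n d (s≤s z≤n)) (s≤s z≤n) in
    suc k , h , trans (cong₂ ℕ._+_ d≡ d≡) (double (2 ℕ.^ k) (suc (h ℕ.+ h)))
    where
    double : ∀ a b → a ℕ.* b ℕ.+ a ℕ.* b ≡ 2 ℕ.* a ℕ.* b
    double = ℕ-ring

module PrimePower (m′ : ℕ) (p e : ℕ) (p-prime : Prime p) (q≡p^e : Bound.q m′ ≡ p ℕ.^ suc e) where
  open Bound m′ using (m; q)

  abstract
    p∣q : p ∣ q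
    p∣q = subst (p ∣_) (sym q≡p^e) (∣.m∣m*n (p ℕ.^ e))

    p∤2 : ¬ p ∣ 2
    p∤2 p∣2 = [ (λ p≡1 → contradiction p≡1 (ℕ.nonTrivial⇒≢1 {{prime⇒nonTrivial p-prime}})) , (λ p≡2 → q-odd (subst (_∣ q) p≡2 p∣q)) ]′ (prime⇒irreducible prime[2] p∣2)
      where
      odd : ∀ m → m ℕ.* m ℕ.+ suc m ℕ.* suc m ≡ (m ℕ.* m ℕ.+ m) ℕ.* 2 ℕ.+ 1
      odd = ℕ-ring
      q-odd : ¬ 2 ∣ q
      q-odd 2∣q = contradiction (∣.∣1⇒≡1 (∣.∣m+n∣m⇒∣n (subst (2 ∣_) (odd m) 2∣q) (∣.n∣m*n (m ℕ.* m ℕ.+ m)))) λ ()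

    p-1mod4 : ∃ λ s → 0 < s × p ≡ 1+4× s
    p-1mod4 = prime-1mod4 p-prime p∤2 m p∣q

  s : ℕ
  s = proj₁ p-1mod4

  0<s : 0 < s
  0<s = proj₁ (proj₂ p-1mod4)

  p≡1+4s : p ≡ 1+4× s
  p≡1+4s = proj₂ (proj₂ p-1mod4)

  abstract
    q-1mod4 : ∃ λ t → 0 < t × q ≡ 1+4× t
    q-1mod4 = let t , 0<t , e≡ = 1mod4-^ s p≡1+4s 0<s (suc e) (s≤s z≤n) in t , 0<t , trans q≡p^e e≡

  rescaling : (F : FiniteField q) → Rescaling F
  rescaling F = RescaledPaley.rescaling m′ F p e p-prime q≡p^e s 0<s p≡1+4s (proj₁ q-1mod4) (proj₁ (proj₂ q-1mod4)) (proj₂ (proj₂ q-1mod4))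

  private
    no-odd-part : ∀ k → FiniteField (p ℕ.^ (2 ℕ.^ k)) → ∀ h → 0 < h → suc e ≢ 2 ℕ.^ k ℕ.* suc (h ℕ.+ h)
    no-odd-part k F h 0<h e≡ = lemma (1mod4-^ s p≡1+4s 0<s (2 ℕ.^ k) (0<2^k k))
      where
      f : ℕ
      f = pred (2 ℕ.^ k)
      1+f≡2^k : suc f ≡ 2 ℕ.^ k
      1+f≡2^k = ℕₚ.suc-pred (2 ℕ.^ k) {{ℕ.>-nonZero (0<2^k k)}}
      q≡ : + m ℤ.* + m ℤ.+ (+ m ℤ.+ + 1) ℤ.* (+ m ℤ.+ + 1) ≡ + ((p ℕ.^ suc f) ℕ.^ suc (h ℕ.+ h))
      q≡ = begin
        + m ℤ.* + m ℤ.+ (+ m ℤ.+ + 1) ℤ.* (+ m ℤ.+ + 1) ≡⟨ cong (λ x → + m ℤ.* + m ℤ.+ x ℤ.* x) (ℤₚ.+-comm (+ m) (+ 1)) ⟩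
        + m ℤ.* + m ℤ.+ + suc m ℤ.* + suc m ≡⟨ cong₂ ℤ._+_ (sym (ℤₚ.pos-* m m)) (sym (ℤₚ.pos-* (suc m) (suc m))) ⟩
        + q ≡⟨ cong +_ (trans q≡p^e (trans (cong (p ℕ.^_) e≡) (sym (ℕₚ.^-*-assoc p (2 ℕ.^ k) (suc (h ℕ.+ h)))))) ⟩
        + ((p ℕ.^ (2 ℕ.^ k)) ℕ.^ suc (h ℕ.+ h)) ≡⟨ cong (λ x → + ((p ℕ.^ x) ℕ.^ suc (h ℕ.+ h))) (sym 1+f≡2^k) ⟩
        + ((p ℕ.^ suc f) ℕ.^ suc (h ℕ.+ h)) ∎
      lemma : (∃ λ t → 0 < t × p ℕ.^ (2 ℕ.^ k) ≡ 1+4× t) → ⊥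
      lemma (t , 0<t , q≡1+4t) = OddPower.no-odd-power p-prime p∤2 f
        (PrimitiveSum.AB-primitive F t 0<t q≡1+4t f p-prime p∤2 (cong (p ℕ.^_) (sym 1+f≡2^k)) s p≡1+4s) h 0<h (+ m) q≡

  abstract
    field-of-order-q : FiniteField q
    field-of-order-q = let k , h , e≡ = odd-part (suc e) (s≤s z≤n) in build k h e≡
      where
      build : ∀ k h → suc e ≡ 2 ℕ.^ k ℕ.* suc (h ℕ.+ h) → FiniteField q
      build k zero e≡ = subst FiniteField (sym (trans q≡p^e (cong (p ℕ.^_) (trans e≡ (ℕₚ.*-identityʳ (2 ℕ.^ k)))))) (fieldTower p-prime s p≡1+4s 0<s k)
      build k h@(suc _) e≡ = contradiction e≡ (no-odd-part k (fieldTower p-prime s p≡1+4s 0<s k) h (s≤s z≤n))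

consecutive-squares : ∀ m → let q = m ℕ.* m ℕ.+ suc m ℕ.* suc m in IsPrimePower q →
  Σ (Matrix (2 ℕ.+ (q ℕ.+ q))) MaxExcess × ((F : FiniteField q) → Rescaling F)
consecutive-squares zero (p , suc e , p-prime , _ , 1≡p^e) =
  contradiction (ℕₚ.m*n≡1⇒m≡1 p (p ℕ.^ e) (sym 1≡p^e)) (ℕ.nonTrivial⇒≢1 {{prime⇒nonTrivial p-prime}})
consecutive-squares (suc m′) (p , suc e , p-prime , _ , q≡p^e) =
  let r , c , maxExcess = rescaling field-of-order-q in (rescale r c (Construction.H field-of-order-q) , maxExcess) , rescaling
  where open PrimePower m′ p e p-prime q≡p^e

qOf-consecutive : ∀ m → ∃ λ k → qOf m ≡ k ℕ.* k ℕ.+ suc k ℕ.* suc k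
qOf-consecutive (+ n) = n , cong ∣_∣ (trans (expand (+ n)) (sym (trans (cong₂ ℤ._+_ (ℤₚ.pos-* n n) (ℤₚ.pos-* (suc n) (suc n))) refl)))
  where
  expand : ∀ n → + 2 ℤ.* n ℤ.* n ℤ.+ + 2 ℤ.* n ℤ.+ + 1 ≡ n ℤ.* n ℤ.+ (+ 1 ℤ.+ n) ℤ.* (+ 1 ℤ.+ n)
  expand = ℤ-ring
qOf-consecutive -[1+ n ] = n , cong ∣_∣ (trans (expand (+ n)) (sym (cong₂ ℤ._+_ (ℤₚ.pos-* n n) (ℤₚ.pos-* (suc n) (suc n)))))
  where
  expand : ∀ n → + 2 ℤ.* (ℤ.- (+ 1 ℤ.+ n)) ℤ.* (ℤ.- (+ 1 ℤ.+ n)) ℤ.+ + 2 ℤ.* (ℤ.- (+ 1 ℤ.+ n)) ℤ.+ + 1 ≡ n ℤ.* n ℤ.+ (+ 1 ℤ.+ n) ℤ.* (+ 1 ℤ.+ n)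
  expand = ℤ-ring

open import Data.Nat using (_+_)

theorem1p3 : (m : ℤ) → IsPrimePower (qOf m) →
    (Σ (Matrix (2 + (qOf m + qOf m))) λ H′ →
    IsHadamard (2 + (qOf m + qOf m)) H′ × IsBiregular H′ × HasMaxExcess H′)
    × ((F : FiniteField (qOf m)) →
    Σ (Fin (2 + (qOf m + qOf m)) → Bool) λ r →
    Σ (Fin (2 + (qOf m + qOf m)) → Bool) λ c →
    IsHadamard (2 + (qOf m + qOf m)) (rescale r c (Construction.H F))
    × IsBiregular (rescale r c (Construction.H F))
    × HasMaxExcess (rescale r c (Construction.H F)))
theorem1p3 m = let k , qOf≡ = qOf-consecutive m in
  subst (λ q → IsPrimePower q → Σ (Matrix (2 + (q + q))) MaxExcess × ((F : FiniteField q) → Rescaling F)) (sym qOf≡) (consecutive-squares k)
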